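{- There exist additively free hyperplane arrangements $\mathcal{A}$ such that for some $H_0\in\mathcal{A}$ the Ziegler restriction $(\mathcal{A}^{H_0},\kappa)$ is not additively free.
   Context: An arrangement $\mathcal{A}$ is a finite set of linear hyperplanes in $V=\mathbb{K}^\ell$ ($\mathbb{K}$ a field), $H=\ker\alpha_H$, $S=\mathbb{K}[x_1,\dots,x_\ell]$. For a multiplicity $\mu:\mathcal{A}\to\mathbb{Z}_{\ge0}$, $|\mu|=\sum_H\mu(H)$ and $D(\mathcal{A},\mu)=\{\theta\in\mathrm{Der}(S):\theta(\alpha_H)\in\alpha_H^{\mu(H)}S\ \forall H\}$; $(\mathcal{A},\mu)$ is free if this is a free $S$-module. A multiarrangement $(\mathcal{A},\mu)$ is additively free if there are multiplicities $\mu_0<\mu_1<\dots<\mu_n=\mu$ (pointwise order) with each $(\mathcal{A},\mu_i)$ free and $|\mu_i|=i$; a simple arrangement $\mathcal{A}$ is additively free if $(\mathcal{A},\mathbb{1})$ is, i.e. there is a chain $\emptyset=\mathcal{A}_0\subset\dots\subset\mathcal{A}_n=\mathcal{A}$ of free arrangements with $|\mathcal{A}_i|=i$. For $H_0\in\mathcal{A}$, the Ziegler restriction is $(\mathcal{A}^{H_0},\kappa)$ with $\mathcal{A}^{H_0}=\{H_0\cap H:H\in\mathcal{A}\setminus\{H_0\}\}$ and $\kappa(Y)$ the number of hyperplanes in $\mathcal{A}\setminus\{H_0\}$ containing $Y$. -}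

module Defs where

open import Data.Nat using (ℕ; zero; suc; _≤_; _<_)
open import Data.Fin using (Fin; punchIn) renaming (zero to fzero; suc to fsuc)
open import Data.Fin.Properties using () renaming (_≟_ to _≟ᶠ_)
open import Data.Rational using (ℚ; 0ℚ; 1ℚ; _+_; _*_; _-_)
open import Data.List using (List; length; filter; map; allFin)
open import Data.Nat.ListAction using (sum)
open import Data.Product using (Σ; ∃; _×_; _,_)
open import Relation.Binary.PropositionalEquality using (_≡_; _≢_)
open import Relation.Nullary using (¬_)

open import Relation.Nullary.Decidable using (_×-dec_; ¬?)

-- The ground field K is taken to be ℚ.

-- Linear forms on K^ℓ, given by their coefficient vectors.
Form : ℕ → Set
Form ℓ = Fin ℓ → ℚ

Proportional : ∀ {ℓ} → Form ℓ → Form ℓ → Set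
Proportional {ℓ} a b = Σ ℚ λ c → (c ≢ 0ℚ) × (∀ i → a i ≡ c * b i)

-- Polynomial ring S = K[x₁,…,x_ℓ]: the free commutative K-algebra on
-- ℓ generators, presented as terms modulo the commutative-ring laws
-- and the laws making  con : K → S  a ring homomorphism.

infixl 6 _⊕_
infixl 7 _⊗_

data Poly (ℓ : ℕ) : Set where
  con : ℚ → Poly ℓ
  var : Fin ℓ → Poly ℓ
  _⊕_ : Poly ℓ → Poly ℓ → Poly ℓ
  _⊗_ : Poly ℓ → Poly ℓ → Poly ℓ
  ⊝_  : Poly ℓ → Poly ℓ

𝟘 𝟙 : ∀ {ℓ} → Poly ℓ
𝟘 = con 0ℚ
𝟙 = con 1ℚ

infix 4 _≈_
data _≈_ {ℓ : ℕ} : Poly ℓ → Poly ℓ → Set where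
  ≈-refl  : ∀ {p} → p ≈ p
  ≈-sym   : ∀ {p q} → p ≈ q → q ≈ p
  ≈-trans : ∀ {p q r} → p ≈ q → q ≈ r → p ≈ r
  ⊕-cong  : ∀ {p p′ q q′} → p ≈ p′ → q ≈ q′ → p ⊕ q ≈ p′ ⊕ q′
  ⊗-cong  : ∀ {p p′ q q′} → p ≈ p′ → q ≈ q′ → p ⊗ q ≈ p′ ⊗ q′
  ⊝-cong  : ∀ {p p′} → p ≈ p′ → ⊝ p ≈ ⊝ p′
  ⊕-assoc : ∀ p q r → (p ⊕ q) ⊕ r ≈ p ⊕ (q ⊕ r)
  ⊕-comm  : ∀ p q → p ⊕ q ≈ q ⊕ p
  ⊕-idˡ   : ∀ p → 𝟘 ⊕ p ≈ p
  ⊕-invˡ  : ∀ p → (⊝ p) ⊕ p ≈ 𝟘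
  ⊗-assoc : ∀ p q r → (p ⊗ q) ⊗ r ≈ p ⊗ (q ⊗ r)
  ⊗-comm  : ∀ p q → p ⊗ q ≈ q ⊗ p
  ⊗-idˡ   : ∀ p → 𝟙 ⊗ p ≈ p
  distribˡ : ∀ p q r → p ⊗ (q ⊕ r) ≈ (p ⊗ q) ⊕ (p ⊗ r)
  con-+   : ∀ a b → con a ⊕ con b ≈ con (a + b)
  con-*   : ∀ a b → con a ⊗ con b ≈ con (a * b)

polySum : ∀ {ℓ m} → (Fin m → Poly ℓ) → Poly ℓ
polySum {m = zero}  f = 𝟘
polySum {m = suc m} f = f fzero ⊕ polySum (λ j → f (fsuc j))

_^_ : ∀ {ℓ} → Poly ℓ → ℕ → Poly ℓ
p ^ zero  = 𝟙
p ^ suc k = p ⊗ (p ^ k)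

lin : ∀ {ℓ} → Form ℓ → Poly ℓ
lin a = polySum (λ i → con (a i) ⊗ var i)

-- Der(S): θ = Σ θᵢ ∂/∂xᵢ, stored by its components θᵢ = θ(xᵢ).
Der : ℕ → Set
Der ℓ = Fin ℓ → Poly ℓ

applyDer : ∀ {ℓ} → Der ℓ → Form ℓ → Poly ℓ
applyDer θ a = polySum (λ i → θ i ⊗ con (a i))

record Arrangement (ℓ : ℕ) : Set where
  field
    n        : ℕ
    form     : Fin n → Form ℓ
    nonzero  : ∀ k → ∃ λ i → form k i ≢ 0ℚ
    distinct : ∀ k k′ → Proportional (form k) (form k′) → k ≡ k′
open Arrangement public

Multiplicity : ∀ {ℓ} → Arrangement ℓ → Set
Multiplicity A = Fin (n A) → ℕ

∣_∣ : ∀ {ℓ} {A : Arrangement ℓ} → Multiplicity A → ℕ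
∣_∣ {A = A} μ = sum (map μ (allFin (n A)))

InD : ∀ {ℓ} (A : Arrangement ℓ) → Multiplicity A → Der ℓ → Set
InD {ℓ} A μ θ =
  ∀ k → Σ (Poly ℓ) λ g → applyDer θ (form A k) ≈ (lin (form A k) ^ μ k) ⊗ g

Free : ∀ {ℓ} (A : Arrangement ℓ) → Multiplicity A → Set
Free {ℓ} A μ =
  Σ ℕ λ m → Σ (Fin m → Der ℓ) λ θ →
      (∀ j → InD A μ (θ j))
    × (∀ φ → InD A μ φ →
         Σ (Fin m → Poly ℓ) λ c → ∀ i → φ i ≈ polySum (λ j → c j ⊗ θ j i))
    × (∀ (c : Fin m → Poly ℓ) →
         (∀ i → polySum (λ j → c j ⊗ θ j i) ≈ 𝟘) → ∀ j → c j ≈ 𝟘)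

-- (A, μ) additively free: a chain μ₀ < μ₁ < … < μ_N = μ, |μᵢ| = i,
-- each (A, μᵢ) free.  (Strictness follows from ≤ and |μᵢ| = i.)
AdditivelyFree : ∀ {ℓ} (A : Arrangement ℓ) → Multiplicity A → Set
AdditivelyFree A μ =
  Σ (ℕ → Multiplicity A) λ c →
      (∀ i → i ≤ ∣_∣ {A = A} μ → (∣_∣ {A = A} (c i) ≡ i) × Free A (c i))
    × (∀ i → i < ∣_∣ {A = A} μ → ∀ k → c i k ≤ c (suc i) k)
    × (∀ k → c (∣_∣ {A = A} μ) k ≡ μ k)

AdditivelyFreeArr : ∀ {ℓ} → Arrangement ℓ → Set
AdditivelyFreeArr A = AdditivelyFree A (λ _ → 1)

-- Ziegler restriction.  H₀ = ker α₀ with α₀ = form A z.  A pivot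
-- coordinate j with α₀ⱼ ≠ 0 gives coordinates (x_i)_{i≠j} on H₀;
-- the restriction of β to H₀ (scaled by the nonzero constant α₀ⱼ) is
--   α₀ⱼ·β − βⱼ·α₀  with the j-th coordinate deleted.
restrictForm : ∀ {ℓ} → Form (suc ℓ) → Fin (suc ℓ) → Form (suc ℓ) → Form ℓ
restrictForm α₀ j β i = α₀ j * β (punchIn j i) - β j * α₀ (punchIn j i)

-- (B, κ) is the Ziegler restriction (A^{H₀}, κ) of A at H₀ = H_z:
-- f sends each H ≠ H₀ to the hyperplane H ∩ H₀ of B, every hyperplane of
-- B arises, and κ(Y) = #{H ∈ A ∖ {H₀} : H ∩ H₀ = Y}.
record IsZieglerRestriction {ℓ : ℕ} (A : Arrangement (suc ℓ)) (z : Fin (n A))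
         (B : Arrangement ℓ) (κ : Multiplicity B) : Set where
  field
    pivot      : Fin (suc ℓ)
    pivot≢0    : form A z pivot ≢ 0ℚ
    f          : Fin (n A) → Fin (n B)
    f-restrict : ∀ k → k ≢ z →
                 Proportional (restrictForm (form A z) pivot (form A k)) (form B (f k))
    f-onto     : ∀ y → ∃ λ k → (k ≢ z) × (f k ≡ y)
    κ-count    : ∀ y → κ y ≡
                 length (filter (λ k → ¬? (k ≟ᶠ z) ×-dec (f k ≟ᶠ y)) (allFin (n A)))

{-# OPTIONS --safe #-}
module Submission where

-- A consists of 34 hyperplanes in ℚ⁴, found by a computer search.  They can be
-- added one at a time so that each addition turns a basis of the derivation
-- module explicitly into one of the next, hence A is additively free.  The
-- restriction B of A to the hyperplane x₃ + x₄ = 0 has 23 lines, and D(B, 𝟙)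
-- has a basis θ_E, θ₂, θ₃ of degrees 1, 11, 11 such that θ₂, θ₃ even lie in
-- D(B, κ), where |κ| = 33.  For 𝟙 ≤ μ ≤ κ it follows that Πα^(μ-1) θ_E, θ₂, θ₃
-- is a basis of D(B, μ).  If μ_H = 1, then for φ in the module of μ with H
-- deleted, α_H φ is a combination of this basis; its coefficients vanish at
-- the origin, since on H no constant combination of θ₂, θ₃ is a multiple of
-- θ_E and the degrees of θ₂, θ₃ are not exceeded by that of Πα^(μ-1) θ_E.  This
-- prevents the larger module from being free.  So a chain of free multiplicities
-- descending from κ never loses a line, and cannot reach 0.

open import Defs
open import Data.Nat as ℕ using (ℕ; zero; suc; _≡ᵇ_; _≤ᵇ_)
import Data.Nat.Properties as ℕP
open import Data.Nat.Coprimality as Cop using ()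
open import Data.Integer as ℤ using (ℤ)
import Data.Integer.Properties as ℤP
open import Data.Fin as Fin using (Fin; toℕ; punchIn; punchOut; #_) renaming (zero to fzero; suc to fsuc)
open import Data.Rational as ℚ using (ℚ; 0ℚ; 1ℚ; mkℚ)
import Data.Rational.Properties as ℚᴾ
open import Data.Rational.Unnormalised using (*≡*)
import Data.Rational.Unnormalised.Properties as ℚᵘP
open import Data.List as List using (List; []; _∷_; map; length; take; drop; allFin; filter)
open import Data.List.Relation.Unary.All as All using (All; []; _∷_)
open import Data.Maybe using (Maybe; just; nothing)
open import Data.Product using (Σ; ∃; _×_; _,_; proj₁; proj₂)
open import Data.Sum using (_⊎_; inj₁; inj₂)
open import Data.Unit using (⊤; tt)
open import Data.Empty using (⊥; ⊥-elim)
open import Function using (Equivalence)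
open import Relation.Nullary using (¬_; yes; no; Dec)
open import Relation.Binary.PropositionalEquality
open import Algebra.Bundles using (CommutativeRing)
open import Algebra.Structures using (IsCommutativeRing)
open import Algebra.Solver.Ring.AlmostCommutativeRing using (fromCommutativeRing; _-Raw-AlmostCommutative⟶_)
import Algebra.Solver.Ring as RingSolver
open import Level using (0ℓ)
import Algebra.Properties.Ring as RingProperties
import Algebra.Solver.Ring.NaturalCoefficients.Default as NatSolver
import Data.Fin.Properties as FinP
open import Data.Bool using (Bool; true; false; T; _∧_; not; if_then_else_; _∨_)
open import Data.Vec as Vec using (Vec; []; _∷_; lookup; insertAt; _[_]≔_)
import Data.Vec.Properties as VecP
open import Data.Bool.Properties using (T-∧; T-∨)
open import Relation.Nullary.Decidable using (isYes; _×-dec_; ¬?)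
open import Data.Fin.Patterns using (0F; 1F; 2F)
import Data.List.Properties as ListP
open import Data.Nat.ListAction using (sum)

-- The field operations of ℚ are made opaque, so that unification treats them
-- as injective symbols instead of unfolding the normalisation of fractions.

-- Terms of `Poly` have no normal form, so nothing is proved by rewriting them. As ℚ is infinite,
-- `_≈_` amounts to equality of values at all rational points; hence divisibility by a linear form
-- becomes vanishing on its kernel, and arguments by continuity become the fact that a univariate
-- polynomial vanishing for `t ≢ 0` vanishes at 0. `Free` fixes neither the length of a basis nor
-- homogeneity of its members. A basis of a deleted multiarrangement is therefore refuted through
-- the transition matrices to a known basis, which may be rectangular, instead of through degrees or
-- determinants. The numbers fit tightly. The bases computed here have degrees 1, 11, 11, 11 for A,
-- then 1, 11, 11 for B with multiplicity one and 11, 11, 11 for (B, κ): since `κ` exceeds one by 10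
-- in total, the multiple of the Euler derivation just reaches degree 11. One unit more and the
-- comparison of degrees at the origin would fail. For A only values `θ_j(a)` on the hyperplane
-- being added are expanded, in two affine coordinates; homogeneity carries the result to the whole
-- hyperplane.

infixl 6 _+_ _-_
infixl 7 _*_
infix  8 -_

opaque
  _+_ _*_ : ℚ → ℚ → ℚ
  _+_ = ℚ._+_
  _*_ = ℚ._*_

  -_ : ℚ → ℚ
  -_ = ℚ.-_

  +-def : ∀ a b → a ℚ.+ b ≡ a + b
  +-def a b = refl

  *-def : ∀ a b → a ℚ.* b ≡ a * b
  *-def a b = refl

  neg-def : ∀ a → ℚ.- a ≡ - a
  neg-def a = refl

  isRing : IsCommutativeRing _≡_ _+_ _*_ -_ 0ℚ 1ℚ
  isRing = ℚᴾ.+-*-isCommutativeRing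

  inv : ∀ p → p ≢ 0ℚ → Σ ℚ λ r → r * p ≡ 1ℚ
  inv p p≢0 = (ℚ.1/ p) {{nz}} , ℚᴾ.*-inverseˡ p {{nz}}
    where
    nz : ℚ.NonZero p
    nz = ℚ.≢-nonZero p≢0

_-_ : ℚ → ℚ → ℚ
p - q = p + - q

ℚ-ring : CommutativeRing 0ℓ 0ℓ
ℚ-ring = record { isCommutativeRing = isRing }

module ℚP = CommutativeRing ℚ-ring renaming
  ( zeroˡ to *-zeroˡ ; zeroʳ to *-zeroʳ ; -‿inverseˡ to +-inverseˡ ; -‿inverseʳ to +-inverseʳ
  ; distribˡ to *-distribˡ-+ ; distribʳ to *-distribʳ-+ )

-- The integers inside ℚ, and products in the field ℚ

ι : ℤ → ℚ
ι z = mkℚ z 0 (Cop.sym (Cop.1-coprimeTo _))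

opaque
  unfolding _+_

  ι-+ : ∀ a b → ι (a ℤ.+ b) ≡ ι a + ι b
  ι-+ a b = ℚᴾ.toℚᵘ-injective (ℚᵘP.≃-trans
    (*≡* (cong (ℤ._* ℤ.+ 1) (cong₂ ℤ._+_ (sym (ℤP.*-identityʳ a)) (sym (ℤP.*-identityʳ b)))))
    (ℚᵘP.≃-sym (ℚᴾ.toℚᵘ-homo-+ (ι a) (ι b))))

  ι-* : ∀ a b → ι (a ℤ.* b) ≡ ι a * ι b
  ι-* a b = ℚᴾ.toℚᵘ-injective (ℚᵘP.≃-trans (*≡* refl)
    (ℚᵘP.≃-sym (ℚᴾ.toℚᵘ-homo-* (ι a) (ι b))))

  ι-neg : ∀ a → ι (ℤ.- a) ≡ - ι a
  ι-neg a = ℚᴾ.toℚᵘ-injective (ℚᵘP.≃-trans (*≡* refl)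
    (ℚᵘP.≃-sym (ℚᴾ.toℚᵘ-homo‿- (ι a))))

ι-injective : ∀ {a b} → ι a ≡ ι b → a ≡ b
ι-injective refl = refl

ιℕ : ℕ → ℚ
ιℕ n = ι (ℤ.+ n)

private
  ι-hom : ℤ.+-*-rawRing -Raw-AlmostCommutative⟶ fromCommutativeRing ℚ-ring
  ι-hom = record
    { ⟦_⟧ = ι ; +-homo = ι-+ ; *-homo = ι-* ; -‿homo = ι-neg ; 0-homo = refl ; 1-homo = refl }

  weakDec : ∀ a b → Maybe (ι a ≡ ι b)
  weakDec a b with a ℤ.≟ b
  ... | yes e = just (cong ι e)
  ... | no  _ = nothing

open RingSolver ℤ.+-*-rawRing (fromCommutativeRing ℚ-ring) ι-hom weakDec
  using (solve; _:=_; _:+_; _:*_; :-_; _:-_)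
  renaming (con to :con) public

:0 :1 : ∀ {n} → RingSolver.Polynomial ℤ.+-*-rawRing (fromCommutativeRing ℚ-ring) ι-hom weakDec n
:0 = :con (ℤ.+ 0)
:1 = :con (ℤ.+ 1)

1≢0 : 1ℚ ≢ 0ℚ
1≢0 ()

*-zero-split : ∀ p q → p * q ≡ 0ℚ → p ≢ 0ℚ → q ≡ 0ℚ
*-zero-split p q pq≡0 p≢0 with inv p p≢0
... | r , rp≡1 = begin
  q            ≡⟨ sym (ℚP.*-identityˡ q) ⟩
  1ℚ * q       ≡⟨ cong (_* q) (sym rp≡1) ⟩
  r * p * q    ≡⟨ ℚP.*-assoc r p q ⟩
  r * (p * q)  ≡⟨ cong (r *_) pq≡0 ⟩
  r * 0ℚ       ≡⟨ ℚP.*-zeroʳ r ⟩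
  0ℚ ∎
  where open ≡-Reasoning

*-nonzero : ∀ {p q} → p ≢ 0ℚ → q ≢ 0ℚ → p * q ≢ 0ℚ
*-nonzero {p} {q} p≢0 q≢0 e = q≢0 (*-zero-split p q e p≢0)

p-q≡0⇒p≡q : ∀ p q → p - q ≡ 0ℚ → p ≡ q
p-q≡0⇒p≡q p q e = trans (solve 2 (λ p q → p := (p :- q) :+ q) refl p q)
  (trans (cong (_+ q) e) (ℚP.+-identityˡ q))

p≡q⇒p-q≡0 : ∀ {p q} → p ≡ q → p - q ≡ 0ℚ
p≡q⇒p-q≡0 {p} refl = ℚP.+-inverseʳ p

-- Powers, finite sums and the Kronecker delta

pw : ℚ → ℕ → ℚ
pw t zero    = 1ℚ
pw t (suc n) = t * pw t n

pw-+ : ∀ t m n → pw t (m ℕ.+ n) ≡ pw t m * pw t n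
pw-+ t zero    n = sym (ℚP.*-identityˡ _)
pw-+ t (suc m) n = trans (cong (t *_) (pw-+ t m n)) (sym (ℚP.*-assoc t _ _))

pw-* : ∀ s t n → pw (s * t) n ≡ pw s n * pw t n
pw-* s t zero    = sym (ℚP.*-identityˡ 1ℚ)
pw-* s t (suc n) = trans (cong ((s * t) *_) (pw-* s t n))
  (solve 4 (λ s t a b → (s :* t) :* (a :* b) := (s :* a) :* (t :* b)) refl s t (pw s n) (pw t n))

pw≢0 : ∀ {t} n → t ≢ 0ℚ → pw t n ≢ 0ℚ
pw≢0 zero    t≢0 = λ ()
pw≢0 (suc n) t≢0 = *-nonzero t≢0 (pw≢0 n t≢0)

sumℚ : ∀ {m} → (Fin m → ℚ) → ℚ
sumℚ {zero}  f = 0ℚ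
sumℚ {suc m} f = f fzero + sumℚ (λ j → f (fsuc j))

sum-cong : ∀ {m} {f g : Fin m → ℚ} → (∀ j → f j ≡ g j) → sumℚ f ≡ sumℚ g
sum-cong {zero}  e = refl
sum-cong {suc m} e = cong₂ _+_ (e fzero) (sum-cong (λ j → e (fsuc j)))

sum-0 : ∀ {m} {f : Fin m → ℚ} → (∀ j → f j ≡ 0ℚ) → sumℚ f ≡ 0ℚ
sum-0 {zero}  e = refl
sum-0 {suc m} e = trans (cong₂ _+_ (e fzero) (sum-0 (λ j → e (fsuc j)))) (ℚP.+-identityˡ 0ℚ)

sum-+ : ∀ {m} (f g : Fin m → ℚ) → sumℚ (λ j → f j + g j) ≡ sumℚ f + sumℚ g
sum-+ {zero}  f g = sym (ℚP.+-identityˡ 0ℚ)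
sum-+ {suc m} f g = trans (cong (f fzero + g fzero +_) (sum-+ (λ j → f (fsuc j)) (λ j → g (fsuc j))))
  (solve 4 (λ a b c d → (a :+ b) :+ (c :+ d) := (a :+ c) :+ (b :+ d)) refl _ _ _ _)

sum-*ˡ : ∀ {m} c (f : Fin m → ℚ) → sumℚ (λ j → c * f j) ≡ c * sumℚ f
sum-*ˡ {zero}  c f = sym (ℚP.*-zeroʳ c)
sum-*ˡ {suc m} c f = trans (cong (c * f fzero +_) (sum-*ˡ c (λ j → f (fsuc j))))
  (sym (ℚP.*-distribˡ-+ c _ _))

sum-*ʳ : ∀ {m} c (f : Fin m → ℚ) → sumℚ (λ j → f j * c) ≡ sumℚ f * c
sum-*ʳ c f = trans (sum-cong (λ j → ℚP.*-comm (f j) c)) (trans (sum-*ˡ c f) (ℚP.*-comm c _))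

sum-swap : ∀ {m n} (f : Fin m → Fin n → ℚ) →
  sumℚ (λ i → sumℚ (f i)) ≡ sumℚ (λ j → sumℚ (λ i → f i j))
sum-swap {zero} {n} f = sym (sum-0 {n} (λ j → refl))
sum-swap {suc m} f = trans (cong (sumℚ (f fzero) +_) (sum-swap (λ i → f (fsuc i))))
  (sym (sum-+ (f fzero) (λ j → sumℚ (λ i → f (fsuc i) j))))

δ : ∀ {m} → Fin m → Fin m → ℚ
δ fzero    fzero    = 1ℚ
δ fzero    (fsuc j) = 0ℚ
δ (fsuc i) fzero    = 0ℚ
δ (fsuc i) (fsuc j) = δ i j

sum-δ : ∀ {m} (k : Fin m) (f : Fin m → ℚ) → sumℚ (λ j → δ k j * f j) ≡ f k
sum-δ {suc m} fzero f = trans (cong₂ _+_ (ℚP.*-identityˡ _) (sum-0 {m} (λ j → ℚP.*-zeroˡ (f (fsuc j))))) (ℚP.+-identityʳ _)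
sum-δ (fsuc k) f = trans (cong₂ _+_ (ℚP.*-zeroˡ (f fzero)) (sum-δ k (λ j → f (fsuc j)))) (ℚP.+-identityˡ _)

δ-sym : ∀ {m} (i j : Fin m) → δ i j ≡ δ j i
δ-sym fzero    fzero    = refl
δ-sym fzero    (fsuc j) = refl
δ-sym (fsuc i) fzero    = refl
δ-sym (fsuc i) (fsuc j) = δ-sym i j

δ-refl : ∀ {m} (i : Fin m) → δ i i ≡ 1ℚ
δ-refl fzero    = refl
δ-refl (fsuc i) = δ-refl i

δ-≢ : ∀ {m} {i j : Fin m} → i ≢ j → δ i j ≡ 0ℚ
δ-≢ {i = fzero}  {fzero}  ne = ⊥-elim (ne refl)
δ-≢ {i = fzero}  {fsuc j} ne = refl
δ-≢ {i = fsuc i} {fzero}  ne = refl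
δ-≢ {i = fsuc i} {fsuc j} ne = δ-≢ (λ e → ne (cong fsuc e))

-- Evaluation of polynomial terms

Pt : ℕ → Set
Pt n = Fin n → ℚ

eval : ∀ {n} → Poly n → Pt n → ℚ
eval (con c) x = c
eval (var i) x = x i
eval (p ⊕ q) x = eval p x + eval q x
eval (p ⊗ q) x = eval p x * eval q x
eval (⊝ p)   x = - eval p x

eval-≈ : ∀ {n} {p q : Poly n} → p ≈ q → ∀ x → eval p x ≡ eval q x
eval-≈ ≈-refl x = refl
eval-≈ (≈-sym e) x = sym (eval-≈ e x)
eval-≈ (≈-trans e f) x = trans (eval-≈ e x) (eval-≈ f x)
eval-≈ (⊕-cong e f) x = cong₂ _+_ (eval-≈ e x) (eval-≈ f x)
eval-≈ (⊗-cong e f) x = cong₂ _*_ (eval-≈ e x) (eval-≈ f x)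
eval-≈ (⊝-cong e) x = cong -_ (eval-≈ e x)
eval-≈ (⊕-assoc p q r) x = ℚP.+-assoc (eval p x) (eval q x) (eval r x)
eval-≈ (⊕-comm p q) x = ℚP.+-comm (eval p x) (eval q x)
eval-≈ (⊕-idˡ p) x = ℚP.+-identityˡ (eval p x)
eval-≈ (⊕-invˡ p) x = ℚP.+-inverseˡ (eval p x)
eval-≈ (⊗-assoc p q r) x = ℚP.*-assoc (eval p x) (eval q x) (eval r x)
eval-≈ (⊗-comm p q) x = ℚP.*-comm (eval p x) (eval q x)
eval-≈ (⊗-idˡ p) x = ℚP.*-identityˡ (eval p x)
eval-≈ (distribˡ p q r) x = ℚP.*-distribˡ-+ (eval p x) (eval q x) (eval r x)
eval-≈ (con-+ a b) x = sym (+-def a b)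
eval-≈ (con-* a b) x = sym (*-def a b)

eval-cong : ∀ {n} (p : Poly n) {x y : Pt n} → (∀ i → x i ≡ y i) → eval p x ≡ eval p y
eval-cong (con c) e = refl
eval-cong (var i) e = e i
eval-cong (p ⊕ q) e = cong₂ _+_ (eval-cong p e) (eval-cong q e)
eval-cong (p ⊗ q) e = cong₂ _*_ (eval-cong p e) (eval-cong q e)
eval-cong (⊝ p)   e = cong -_ (eval-cong p e)

eval-sum : ∀ {n m} (f : Fin m → Poly n) x → eval (polySum f) x ≡ sumℚ (λ j → eval (f j) x)
eval-sum {m = zero}  f x = refl
eval-sum {m = suc m} f x = cong (eval (f fzero) x +_) (eval-sum (λ j → f (fsuc j)) x)

eval-^ : ∀ {n} (p : Poly n) k x → eval (p ^ k) x ≡ pw (eval p x) k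
eval-^ p zero    x = refl
eval-^ p (suc k) x = cong (eval p x *_) (eval-^ p k x)

-- Rings of "polynomials" with an evaluation into ℚ, closed under adjoining
-- a variable by taking coefficient lists.

record Ev : Set₁ where
  infixl 6 _+̇_
  infixl 7 _*̇_
  field
    C     : Set
    E     : Set
    ⟦_⟧   : C → E → ℚ
    _+̇_   : C → C → C
    _*̇_   : C → C → C
    neg   : C → C
    ⟦+⟧   : ∀ a b e → ⟦ a +̇ b ⟧ e ≡ ⟦ a ⟧ e + ⟦ b ⟧ e
    ⟦*⟧   : ∀ a b e → ⟦ a *̇ b ⟧ e ≡ ⟦ a ⟧ e * ⟦ b ⟧ e
    ⟦neg⟧ : ∀ a e → ⟦ neg a ⟧ e ≡ - ⟦ a ⟧ e

module ListOps (R : Ev) where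
  open Ev R

  horner : List C → E × ℚ → ℚ
  horner []       _       = 0ℚ
  horner (a ∷ as) (e , t) = ⟦ a ⟧ e + t * horner as (e , t)

  add : List C → List C → List C
  add []       bs       = bs
  add (a ∷ as) []       = a ∷ as
  add (a ∷ as) (b ∷ bs) = (a +̇ b) ∷ add as bs

  scale : C → List C → List C
  scale c []       = []
  scale c (a ∷ as) = (c *̇ a) ∷ scale c as

  -- multiplication by the variable; the constant term 0 is written c − c, as
  -- C is not assumed to have a zero
  shift : List C → List C
  shift []       = []
  shift (c ∷ cs) = (c +̇ neg c) ∷ c ∷ cs

  mul : List C → List C → List C
  mul []       bs = []
  mul (a ∷ as) bs = add (scale a bs) (shift (mul as bs))

  negL : List C → List C
  negL []       = []
  negL (a ∷ as) = neg a ∷ negL as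

  horner-add : ∀ as bs e → horner (add as bs) e ≡ horner as e + horner bs e
  horner-add []       bs       e       = sym (ℚP.+-identityˡ _)
  horner-add (a ∷ as) []       e       = sym (ℚP.+-identityʳ _)
  horner-add (a ∷ as) (b ∷ bs) (e , t) =
    trans (cong₂ (λ u v → u + t * v) (⟦+⟧ a b e) (horner-add as bs (e , t)))
      (solve 5 (λ a b t x y → (a :+ b) :+ t :* (x :+ y) := (a :+ t :* x) :+ (b :+ t :* y)) refl _ _ _ _ _)

  horner-scale : ∀ c bs e t → horner (scale c bs) (e , t) ≡ ⟦ c ⟧ e * horner bs (e , t)
  horner-scale c []       e t = sym (ℚP.*-zeroʳ _)
  horner-scale c (b ∷ bs) e t =
    trans (cong₂ (λ u v → u + t * v) (⟦*⟧ c b e) (horner-scale c bs e t))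
      (solve 4 (λ c b t x → c :* b :+ t :* (c :* x) := c :* (b :+ t :* x)) refl _ _ _ _)

  horner-shift : ∀ as e t → horner (shift as) (e , t) ≡ t * horner as (e , t)
  horner-shift []       e t = sym (ℚP.*-zeroʳ t)
  horner-shift (a ∷ as) e t =
    trans (cong (_+ t * horner (a ∷ as) (e , t)) (trans (⟦+⟧ a (neg a) e) (trans (cong (⟦ a ⟧ e +_) (⟦neg⟧ a e)) (ℚP.+-inverseʳ _))))
      (ℚP.+-identityˡ _)

  horner-mul : ∀ as bs e → horner (mul as bs) e ≡ horner as e * horner bs e
  horner-mul []       bs e       = sym (ℚP.*-zeroˡ _)
  horner-mul (a ∷ as) bs (e , t) =
    trans (horner-add (scale a bs) (shift (mul as bs)) (e , t))
      (trans (cong₂ _+_ (horner-scale a bs e t)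
               (trans (horner-shift (mul as bs) e t) (cong (t *_) (horner-mul as bs (e , t)))))
        (solve 4 (λ a t x b → a :* b :+ t :* (x :* b) := (a :+ t :* x) :* b) refl _ _ _ _))

  horner-neg : ∀ as e → horner (negL as) e ≡ - horner as e
  horner-neg []       e       = solve 0 (:0 := :- :0) refl
  horner-neg (a ∷ as) (e , t) =
    trans (cong₂ (λ u v → u + t * v) (⟦neg⟧ a e) (horner-neg as (e , t)))
      (solve 3 (λ a t x → (:- a) :+ t :* (:- x) := :- (a :+ t :* x)) refl _ _ _)

listEv : Ev → Ev
listEv R = record
  { C = List C ; E = E × ℚ ; ⟦_⟧ = horner
  ; _+̇_ = add ; _*̇_ = mul ; neg = negL
  ; ⟦+⟧ = horner-add ; ⟦*⟧ = horner-mul ; ⟦neg⟧ = horner-neg }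
  where
  open Ev R
  open ListOps R

ℚ-Ev ℤ-Ev : Ev
ℚ-Ev = record
  { C = ℚ ; E = ⊤ ; ⟦_⟧ = λ c _ → c ; _+̇_ = _+_ ; _*̇_ = _*_ ; neg = -_
  ; ⟦+⟧ = λ _ _ _ → refl ; ⟦*⟧ = λ _ _ _ → refl ; ⟦neg⟧ = λ _ _ → refl }
ℤ-Ev = record
  { C = ℤ ; E = ⊤ ; ⟦_⟧ = λ c _ → ι c ; _+̇_ = ℤ._+_ ; _*̇_ = ℤ._*_ ; neg = ℤ.-_
  ; ⟦+⟧ = λ a b _ → ι-+ a b ; ⟦*⟧ = λ a b _ → ι-* a b ; ⟦neg⟧ = λ a _ → ι-neg a }

Poly-Ev : ℕ → Ev
Poly-Ev n = record
  { C = Poly n ; E = Pt n ; ⟦_⟧ = eval ; _+̇_ = _⊕_ ; _*̇_ = _⊗_ ; neg = ⊝_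
  ; ⟦+⟧ = λ _ _ _ → refl ; ⟦*⟧ = λ _ _ _ → refl ; ⟦neg⟧ = λ _ _ → refl }

-- Univariate polynomials

module U = ListOps ℚ-Ev

ev : List ℚ → ℚ → ℚ
ev u t = U.horner u (tt , t)

-- Synthetic division by `t - r`: the Horner values of the successive tails at `r` are the
-- coefficients of the quotient, and the value of the whole list is the remainder.
quot : List ℚ → ℚ → List ℚ
quot []            r = []
quot (c ∷ [])      r = []
quot (c ∷ d ∷ u)   r = ev (d ∷ u) r ∷ quot (d ∷ u) r

quot-length : ∀ c u r → length (quot (c ∷ u) r) ≡ length u
quot-length c []      r = refl
quot-length c (d ∷ u) r = cong suc (quot-length d u r)

factor : ∀ u r t → ev u t ≡ ev u r + (t - r) * ev (quot u r) t
factor []          r t = solve 2 (λ t r → :0 := :0 :+ (t :- r) :* :0) refl t r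
factor (c ∷ [])    r t = solve 3 (λ c t r → c :+ t :* :0 := c :+ r :* :0 :+ (t :- r) :* :0) refl c t r
factor (c ∷ d ∷ u) r t = trans (cong (λ z → c + t * z) (factor (d ∷ u) r t))
  (solve 5 (λ c t r e q → c :+ t :* (e :+ (t :- r) :* q) := (c :+ r :* e) :+ (t :- r) :* (e :+ t :* q))
     refl c t r (ev (d ∷ u) r) (ev (quot (d ∷ u) r) t))

-- The integer `N` is a root. Dividing it out leaves a shorter polynomial which vanishes at all
-- integers from `suc N` on, because `n - N` is invertible there. The length `k` is the measure of
-- the recursion.
vanish-from : ∀ k u → length u ≡ k → ∀ N → (∀ n → N ℕ.≤ n → ev u (ιℕ n) ≡ 0ℚ) → ∀ t → ev u t ≡ 0ℚ
vanish-from k       []      len N h t = refl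
vanish-from (suc k) (c ∷ u) len N h t =
  trans (factor (c ∷ u) (ιℕ N) t)
    (trans (cong₂ _+_ (h N ℕP.≤-refl) (trans (cong ((t - ιℕ N) *_) (IH t)) (ℚP.*-zeroʳ (t - ιℕ N)))) (ℚP.+-identityˡ 0ℚ))
  where
  q = quot (c ∷ u) (ιℕ N)
  h′ : ∀ n → suc N ℕ.≤ n → ev q (ιℕ n) ≡ 0ℚ
  h′ n N<n = *-zero-split (ιℕ n - ιℕ N) (ev q (ιℕ n))
    (begin
      (ιℕ n - ιℕ N) * ev q (ιℕ n)
        ≡⟨ sym (ℚP.+-identityˡ _) ⟩
      0ℚ + (ιℕ n - ιℕ N) * ev q (ιℕ n)
        ≡⟨ cong (_+ (ιℕ n - ιℕ N) * ev q (ιℕ n)) (sym (h N ℕP.≤-refl)) ⟩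
      ev (c ∷ u) (ιℕ N) + (ιℕ n - ιℕ N) * ev q (ιℕ n)
        ≡⟨ sym (factor (c ∷ u) (ιℕ N) (ιℕ n)) ⟩
      ev (c ∷ u) (ιℕ n)
        ≡⟨ h n (ℕP.<⇒≤ N<n) ⟩
      0ℚ ∎)
    (λ e → ℕP.<⇒≢ N<n (sym (ℤP.+-injective (ι-injective (p-q≡0⇒p≡q _ _ e)))))
    where open ≡-Reasoning
  IH : ∀ t → ev q t ≡ 0ℚ
  IH = vanish-from k q (trans (quot-length c u (ιℕ N)) (ℕP.suc-injective len)) (suc N) h′

-- The algebraic substitute for continuity at 0. It allows a power of `t` to be cancelled from an
-- identity in `t` before setting `t = 0`.
vanish-≢0 : ∀ u → (∀ t → t ≢ 0ℚ → ev u t ≡ 0ℚ) → ∀ t → ev u t ≡ 0ℚ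
vanish-≢0 u h = vanish-from (length u) u refl 1
  (λ n 1≤n → h (ιℕ n) (λ e → ℕP.<⇒≢ 1≤n (sym (ℤP.+-injective (ι-injective {ℤ.+ n} {ℤ.+ 0} e)))))

ev-0 : ∀ c u → ev (c ∷ u) 0ℚ ≡ c
ev-0 c u = trans (cong (c +_) (ℚP.*-zeroˡ _)) (ℚP.+-identityʳ c)

vanish-tail : ∀ c u → (∀ t → ev (c ∷ u) t ≡ 0ℚ) → (c ≡ 0ℚ) × (∀ t → ev u t ≡ 0ℚ)
vanish-tail c u h = c≡0 , vanish-≢0 u
  (λ t t≢0 → *-zero-split t (ev u t)
     (trans (sym (ℚP.+-identityˡ _)) (trans (cong (_+ t * ev u t) (sym c≡0)) (h t))) t≢0)
  where c≡0 = trans (sym (ev-0 c u)) (h 0ℚ)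

coeffs≡0 : ∀ u → (∀ t → ev u t ≡ 0ℚ) → All (_≡ 0ℚ) u
coeffs≡0 []      h = []
coeffs≡0 (c ∷ u) h = let c≡0 , h′ = vanish-tail c u h in c≡0 ∷ coeffs≡0 u h′

-- At `t = 0` the product shows that the constant term of `u` is zero. Dividing `u` by `t` then
-- gives the same situation for the tail.
cancelU : ∀ u w → ev w 0ℚ ≢ 0ℚ → (∀ t → ev u t * ev w t ≡ 0ℚ) → ∀ t → ev u t ≡ 0ℚ
cancelU []      w w≢0 h t = refl
cancelU (c ∷ u) w w≢0 h t = trans (cong₂ (λ a b → a + t * b) c≡0 (cancelU u w w≢0 uw t))
  (trans (ℚP.+-identityˡ _) (ℚP.*-zeroʳ t))
  where
  c≡0 : c ≡ 0ℚ
  c≡0 = trans (sym (ev-0 c u)) (*-zero-split (ev w 0ℚ) (ev (c ∷ u) 0ℚ)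
          (trans (ℚP.*-comm (ev w 0ℚ) _) (h 0ℚ)) w≢0)
  uw : ∀ t → ev u t * ev w t ≡ 0ℚ
  uw t = trans (sym (U.horner-mul u w (tt , t))) (vanish-≢0 (U.mul u w) (λ s s≢0 →
    trans (U.horner-mul u w (tt , s)) (*-zero-split s _
      (trans (sym (ℚP.*-assoc s _ _))
        (trans (cong (_* ev w s) (trans (sym (ℚP.+-identityˡ _)) (cong (_+ s * ev u s) (sym c≡0)))) (h s))) s≢0)) t)

line : ∀ {n} → Poly n → Pt n → Pt n → List ℚ
line (con c) x y = c ∷ []
line (var i) x y = x i ∷ y i ∷ []
line (p ⊕ q) x y = U.add (line p x y) (line q x y)
line (p ⊗ q) x y = U.mul (line p x y) (line q x y)
line (⊝ p)   x y = U.negL (line p x y)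

_+·_∙_ : ∀ {n} → Pt n → ℚ → Pt n → Pt n
(x +· t ∙ y) i = x i + t * y i

ev-line : ∀ {n} (p : Poly n) x y t → ev (line p x y) t ≡ eval p (x +· t ∙ y)
ev-line (con c) x y t = solve 2 (λ c t → c :+ t :* :0 := c) refl c t
ev-line (var i) x y t = solve 3 (λ a b t → a :+ t :* (b :+ t :* :0) := a :+ t :* b) refl (x i) (y i) t
ev-line (p ⊕ q) x y t = trans (U.horner-add (line p x y) (line q x y) (tt , t)) (cong₂ _+_ (ev-line p x y t) (ev-line q x y t))
ev-line (p ⊗ q) x y t = trans (U.horner-mul (line p x y) (line q x y) (tt , t)) (cong₂ _*_ (ev-line p x y t) (ev-line q x y t))
ev-line (⊝ p)   x y t = trans (U.horner-neg (line p x y) (tt , t)) (cong -_ (ev-line p x y t))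

-- A set of points containing with two points the line through them: there
-- polynomials behave as on an irreducible variety.
Flat : ∀ {n} → (Pt n → Set) → Set
Flat W = (∀ {x y} t → W x → W y → W (x +· t ∙ (λ i → y i - x i)))

-- On the line from `p` to `x` the restriction of `g` has the nonzero constant term `g(p)`, so the
-- univariate cancellation applies; parameter 1 gives the value of `f` at `x`. Thus one point where
-- `g` is nonzero suffices to cancel it on all of `W`.
cancel : ∀ {n} {W : Pt n → Set} → Flat W → (f g : Poly n) (p : Pt n) → W p → eval g p ≢ 0ℚ →
  (∀ x → W x → eval f x * eval g x ≡ 0ℚ) → ∀ x → W x → eval f x ≡ 0ℚ
cancel fl f g p Wp gp≢0 h x Wx = begin
  eval f x                ≡⟨ eval-cong f (λ i → solve 2 (λ p x → x := p :+ :1 :* (x :- p)) refl (p i) (x i)) ⟩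
  eval f (p +· 1ℚ ∙ d)    ≡⟨ sym (ev-line f p d 1ℚ) ⟩
  ev (line f p d) 1ℚ      ≡⟨ cancelU (line f p d) (line g p d)
                               (λ e → gp≢0 (trans (sym g0) e))
                               (λ t → trans (cong₂ _*_ (ev-line f p d t) (ev-line g p d t)) (h _ (fl t Wp Wx))) 1ℚ ⟩
  0ℚ ∎
  where
  open ≡-Reasoning
  d = λ i → x i - p i
  g0 : ev (line g p d) 0ℚ ≡ eval g p
  g0 = trans (ev-line g p d 0ℚ) (eval-cong g (λ i → solve 2 (λ a b → a :+ :0 :* b := a) refl (p i) (d i)))

Everywhere : ∀ {n} → Pt n → Set
Everywhere _ = ⊤

cancel-all : ∀ {n} (f g : Poly n) (p : Pt n) → eval g p ≢ 0ℚ →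
  (∀ x → eval f x * eval g x ≡ 0ℚ) → ∀ x → eval f x ≡ 0ℚ
cancel-all f g p gp h x = cancel {W = Everywhere} (λ _ _ _ → tt) f g p tt gp (λ x _ → h x) x tt

-- Completeness of evaluation at rational points

Poly-ring : ℕ → CommutativeRing 0ℓ 0ℓ
Poly-ring n = record
  { Carrier = Poly n ; _≈_ = _≈_ ; _+_ = _⊕_ ; _*_ = _⊗_ ; -_ = ⊝_ ; 0# = 𝟘 ; 1# = 𝟙
  ; isCommutativeRing = record
    { isRing = record
      { +-isAbelianGroup = record
        { isGroup = record
          { isMonoid = record
            { isSemigroup = record
              { isMagma = record
                { isEquivalence = record { refl = ≈-refl ; sym = ≈-sym ; trans = ≈-trans }
                ; ∙-cong = ⊕-cong }
              ; assoc = ⊕-assoc }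
            ; identity = ⊕-idˡ , (λ p → ≈-trans (⊕-comm p 𝟘) (⊕-idˡ p)) }
          ; inverse = ⊕-invˡ , (λ p → ≈-trans (⊕-comm p (⊝ p)) (⊕-invˡ p))
          ; ⁻¹-cong = ⊝-cong }
        ; comm = ⊕-comm }
      ; *-cong = ⊗-cong
      ; *-assoc = ⊗-assoc
      ; *-identity = ⊗-idˡ , (λ p → ≈-trans (⊗-comm p 𝟙) (⊗-idˡ p))
      ; distrib = distribˡ , (λ p q r → ≈-trans (⊗-comm (q ⊕ r) p)
          (≈-trans (distribˡ p q r) (⊕-cong (⊗-comm p q) (⊗-comm p r)))) }
    ; *-comm = ⊗-comm } }

wk : ∀ {n} → Poly n → Poly (suc n)
wk (con c) = con c
wk (var i) = var (fsuc i)
wk (p ⊕ q) = wk p ⊕ wk q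
wk (p ⊗ q) = wk p ⊗ wk q
wk (⊝ p)   = ⊝ wk p

wk-≈ : ∀ {n} {p q : Poly n} → p ≈ q → wk p ≈ wk q
wk-≈ ≈-refl = ≈-refl
wk-≈ (≈-sym e) = ≈-sym (wk-≈ e)
wk-≈ (≈-trans e f) = ≈-trans (wk-≈ e) (wk-≈ f)
wk-≈ (⊕-cong e f) = ⊕-cong (wk-≈ e) (wk-≈ f)
wk-≈ (⊗-cong e f) = ⊗-cong (wk-≈ e) (wk-≈ f)
wk-≈ (⊝-cong e) = ⊝-cong (wk-≈ e)
wk-≈ (⊕-assoc p q r) = ⊕-assoc (wk p) (wk q) (wk r)
wk-≈ (⊕-comm p q) = ⊕-comm (wk p) (wk q)
wk-≈ (⊕-idˡ p) = ⊕-idˡ (wk p)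
wk-≈ (⊕-invˡ p) = ⊕-invˡ (wk p)
wk-≈ (⊗-assoc p q r) = ⊗-assoc (wk p) (wk q) (wk r)
wk-≈ (⊗-comm p q) = ⊗-comm (wk p) (wk q)
wk-≈ (⊗-idˡ p) = ⊗-idˡ (wk p)
wk-≈ (distribˡ p q r) = distribˡ (wk p) (wk q) (wk r)
wk-≈ (con-+ a b) = con-+ a b
wk-≈ (con-* a b) = con-* a b

module _ {n : ℕ} where
  private
    module L = ListOps (Poly-Ev n)
    R  = Poly-ring (suc n)
    CR = CommutativeRing.commutativeSemiring R
    𝕏 : Poly (suc n)
    𝕏 = var fzero
  open NatSolver CR using () renaming
    (solve to solveᴾ; _:=_ to infix 4 _⊜_; _:+_ to infixl 6 _⊞_; _:*_ to infixl 7 _⊠_)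
  open RingProperties (CommutativeRing.ring R) using (-‿distribʳ-*; -‿+-comm)

  coeffs : Poly (suc n) → List (Poly n)
  coeffs (con c)        = con c ∷ []
  coeffs (var fzero)    = 𝟘 ∷ 𝟙 ∷ []
  coeffs (var (fsuc i)) = var i ∷ []
  coeffs (p ⊕ q)        = L.add (coeffs p) (coeffs q)
  coeffs (p ⊗ q)        = L.mul (coeffs p) (coeffs q)
  coeffs (⊝ p)          = L.negL (coeffs p)

  fromCoeffs : List (Poly n) → Poly (suc n)
  fromCoeffs []       = 𝟘
  fromCoeffs (c ∷ cs) = wk c ⊕ 𝕏 ⊗ fromCoeffs cs

  private
    from-add : ∀ as bs → fromCoeffs (L.add as bs) ≈ fromCoeffs as ⊕ fromCoeffs bs
    from-add []       bs       = ≈-sym (⊕-idˡ _)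
    from-add (a ∷ as) []       = ≈-sym (≈-trans (⊕-comm _ _) (⊕-idˡ _))
    from-add (a ∷ as) (b ∷ bs) = ≈-trans (⊕-cong ≈-refl (⊗-cong ≈-refl (from-add as bs)))
      (solveᴾ 5 (λ a b x p q → (a ⊞ b) ⊞ x ⊠ (p ⊞ q) ⊜ (a ⊞ x ⊠ p) ⊞ (b ⊞ x ⊠ q)) ≈-refl _ _ _ _ _)

    𝕏⊗𝟘 : ∀ p → p ⊗ 𝟘 ≈ 𝟘
    𝕏⊗𝟘 = CommutativeRing.zeroʳ R

    from-scale : ∀ c bs → fromCoeffs (L.scale c bs) ≈ wk c ⊗ fromCoeffs bs
    from-scale c []       = ≈-sym (𝕏⊗𝟘 (wk c))
    from-scale c (b ∷ bs) = ≈-trans (⊕-cong ≈-refl (⊗-cong ≈-refl (from-scale c bs)))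
      (solveᴾ 4 (λ c b x p → c ⊠ b ⊞ x ⊠ (c ⊠ p) ⊜ c ⊠ (b ⊞ x ⊠ p)) ≈-refl _ _ _ _)

    from-shift : ∀ as → fromCoeffs (L.shift as) ≈ 𝕏 ⊗ fromCoeffs as
    from-shift []       = ≈-sym (𝕏⊗𝟘 𝕏)
    from-shift (a ∷ as) = ≈-trans (⊕-cong (CommutativeRing.-‿inverseʳ R (wk a)) ≈-refl) (⊕-idˡ _)

    from-mul : ∀ as bs → fromCoeffs (L.mul as bs) ≈ fromCoeffs as ⊗ fromCoeffs bs
    from-mul []       bs = ≈-sym (CommutativeRing.zeroˡ R (fromCoeffs bs))
    from-mul (a ∷ as) bs = ≈-trans (from-add (L.scale a bs) (L.shift (L.mul as bs)))
      (≈-trans (⊕-cong (from-scale a bs) (≈-trans (from-shift (L.mul as bs)) (⊗-cong ≈-refl (from-mul as bs))))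
        (solveᴾ 4 (λ a x p b → a ⊠ b ⊞ x ⊠ (p ⊠ b) ⊜ (a ⊞ x ⊠ p) ⊠ b) ≈-refl _ _ _ _))

    from-neg : ∀ as → fromCoeffs (L.negL as) ≈ ⊝ fromCoeffs as
    from-neg []       = ≈-sym (RingProperties.-0#≈0# (CommutativeRing.ring R))
    from-neg (a ∷ as) = ≈-trans (⊕-cong ≈-refl (≈-trans (⊗-cong ≈-refl (from-neg as)) (≈-sym (-‿distribʳ-* 𝕏 _))))
      (-‿+-comm (wk a) (𝕏 ⊗ fromCoeffs as))

  from-coeffs : ∀ p → p ≈ fromCoeffs (coeffs p)
  from-coeffs (con c) = ≈-sym (≈-trans (⊕-cong ≈-refl (𝕏⊗𝟘 𝕏)) (≈-trans (⊕-comm _ _) (⊕-idˡ _)))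
  from-coeffs (var fzero) = ≈-sym (≈-trans (⊕-idˡ _)
    (≈-trans (⊗-cong ≈-refl (≈-trans (⊕-cong ≈-refl (𝕏⊗𝟘 𝕏)) (≈-trans (⊕-comm _ _) (⊕-idˡ _))))
      (≈-trans (⊗-comm 𝕏 𝟙) (⊗-idˡ 𝕏))))
  from-coeffs (var (fsuc i)) = ≈-sym (≈-trans (⊕-cong ≈-refl (𝕏⊗𝟘 𝕏)) (≈-trans (⊕-comm _ _) (⊕-idˡ _)))
  from-coeffs (p ⊕ q) = ≈-trans (⊕-cong (from-coeffs p) (from-coeffs q)) (≈-sym (from-add (coeffs p) (coeffs q)))
  from-coeffs (p ⊗ q) = ≈-trans (⊗-cong (from-coeffs p) (from-coeffs q)) (≈-sym (from-mul (coeffs p) (coeffs q)))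
  from-coeffs (⊝ p)   = ≈-trans (⊝-cong (from-coeffs p)) (≈-sym (from-neg (coeffs p)))

  fromCoeffs≈𝟘 : ∀ {cs} → All (_≈ 𝟘) cs → fromCoeffs cs ≈ 𝟘
  fromCoeffs≈𝟘 []       = ≈-refl
  fromCoeffs≈𝟘 (e ∷ es) = ≈-trans (⊕-cong (wk-≈ e) (≈-trans (⊗-cong ≈-refl (fromCoeffs≈𝟘 es)) (𝕏⊗𝟘 𝕏))) (⊕-idˡ 𝟘)

  infixr 5 _∷ᵖ_
  _∷ᵖ_ : ℚ → Pt n → Pt (suc n)
  (t ∷ᵖ y) fzero    = t
  (t ∷ᵖ y) (fsuc i) = y i

  horner-coeffs : ∀ p y t → L.horner (coeffs p) (y , t) ≡ eval p (t ∷ᵖ y)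
  horner-coeffs (con c) y t = trans (cong (c +_) (ℚP.*-zeroʳ t)) (ℚP.+-identityʳ c)
  horner-coeffs (var fzero) y t = trans (ℚP.+-identityˡ _)
    (trans (cong (t *_) (trans (cong (1ℚ +_) (ℚP.*-zeroʳ t)) (ℚP.+-identityʳ 1ℚ))) (ℚP.*-identityʳ t))
  horner-coeffs (var (fsuc i)) y t = trans (cong (y i +_) (ℚP.*-zeroʳ t)) (ℚP.+-identityʳ (y i))
  horner-coeffs (p ⊕ q) y t = trans (L.horner-add (coeffs p) (coeffs q) (y , t)) (cong₂ _+_ (horner-coeffs p y t) (horner-coeffs q y t))
  horner-coeffs (p ⊗ q) y t = trans (L.horner-mul (coeffs p) (coeffs q) (y , t)) (cong₂ _*_ (horner-coeffs p y t) (horner-coeffs q y t))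
  horner-coeffs (⊝ p)   y t = trans (L.horner-neg (coeffs p) (y , t)) (cong -_ (horner-coeffs p y t))

  at : Pt n → List (Poly n) → List ℚ
  at y = map (λ c → eval c y)

  ev-at : ∀ cs y t → ev (at y cs) t ≡ L.horner cs (y , t)
  ev-at []       y t = refl
  ev-at (c ∷ cs) y t = cong (λ z → eval c y + t * z) (ev-at cs y t)

  all-vanish : ∀ cs → (∀ y → All (_≡ 0ℚ) (at y cs)) → All (λ c → ∀ y → eval c y ≡ 0ℚ) cs
  all-vanish []       h = []
  all-vanish (c ∷ cs) h = (λ y → All.head (h y)) ∷ all-vanish cs (λ y → All.tail (h y))

con-cong : ∀ {n a b} → a ≡ b → con {n} a ≈ con b
con-cong refl = ≈-refl

con-eval : (p : Poly 0) (x : Pt 0) → p ≈ con (eval p x)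
con-eval (con c) x = ≈-refl
con-eval (p ⊕ q) x = ≈-trans (⊕-cong (con-eval p x) (con-eval q x))
  (≈-trans (con-+ _ _) (con-cong (+-def (eval p x) (eval q x))))
con-eval (p ⊗ q) x = ≈-trans (⊗-cong (con-eval p x) (con-eval q x))
  (≈-trans (con-* _ _) (con-cong (*-def (eval p x) (eval q x))))
con-eval (⊝ p)   x = ≈-trans (⊝-cong (con-eval p x)) (≈-sym (inverseʳ-unique _ _
    (≈-trans (con-+ _ _) (con-cong (trans (+-def (eval p x) (- eval p x)) (ℚP.+-inverseʳ (eval p x)))))))
  where open RingProperties (CommutativeRing.ring (Poly-ring 0)) using () renaming (+-inverseʳ-unique to inverseʳ-unique)

-- Induction on the number of variables. With the other variables fixed at `y`, the coefficients in
-- the first variable form a univariate polynomial with all of ℚ as roots, so they vanish at `y`;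
-- each of them is then `𝟘` by induction. Without variables a term is a constant.
vanishing⇒≈𝟘 : ∀ {n} (p : Poly n) → (∀ x → eval p x ≡ 0ℚ) → p ≈ 𝟘
vanishing⇒≈𝟘 {zero}  p h = subst (λ z → p ≈ con z) (h (λ ())) (con-eval p (λ ()))
vanishing⇒≈𝟘 {suc n} p h = ≈-trans (from-coeffs p) (fromCoeffs≈𝟘
  (All.map (λ {c} → vanishing⇒≈𝟘 c) (all-vanish (coeffs p)
    (λ y → coeffs≡0 (at y (coeffs p)) (λ t → trans (ev-at (coeffs p) y t) (trans (horner-coeffs p y t) (h (t ∷ᵖ y))))))))

eval-complete : ∀ {n} (p q : Poly n) → (∀ x → eval p x ≡ eval q x) → p ≈ q
eval-complete {n} p q h = x∙y⁻¹≈ε⇒x≈y p q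
  (vanishing⇒≈𝟘 (p ⊕ (⊝ q)) (λ x → p≡q⇒p-q≡0 (h x)))
  where open RingProperties (CommutativeRing.ring (Poly-ring n)) using (x∙y⁻¹≈ε⇒x≈y)

-- Linear forms, hyperplanes and divisibility by powers of linear forms

dot : ∀ {n} → Form n → Pt n → ℚ
dot a x = sumℚ (λ i → a i * x i)

eval-lin : ∀ {n} (a : Form n) x → eval (lin a) x ≡ dot a x
eval-lin a x = eval-sum (λ i → con (a i) ⊗ var i) x

dot-cong : ∀ {n} (a : Form n) {x y : Pt n} → (∀ i → x i ≡ y i) → dot a x ≡ dot a y
dot-cong a e = sum-cong (λ i → cong (a i *_) (e i))

dot-+· : ∀ {n} (a : Form n) x t y → dot a (x +· t ∙ y) ≡ dot a x + t * dot a y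
dot-+· a x t y = trans (sum-cong (λ i → solve 4 (λ a x t y → a :* (x :+ t :* y) := a :* x :+ t :* (a :* y)) refl (a i) (x i) t (y i)))
  (trans (sum-+ (λ i → a i * x i) (λ i → t * (a i * y i))) (cong (dot a x +_) (sum-*ˡ t (λ i → a i * y i))))

dot-· : ∀ {n} (a : Form n) t y → dot a (λ i → t * y i) ≡ t * dot a y
dot-· a t y = trans (sum-cong (λ i → solve 3 (λ a t y → a :* (t :* y) := t :* (a :* y)) refl (a i) t (y i))) (sum-*ˡ t (λ i → a i * y i))

Ker : ∀ {n} → Form n → Pt n → Set
Ker a x = dot a x ≡ 0ℚ

Ker-flat : ∀ {n} (a : Form n) → Flat (Ker a)
Ker-flat a {x} {y} t ax ay = trans (dot-+· a x t (λ i → y i - x i))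
  (trans (cong₂ (λ u v → u + t * v) ax
     (trans (dot-cong a (λ i → solve 2 (λ y x → y :- x := y :+ (:- :1) :* x) refl (y i) (x i)))
       (trans (dot-+· a y (- 1ℚ) x) (cong₂ (λ u v → u + - 1ℚ * v) ay ax))))
     (solve 1 (λ t → :0 :+ t :* (:0 :+ (:- :1) :* :0) := :0) refl t))

unit-point : ∀ {n} (a : Form n) i → a i ≢ 0ℚ → Σ (Pt n) λ h → dot a h ≡ 1ℚ
unit-point a i ai≢0 with inv (a i) ai≢0
... | r , e = (λ j → δ i j * r) ,
  trans (sum-cong (λ j → solve 3 (λ a d r → a :* (d :* r) := d :* (r :* a)) refl (a j) (δ i j) r))
    (trans (sum-δ i (λ j → r * a j)) e)

module _ {n : ℕ} (a : Form n) (h : Pt n) (ah≡1 : dot a h ≡ 1ℚ) where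

  -- projection to the hyperplane along h
  proj : Poly n → Poly n
  proj (con c) = con c
  proj (var i) = var i ⊕ (⊝ (lin a ⊗ con (h i)))
  proj (p ⊕ q) = proj p ⊕ proj q
  proj (p ⊗ q) = proj p ⊗ proj q
  proj (⊝ p)   = ⊝ proj p

  -- The quotient of `p - proj p` by the form, a divided difference: for products it uses
  -- `p q - p′ q′ = p (q - q′) + (p - p′) q′`.
  cofactor : Poly n → Poly n
  cofactor (con c) = 𝟘
  cofactor (var i) = con (h i)
  cofactor (p ⊕ q) = cofactor p ⊕ cofactor q
  cofactor (p ⊗ q) = (p ⊗ cofactor q) ⊕ (cofactor p ⊗ proj q)
  cofactor (⊝ p)   = ⊝ cofactor p

  private
    σ : Pt n → Pt n
    σ x = x +· - dot a x ∙ h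

    σ∈Ker : ∀ x → Ker a (σ x)
    σ∈Ker x = trans (dot-+· a x (- dot a x) h) (trans (cong (λ z → dot a x + - dot a x * z) ah≡1)
      (solve 1 (λ d → d :+ (:- d) :* :1 := :0) refl (dot a x)))

    eval-proj : ∀ p x → eval (proj p) x ≡ eval p (σ x)
    eval-proj (con c) x = refl
    eval-proj (var i) x = trans (cong (λ z → x i + - (z * h i)) (eval-lin a x))
      (solve 3 (λ x d h → x :+ (:- (d :* h)) := x :+ (:- d) :* h) refl (x i) (dot a x) (h i))
    eval-proj (p ⊕ q) x = cong₂ _+_ (eval-proj p x) (eval-proj q x)
    eval-proj (p ⊗ q) x = cong₂ _*_ (eval-proj p x) (eval-proj q x)
    eval-proj (⊝ p)   x = cong -_ (eval-proj p x)

    spec : ∀ p x → eval p x ≡ eval (proj p) x + dot a x * eval (cofactor p) x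
    spec (con c) x = solve 2 (λ c d → c := c :+ d :* :0) refl c (dot a x)
    spec (var i) x = trans (solve 3 (λ x d h → x := x :+ (:- (d :* h)) :+ d :* h) refl (x i) (dot a x) (h i))
      (cong (λ z → x i + - (z * h i) + dot a x * h i) (sym (eval-lin a x)))
    spec (p ⊕ q) x = trans (cong₂ _+_ (spec p x) (spec q x))
      (solve 5 (λ p c q e d → (p :+ d :* c) :+ (q :+ d :* e) := (p :+ q) :+ d :* (c :+ e)) refl
         (eval (proj p) x) (eval (cofactor p) x) (eval (proj q) x) (eval (cofactor q) x) (dot a x))
    spec (p ⊗ q) x = begin
      P * Q                       ≡⟨ cong (P *_) (spec q x) ⟩
      P * (Q′ + d * e)            ≡⟨ solve 4 (λ P Q d e → P :* (Q :+ d :* e) := P :* Q :+ d :* (P :* e)) refl P Q′ d e ⟩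
      P * Q′ + d * (P * e)        ≡⟨ cong (λ z → z * Q′ + d * (P * e)) (spec p x) ⟩
      (P′ + d * c) * Q′ + d * (P * e)
        ≡⟨ solve 6 (λ P P′ Q d c e → (P′ :+ d :* c) :* Q :+ d :* (P :* e) := P′ :* Q :+ d :* (P :* e :+ c :* Q)) refl P P′ Q′ d c e ⟩
      P′ * Q′ + d * (P * e + c * Q′) ∎
      where
      open ≡-Reasoning
      P = eval p x ; Q = eval q x ; P′ = eval (proj p) x ; Q′ = eval (proj q) x
      c = eval (cofactor p) x ; e = eval (cofactor q) x ; d = dot a x
    spec (⊝ p) x = trans (cong -_ (spec p x))
      (solve 3 (λ p d c → :- (p :+ d :* c) := (:- p) :+ d :* (:- c)) refl (eval (proj p) x) (dot a x) (eval (cofactor p) x))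

  divide : ∀ f → (∀ x → Ker a x → eval f x ≡ 0ℚ) → ∀ x → eval f x ≡ dot a x * eval (cofactor f) x
  divide f van x = trans (spec f x) (trans (cong (_+ dot a x * eval (cofactor f) x)
    (trans (eval-proj f x) (van (σ x) (σ∈Ker x)))) (ℚP.+-identityˡ _))

  cancel-form : ∀ f → (∀ x → eval f x * dot a x ≡ 0ℚ) → ∀ x → eval f x ≡ 0ℚ
  cancel-form f e = cancel-all f (lin a) h (λ z → 1≢0 (trans (sym ah≡1) (trans (sym (eval-lin a h)) z)))
    (λ x → trans (cong (eval f x *_) (eval-lin a x)) (e x))

  -- A linear form is prime, and `c`, being nonzero at a point of its kernel, is not divisible by
  -- it. Hence `f` vanishes on the kernel, and one factor of the form can be split off `f` and
  -- cancelled on both sides.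
  divide-pow : ∀ k (c f g : Poly n) p → Ker a p → eval c p ≢ 0ℚ →
    (∀ x → eval c x * eval f x ≡ pw (dot a x) k * eval g x) →
    Σ (Poly n) λ f′ → ∀ x → eval f x ≡ pw (dot a x) k * eval f′ x
  divide-pow zero    c f g p ap cp e = f , λ x → sym (ℚP.*-identityˡ _)
  divide-pow (suc k) c f g p ap cp e =
    let f′ , e′ = divide-pow k c f₁ g p ap cp e₁ in
    f′ , λ x → trans (divide f van x) (trans (cong (dot a x *_) (e′ x)) (sym (ℚP.*-assoc (dot a x) _ _)))
    where
    van : ∀ x → Ker a x → eval f x ≡ 0ℚ
    van = cancel (Ker-flat a) f c p ap cp (λ x ax → trans (ℚP.*-comm _ _) (trans (e x)
      (trans (cong (λ z → z * pw (dot a x) k * eval g x) ax)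
        (solve 2 (λ u v → :0 :* u :* v := :0) refl (pw (dot a x) k) (eval g x)))))
    f₁ = cofactor f
    e₁ : ∀ x → eval c x * eval f₁ x ≡ pw (dot a x) k * eval g x
    e₁ x = p-q≡0⇒p≡q _ _ (trans (sym (eq x)) (cancel-form ((c ⊗ f₁) ⊕ (⊝ ((lin a ^ k) ⊗ g))) (λ y →
      trans (cong (_* dot a y) (eq y))
      (trans (solve 5 (λ c f d w g → (c :* f :- w :* g) :* d := c :* (d :* f) :- (d :* w) :* g) refl
         (eval c y) (eval f₁ y) (dot a y) (pw (dot a y) k) (eval g y))
      (p≡q⇒p-q≡0 (trans (cong (eval c y *_) (sym (divide f van y))) (e y))))) x))
      where
      eq : ∀ y → eval ((c ⊗ f₁) ⊕ (⊝ ((lin a ^ k) ⊗ g))) y ≡ eval c y * eval f₁ y - pw (dot a y) k * eval g y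
      eq y = cong (λ z → eval c y * eval f₁ y + - (z * eval g y))
        (trans (eval-^ (lin a) k y) (cong (λ z → pw z k) (eval-lin a y)))

-- Products of powers of linear forms

prodℚ : ∀ {m} → (Fin m → ℚ) → ℚ
prodℚ {zero}  f = 1ℚ
prodℚ {suc m} f = f fzero * prodℚ (λ j → f (fsuc j))

prodP : ∀ {m n} → (Fin m → Poly n) → Poly n
prodP {zero}  f = 𝟙
prodP {suc m} f = f fzero ⊗ prodP (λ j → f (fsuc j))

eval-prodP : ∀ {m n} (f : Fin m → Poly n) x → eval (prodP f) x ≡ prodℚ (λ j → eval (f j) x)
eval-prodP {zero}  f x = refl
eval-prodP {suc m} f x = cong (eval (f fzero) x *_) (eval-prodP (λ j → f (fsuc j)) x)

prod-cong : ∀ {m} {f g : Fin m → ℚ} → (∀ j → f j ≡ g j) → prodℚ f ≡ prodℚ g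
prod-cong {zero}  e = refl
prod-cong {suc m} e = cong₂ _*_ (e fzero) (prod-cong (λ j → e (fsuc j)))

prod≢0 : ∀ {m} {f : Fin m → ℚ} → (∀ j → f j ≢ 0ℚ) → prodℚ f ≢ 0ℚ
prod≢0 {zero}  h ()
prod≢0 {suc m} h = *-nonzero (h fzero) (prod≢0 (λ j → h (fsuc j)))

powers : ∀ {m n} → (Fin m → Form n) → (Fin m → ℕ) → Poly n
powers a e = prodP (λ k → lin (a k) ^ e k)

eval-powers : ∀ {m n} (a : Fin m → Form n) e x → eval (powers a e) x ≡ prodℚ (λ k → pw (dot (a k) x) (e k))
eval-powers a e x = trans (eval-prodP (λ k → lin (a k) ^ e k) x)
  (prod-cong (λ k → trans (eval-^ (lin (a k)) (e k) x) (cong (λ z → pw z (e k)) (eval-lin (a k) x))))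

-- Powers of pairwise coprime forms divide together. Coprimality enters through the points `p k`,
-- which lie on the k-th kernel and on no other: there the product of the remaining powers is
-- nonzero, as `divide-pow` requires.
divide-powers : ∀ {m n} (a : Fin m → Form n) (h : Fin m → Pt n) → (∀ k → dot (a k) (h k) ≡ 1ℚ) →
  (p : Fin m → Pt n) → (∀ k → Ker (a k) (p k)) → (∀ k l → l ≢ k → dot (a l) (p k) ≢ 0ℚ) →
  (e : Fin m → ℕ) (f : Poly n) →
  (∀ k → Σ (Poly n) λ g → ∀ x → eval f x ≡ pw (dot (a k) x) (e k) * eval g x) →
  Σ (Poly n) λ g → ∀ x → eval f x ≡ eval (powers a e) x * eval g x
divide-powers {zero}  a h ah p ap gen e f d = f , λ x → sym (ℚP.*-identityˡ _)
divide-powers {suc m} a h ah p ap gen e f d =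
  let g₁ , eq₁ = divide-powers (λ k → a (fsuc k)) (λ k → h (fsuc k)) (λ k → ah (fsuc k)) (λ k → p (fsuc k))
                   (λ k → ap (fsuc k)) (λ k l ne → gen (fsuc k) (fsuc l) (λ q → ne (fsuc-inj q))) (λ k → e (fsuc k)) f (λ k → d (fsuc k))
      g₀ , eq₀ = d fzero
      g , eq = divide-pow (a fzero) (h fzero) (ah fzero) (e fzero) rest g₁ g₀ (p fzero) (ap fzero) rest≢0
                 (λ x → trans (sym (eq₁ x)) (eq₀ x))
  in g , λ x → trans (eq₁ x) (trans (cong (eval rest x *_) (eq x))
       (trans (solve 3 (λ r w g → r :* (w :* g) := (w :* r) :* g) refl (eval rest x) (pw (dot (a fzero) x) (e fzero)) (eval g x))
         (cong (λ z → z * eval rest x * eval g x)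
           (sym (trans (eval-^ (lin (a fzero)) (e fzero) x) (cong (λ z → pw z (e fzero)) (eval-lin (a fzero) x)))))))
  where
  rest = powers (λ k → a (fsuc k)) (λ k → e (fsuc k))
  fsuc-inj : ∀ {m} {k l : Fin m} → fsuc k ≡ fsuc l → k ≡ l
  fsuc-inj refl = refl
  rest≢0 : eval rest (p fzero) ≢ 0ℚ
  rest≢0 z = prod≢0 (λ k → pw≢0 (e (fsuc k)) (gen fzero (fsuc k) (λ ())))
    (trans (sym (eval-powers (λ k → a (fsuc k)) (λ k → e (fsuc k)) (p fzero))) z)

-- Derivations and freeness in terms of values at points

val : ∀ {n} → Der n → Pt n → Pt n
val θ x i = eval (θ i) x

eval-applyDer : ∀ {n} (θ : Der n) (a : Form n) x → eval (applyDer θ a) x ≡ dot a (val θ x)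
eval-applyDer θ a x = trans (eval-sum (λ i → θ i ⊗ con (a i)) x)
  (sum-cong (λ i → ℚP.*-comm (eval (θ i) x) (a i)))

Tangent : ∀ {n} → Form n → ℕ → Der n → Set
Tangent {n} a k θ = Σ (Poly n) λ g → ∀ x → dot a (val θ x) ≡ pw (dot a x) k * eval g x

Combination : ∀ {n m} → (Fin m → Poly n) → (Fin m → Der n) → Pt n → Pt n
Combination c θ x i = sumℚ (λ j → eval (c j) x * eval (θ j i) x)

-- Taking a predicate `D` in place of a multiarrangement lets the same notion serve lists of
-- hyperplanes, where bases are built, and multiplicities, where freeness is stated.
record Basis {n m} (D : Der n → Set) (θ : Fin m → Der n) : Set where
  field
    member      : ∀ j → D (θ j)
    generates   : ∀ φ → D φ → Σ (Fin m → Poly n) λ c → ∀ x i → val φ x i ≡ Combination c θ x i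
    independent : ∀ c → (∀ x i → Combination c θ x i ≡ 0ℚ) → ∀ j x → eval (c j) x ≡ 0ℚ

module _ {n : ℕ} (A : Arrangement n) (μ : Multiplicity A) where

  TangentAll : Der n → Set
  TangentAll θ = ∀ k → Tangent (form A k) (μ k) θ

  InD⇒ : ∀ {θ} → InD A μ θ → TangentAll θ
  InD⇒ {θ} h k = let g , e = h k in g , λ x →
    trans (sym (eval-applyDer θ (form A k) x)) (trans (eval-≈ e x)
      (cong (_* eval g x) (trans (eval-^ (lin (form A k)) (μ k) x) (cong (λ z → pw z (μ k)) (eval-lin (form A k) x)))))

  InD⇐ : ∀ {θ} → TangentAll θ → InD A μ θ
  InD⇐ {θ} h k = let g , e = h k in g , eval-complete _ _ (λ x →
    trans (eval-applyDer θ (form A k) x) (trans (e x)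
      (cong (_* eval g x) (sym (trans (eval-^ (lin (form A k)) (μ k) x) (cong (λ z → pw z (μ k)) (eval-lin (form A k) x)))))))

  Free⇐ : ∀ {m} {θ : Fin m → Der n} → Basis TangentAll θ → Free A μ
  Free⇐ {m} {θ} B = m , θ , (λ j → InD⇐ (member j))
    , (λ φ φ∈D → let c , e = generates φ (InD⇒ φ∈D) in c , λ i →
        eval-complete _ _ (λ x → trans (e x i) (sym (eval-sum (λ j → c j ⊗ θ j i) x))))
    , (λ c e j → vanishing⇒≈𝟘 (c j) (independent c
        (λ x i → trans (sym (eval-sum (λ j → c j ⊗ θ j i) x)) (eval-≈ (e i) x)) j))
    where open Basis B

  Free⇒ : Free A μ → Σ ℕ λ m → Σ (Fin m → Der n) λ θ → Basis TangentAll θ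
  Free⇒ (m , θ , mem , gen , ind) = m , θ , record
    { member      = λ j → InD⇒ (mem j)
    ; generates   = λ φ t → let c , e = gen φ (InD⇐ t) in c , λ x i →
        trans (eval-≈ (e i) x) (eval-sum (λ j → c j ⊗ θ j i) x)
    ; independent = λ c e j → eval-≈ (ind c (λ i → vanishing⇒≈𝟘 _
        (λ x → trans (eval-sum (λ j → c j ⊗ θ j i) x) (e x i))) j) }

Basis-⇔ : ∀ {n m} {D D′ : Der n → Set} {θ : Fin m → Der n} →
  (∀ {φ} → D φ → D′ φ) → (∀ {φ} → D′ φ → D φ) → Basis D θ → Basis D′ θ
Basis-⇔ to from B = record
  { member = λ j → to (member j) ; generates = λ φ d → generates φ (from d) ; independent = independent }
  where open Basis B

-- Derivations tangent to a list of hyperplanes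

VanishesOn : ∀ {n} → Form n → Der n → Set
VanishesOn a φ = ∀ x → Ker a x → dot a (val φ x) ≡ 0ℚ

VanishesOnAll : ∀ {n} → List (Form n) → Der n → Set
VanishesOnAll as φ = All (λ a → VanishesOn a φ) as

dot-sum : ∀ {n m} (a : Form n) (v : Fin m → Pt n) → dot a (λ i → sumℚ (λ j → v j i)) ≡ sumℚ (λ j → dot a (v j))
dot-sum a v = trans (sum-cong (λ i → sym (sum-*ˡ (a i) (λ j → v j i)))) (sum-swap (λ i j → a i * v j i))

-- The addition step.  If θ is a basis of D, and modulo the form a all values
-- θ_j(a) are multiples c_j of the value θ_k(a) (up to the scalars d_j), then
-- subtracting multiples of θ_k makes all θ_j with j ≠ k tangent to ker a, and
-- a θ_k completes them to a basis.  The last value is non-zero at a point of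
-- ker a, so it can be cancelled there.

module Addition {n m} (a : Form n)
  (k : Fin m) (d : Fin m → ℚ) (c : Fin m → Poly n) (θ : Fin m → Der n) where

  θ′ : Fin m → Der n
  θ′ j i with j FinP.≟ k
  ... | yes _ = lin a ⊗ θ k i
  ... | no  _ = (con (d j) ⊗ θ j i) ⊕ (⊝ (c j ⊗ θ k i))

  θ′-row : ∀ i x → eval (θ′ k i) x ≡ dot a x * eval (θ k i) x
  θ′-row i x with k FinP.≟ k
  ... | yes _  = cong (_* eval (θ k i) x) (eval-lin a x)
  ... | no k≢k = ⊥-elim (k≢k refl)

  θ′-other : ∀ j → j ≢ k → ∀ i x → eval (θ′ j i) x ≡ d j * eval (θ j i) x - eval (c j) x * eval (θ k i) x
  θ′-other j j≢k i x with j FinP.≟ k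
  ... | yes e = ⊥-elim (j≢k e)
  ... | no  _ = refl

  dot-other : ∀ b j → j ≢ k → ∀ x → dot b (val (θ′ j) x) ≡ d j * dot b (val (θ j) x) - eval (c j) x * dot b (val (θ k) x)
  dot-other b j j≢k x = trans (dot-cong b (λ i → trans (θ′-other j j≢k i x)
      (solve 4 (λ d t c u → d :* t :- c :* u := d :* t :+ (:- c) :* u) refl (d j) (eval (θ j i) x) (eval (c j) x) (eval (θ k i) x))))
    (trans (dot-+· b (λ i → d j * eval (θ j i) x) (- eval (c j) x) (val (θ k) x))
      (trans (cong (_+ - eval (c j) x * dot b (val (θ k) x)) (dot-· b (d j) (val (θ j) x)))
        (solve 3 (λ a c u → a :+ (:- c) :* u := a :- c :* u) refl (d j * dot b (val (θ j) x)) (eval (c j) x) (dot b (val (θ k) x)))))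

  dot-row : ∀ b x → dot b (val (θ′ k) x) ≡ dot a x * dot b (val (θ k) x)
  dot-row b x = trans (dot-cong b (λ i → θ′-row i x)) (dot-· b (dot a x) (val (θ k) x))

  module _ (h : Pt n) (ah≡1 : dot a h ≡ 1ℚ) (as : List (Form n)) (B : Basis (VanishesOnAll as) θ) (d≢0 : ∀ j → j ≢ k → d j ≢ 0ℚ)
    (other : ∀ j → j ≢ k → VanishesOn a (θ′ j))
    (p : Pt n) (p∈ker : Ker a p) (row : dot a (val (θ k) p) ≢ 0ℚ) where
    open Basis B

    private
      member′ : ∀ j → VanishesOn a (θ′ j) × VanishesOnAll as (θ′ j)
      member′ j = by-cases (j FinP.≟ k)
        where
        by-cases : Dec (j ≡ k) → VanishesOn a (θ′ j) × VanishesOnAll as (θ′ j)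
        by-cases (yes refl) = (λ x ax → trans (dot-row a x) (trans (cong (_* dot a (val (θ k) x)) ax) (ℚP.*-zeroˡ _)))
          , All.map (λ {b} v x bx → trans (dot-row b x) (trans (cong (dot a x *_) (v x bx)) (ℚP.*-zeroʳ _))) (member k)
        by-cases (no j≢k) = other j j≢k
          , All.zipWith (λ {b} (vj , vk) x bx → trans (dot-other b j j≢k x)
              (trans (cong₂ (λ u w → d j * u - eval (c j) x * w) (vj x bx) (vk x bx))
                (solve 2 (λ d c → d :* :0 :- c :* :0 := :0) refl (d j) (eval (c j) x)))) (member j , member k)

      r : Fin m → ℚ
      r j with j FinP.≟ k
      ... | yes _   = 1ℚ
      ... | no  j≢k = proj₁ (inv (d j) (d≢0 j j≢k))

      -- On the hyperplane, `θ j` and `ρ j` times `θ k` have the same value on `a`. The factor 1 at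
      -- `k` itself makes `τ k` zero, so that all `j` can be treated alike in sums.
      ρ-cases : ∀ j → Dec (j ≡ k) → Poly n
      ρ-cases j (yes _) = 𝟙
      ρ-cases j (no  _) = con (r j) ⊗ c j

      ρ : Fin m → Poly n
      ρ j = ρ-cases j (j FinP.≟ k)

      r-inverse : ∀ j → j ≢ k → r j * d j ≡ 1ℚ
      r-inverse j j≢k with j FinP.≟ k
      ... | yes e  = ⊥-elim (j≢k e)
      ... | no  ne = proj₂ (inv (d j) (d≢0 j ne))

      ρ-row : ∀ x → eval (ρ k) x ≡ 1ℚ
      ρ-row x with k FinP.≟ k
      ... | yes _  = refl
      ... | no k≢k = ⊥-elim (k≢k refl)

      ρ-other : ∀ j → j ≢ k → ∀ x → eval (ρ j) x ≡ r j * eval (c j) x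
      ρ-other j j≢k x = by-cases (j FinP.≟ k)
        where
        by-cases : ∀ dec → eval (ρ-cases j dec) x ≡ r j * eval (c j) x
        by-cases (yes e) = ⊥-elim (j≢k e)
        by-cases (no  _) = refl

      -- the part of θ_j tangent to ker a
      τ : Fin m → Pt n → Pt n
      τ j x i = eval (θ j i) x - eval (ρ j) x * eval (θ k i) x

      τ-row : ∀ x i → τ k x i ≡ 0ℚ
      τ-row x i = trans (cong (λ z → eval (θ k i) x - z * eval (θ k i) x) (ρ-row x))
        (solve 1 (λ u → u :- :1 :* u := :0) refl (eval (θ k i) x))

      τ-other : ∀ j → j ≢ k → ∀ x i → τ j x i ≡ r j * eval (θ′ j i) x
      τ-other j j≢k x i = sym (begin
        r j * eval (θ′ j i) x
          ≡⟨ cong (r j *_) (θ′-other j j≢k i x) ⟩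
        r j * (d j * t - eval (c j) x * u)
          ≡⟨ solve 5 (λ r d t c u → r :* (d :* t :- c :* u) := (r :* d) :* t :- (r :* c) :* u) refl (r j) (d j) t (eval (c j) x) u ⟩
        (r j * d j) * t - (r j * eval (c j) x) * u
          ≡⟨ cong₂ (λ z w → z * t - w * u) (r-inverse j j≢k) (sym (ρ-other j j≢k x)) ⟩
        1ℚ * t - eval (ρ j) x * u
          ≡⟨ cong (_- eval (ρ j) x * u) (ℚP.*-identityˡ t) ⟩
        t - eval (ρ j) x * u ∎)
        where
        open ≡-Reasoning
        t = eval (θ j i) x
        u = eval (θ k i) x

      split : ∀ (f : Fin m → Poly n) x i →
        Combination f θ x i ≡ sumℚ (λ j → eval (f j) x * τ j x i) + sumℚ (λ j → eval (f j) x * eval (ρ j) x) * eval (θ k i) x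
      split f x i = begin
        sumℚ (λ j → eval (f j) x * eval (θ j i) x)
          ≡⟨ sum-cong (λ j → solve 4 (λ f t r u → f :* t := f :* (t :- r :* u) :+ (f :* r) :* u) refl
               (eval (f j) x) (eval (θ j i) x) (eval (ρ j) x) (eval (θ k i) x)) ⟩
        sumℚ (λ j → eval (f j) x * τ j x i + eval (f j) x * eval (ρ j) x * eval (θ k i) x)
          ≡⟨ sum-+ (λ j → eval (f j) x * τ j x i) (λ j → eval (f j) x * eval (ρ j) x * eval (θ k i) x) ⟩
        sumℚ (λ j → eval (f j) x * τ j x i) + sumℚ (λ j → eval (f j) x * eval (ρ j) x * eval (θ k i) x)
          ≡⟨ cong (sumℚ (λ j → eval (f j) x * τ j x i) +_) (sum-*ʳ (eval (θ k i) x) (λ j → eval (f j) x * eval (ρ j) x)) ⟩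
        _ ∎
        where open ≡-Reasoning

      τ-tangent : ∀ j x → Ker a x → dot a (τ j x) ≡ 0ℚ
      τ-tangent j x ax = by-cases (j FinP.≟ k)
        where
        by-cases : Dec (j ≡ k) → dot a (τ j x) ≡ 0ℚ
        by-cases (yes refl) = sum-0 (λ i → trans (cong (a i *_) (τ-row x i)) (ℚP.*-zeroʳ (a i)))
        by-cases (no j≢k)   = trans (dot-cong a (τ-other j j≢k x)) (trans (dot-· a (r j) (val (θ′ j) x))
          (trans (cong (r j *_) (other j j≢k x ax)) (ℚP.*-zeroʳ (r j))))

      -- Splitting every `θ j` as `τ j` plus `ρ j` times `θ k` leaves one coefficient `G` of `θ k`
      -- that is not tangential. Tangency of `φ` forces `G · θ_k(a)` to vanish on the hyperplane;
      -- there `θ_k(a)` is cancelled thanks to the point `p`, so `a` divides `G`, and `G θ_k` is a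
      -- multiple of the new member `a θ_k`.
      module Gen (φ : Der n) (van : VanishesOn a φ) (f : Fin m → Poly n) (eq : ∀ x i → val φ x i ≡ Combination f θ x i) where
        G : Poly n
        G = polySum (λ j → f j ⊗ ρ j)

        eval-G : ∀ x → eval G x ≡ sumℚ (λ j → eval (f j) x * eval (ρ j) x)
        eval-G x = eval-sum (λ j → f j ⊗ ρ j) x

        G-van : ∀ x → Ker a x → eval G x ≡ 0ℚ
        G-van = cancel (Ker-flat a) G (applyDer (θ k) a) p p∈ker (λ e → row (trans (sym (eval-applyDer (θ k) a p)) e))
          (λ x ax → begin
            eval G x * eval (applyDer (θ k) a) x
              ≡⟨ cong₂ _*_ (eval-G x) (eval-applyDer (θ k) a x) ⟩
            sumℚ (λ j → eval (f j) x * eval (ρ j) x) * dot a (val (θ k) x)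
              ≡⟨ sym (ℚP.+-identityˡ _) ⟩
            0ℚ + sumℚ (λ j → eval (f j) x * eval (ρ j) x) * dot a (val (θ k) x)
              ≡⟨ cong (_+ sumℚ (λ j → eval (f j) x * eval (ρ j) x) * dot a (val (θ k) x)) (sym (tangential x ax)) ⟩
            dot a (λ i → sumℚ (λ j → eval (f j) x * τ j x i)) + sumℚ (λ j → eval (f j) x * eval (ρ j) x) * dot a (val (θ k) x)
              ≡⟨ sym (dot-+· a (λ i → sumℚ (λ j → eval (f j) x * τ j x i)) (sumℚ (λ j → eval (f j) x * eval (ρ j) x)) (val (θ k) x)) ⟩
            dot a (λ i → sumℚ (λ j → eval (f j) x * τ j x i) + sumℚ (λ j → eval (f j) x * eval (ρ j) x) * eval (θ k i) x)
              ≡⟨ dot-cong a (λ i → sym (trans (eq x i) (split f x i))) ⟩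
            dot a (val φ x)
              ≡⟨ van x ax ⟩
            0ℚ ∎)
          where
          open ≡-Reasoning
          tangential : ∀ x → Ker a x → dot a (λ i → sumℚ (λ j → eval (f j) x * τ j x i)) ≡ 0ℚ
          tangential x ax = trans (dot-sum a (λ j i → eval (f j) x * τ j x i))
            (sum-0 (λ j → trans (dot-· a (eval (f j) x) (τ j x))
              (trans (cong (eval (f j) x *_) (τ-tangent j x ax)) (ℚP.*-zeroʳ _))))

        g : Poly n
        g = cofactor a h ah≡1 G

        f′-cases : ∀ j → Dec (j ≡ k) → Poly n
        f′-cases j (yes _) = g
        f′-cases j (no  _) = f j ⊗ con (r j)

        f′ : Fin m → Poly n
        f′ j = f′-cases j (j FinP.≟ k)

        term : ∀ j x i → eval (f′ j) x * eval (θ′ j i) x ≡ eval (f j) x * τ j x i + δ k j * (eval G x * eval (θ k i) x)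
        term j x i = by-cases (j FinP.≟ k)
          where
          open ≡-Reasoning
          by-cases : Dec (j ≡ k) → eval (f′ j) x * eval (θ′ j i) x ≡ eval (f j) x * τ j x i + δ k j * (eval G x * eval (θ k i) x)
          by-cases (yes refl) = begin
            eval (f′ k) x * eval (θ′ k i) x             ≡⟨ cong₂ _*_ f′k (θ′-row i x) ⟩
            eval g x * (dot a x * eval (θ k i) x)       ≡⟨ solve 3 (λ g a u → g :* (a :* u) := :0 :+ :1 :* ((a :* g) :* u)) refl (eval g x) (dot a x) (eval (θ k i) x) ⟩
            0ℚ + 1ℚ * (dot a x * eval g x * eval (θ k i) x)
              ≡⟨ cong₂ (λ u w → u + w) (sym (trans (cong (eval (f k) x *_) (τ-row x i)) (ℚP.*-zeroʳ _)))
                   (cong₂ (λ u w → u * (w * eval (θ k i) x)) (sym (δ-refl k)) (sym (divide a h ah≡1 G G-van x))) ⟩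
            eval (f k) x * τ k x i + δ k k * (eval G x * eval (θ k i) x) ∎
            where
            f′k : eval (f′ k) x ≡ eval g x
            f′k with k FinP.≟ k
            ... | yes _ = refl
            ... | no k≢k = ⊥-elim (k≢k refl)
          by-cases (no j≢k) = begin
            eval (f′ j) x * eval (θ′ j i) x             ≡⟨ cong (_* eval (θ′ j i) x) f′j ⟩
            eval (f j) x * r j * eval (θ′ j i) x        ≡⟨ solve 4 (λ f r t w → f :* r :* t := f :* (r :* t) :+ :0 :* w) refl (eval (f j) x) (r j) (eval (θ′ j i) x) (eval G x * eval (θ k i) x) ⟩
            eval (f j) x * (r j * eval (θ′ j i) x) + 0ℚ * (eval G x * eval (θ k i) x)
              ≡⟨ cong₂ (λ u w → eval (f j) x * u + w * (eval G x * eval (θ k i) x)) (sym (τ-other j j≢k x i)) (sym (δ-≢ (λ e → j≢k (sym e)))) ⟩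
            eval (f j) x * τ j x i + δ k j * (eval G x * eval (θ k i) x) ∎
            where
            f′j : eval (f′ j) x ≡ eval (f j) x * r j
            f′j = dec-cases (j FinP.≟ k)
              where
              dec-cases : ∀ dec → eval (f′-cases j dec) x ≡ eval (f j) x * r j
              dec-cases (yes e) = ⊥-elim (j≢k e)
              dec-cases (no  _) = refl

        eq′ : ∀ x i → val φ x i ≡ Combination f′ θ′ x i
        eq′ x i = begin
          val φ x i ≡⟨ trans (eq x i) (split f x i) ⟩
          S + sumℚ (λ j → eval (f j) x * eval (ρ j) x) * eval (θ k i) x
            ≡⟨ cong (λ z → S + z * eval (θ k i) x) (sym (eval-G x)) ⟩
          S + eval G x * eval (θ k i) x
            ≡⟨ cong (S +_) (sym (sum-δ k (λ _ → eval G x * eval (θ k i) x))) ⟩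
          S + sumℚ (λ j → δ k j * (eval G x * eval (θ k i) x))
            ≡⟨ sym (sum-+ (λ j → eval (f j) x * τ j x i) (λ j → δ k j * (eval G x * eval (θ k i) x))) ⟩
          sumℚ (λ j → eval (f j) x * τ j x i + δ k j * (eval G x * eval (θ k i) x))
            ≡⟨ sum-cong (λ j → sym (term j x i)) ⟩
          Combination f′ θ′ x i ∎
          where
          open ≡-Reasoning
          S = sumℚ (λ j → eval (f j) x * τ j x i)

      -- Rewritten in the old basis, the relation has coefficients `F`. For `j ≢ k` they are `d j`
      -- times `f j`, so these `f j` vanish; then the contribution `S` of the subtracted multiples
      -- vanishes too, and at `k` only `a` times `f k` is left.
      module Ind (f : Fin m → Poly n) (eq : ∀ x i → Combination f θ′ x i ≡ 0ℚ) where
        diag off : Fin m → Poly n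
        diag j with j FinP.≟ k
        ... | yes _ = lin a
        ... | no  _ = con (d j)
        off j with j FinP.≟ k
        ... | yes _ = 𝟘
        ... | no  _ = ⊝ c j

        S : Poly n
        S = polySum (λ j → f j ⊗ off j)

        F : Fin m → Poly n
        F j = (f j ⊗ diag j) ⊕ (con (δ k j) ⊗ S)

        θ′-split : ∀ j i x → eval (θ′ j i) x ≡ eval (diag j) x * eval (θ j i) x + eval (off j) x * eval (θ k i) x
        θ′-split j i x with j FinP.≟ k
        ... | yes refl = solve 2 (λ l t → l :* t := l :* t :+ :0 :* t) refl (eval (lin a) x) (eval (θ k i) x)
        ... | no  _    = solve 4 (λ d t c u → d :* t :+ (:- (c :* u)) := d :* t :+ (:- c) :* u) refl (d j) (eval (θ j i) x) (eval (c j) x) (eval (θ k i) x)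

        F-eq : ∀ x i → Combination F θ x i ≡ 0ℚ
        F-eq x i = begin
          sumℚ (λ j → (eval (f j) x * eval (diag j) x + δ k j * eval S x) * eval (θ j i) x)
            ≡⟨ sum-cong (λ j → solve 5 (λ f d e s t → (f :* d :+ e :* s) :* t := f :* (d :* t) :+ e :* (s :* t)) refl
                 (eval (f j) x) (eval (diag j) x) (δ k j) (eval S x) (eval (θ j i) x)) ⟩
          sumℚ (λ j → eval (f j) x * (eval (diag j) x * eval (θ j i) x) + δ k j * (eval S x * eval (θ j i) x))
            ≡⟨ sum-+ (λ j → eval (f j) x * (eval (diag j) x * eval (θ j i) x)) (λ j → δ k j * (eval S x * eval (θ j i) x)) ⟩
          D + sumℚ (λ j → δ k j * (eval S x * eval (θ j i) x))
            ≡⟨ cong (D +_) (trans (sum-δ k (λ j → eval S x * eval (θ j i) x))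
                 (trans (cong (_* eval (θ k i) x) (eval-sum (λ j → f j ⊗ off j) x)) (sym (sum-*ʳ (eval (θ k i) x) (λ j → eval (f j) x * eval (off j) x))))) ⟩
          D + sumℚ (λ j → eval (f j) x * eval (off j) x * eval (θ k i) x)
            ≡⟨ sym (sum-+ (λ j → eval (f j) x * (eval (diag j) x * eval (θ j i) x)) (λ j → eval (f j) x * eval (off j) x * eval (θ k i) x)) ⟩
          sumℚ (λ j → eval (f j) x * (eval (diag j) x * eval (θ j i) x) + eval (f j) x * eval (off j) x * eval (θ k i) x)
            ≡⟨ sum-cong (λ j → trans (solve 4 (λ f u o t → f :* u :+ f :* o :* t := f :* (u :+ o :* t)) refl
                 (eval (f j) x) (eval (diag j) x * eval (θ j i) x) (eval (off j) x) (eval (θ k i) x))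
                 (cong (eval (f j) x *_) (sym (θ′-split j i x)))) ⟩
          Combination f θ′ x i ≡⟨ eq x i ⟩
          0ℚ ∎
          where
          open ≡-Reasoning
          D = sumℚ (λ j → eval (f j) x * (eval (diag j) x * eval (θ j i) x))

        F≡0 : ∀ j x → eval (F j) x ≡ 0ℚ
        F≡0 = independent F F-eq

        other≡0 : ∀ j → j ≢ k → ∀ x → eval (f j) x ≡ 0ℚ
        other≡0 j j≢k x = *-zero-split (d j) (eval (f j) x) (trans fd (F≡0 j x)) (d≢0 j j≢k)
          where
          fd : d j * eval (f j) x ≡ eval (F j) x
          fd with j FinP.≟ k
          ... | yes e = ⊥-elim (j≢k e)
          ... | no  _ = trans (solve 3 (λ d f s → d :* f := f :* d :+ :0 :* s) refl (d j) (eval (f j) x) (eval S x))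
                          (cong (λ z → eval (f j) x * d j + z * eval S x) (sym (δ-≢ (λ e → j≢k (sym e)))))

        S≡0 : ∀ x → eval S x ≡ 0ℚ
        S≡0 x = trans (eval-sum (λ j → f j ⊗ off j) x) (sum-0 (λ j → term j (j FinP.≟ k)))
          where
          term : ∀ j → Dec (j ≡ k) → eval (f j) x * eval (off j) x ≡ 0ℚ
          term j (no j≢k)   = trans (cong (_* eval (off j) x) (other≡0 j j≢k x)) (ℚP.*-zeroˡ _)
          term j (yes refl) with k FinP.≟ k
          ... | yes _  = ℚP.*-zeroʳ _
          ... | no k≢k = ⊥-elim (k≢k refl)

        row≡0 : ∀ x → eval (f k) x ≡ 0ℚ
        row≡0 = cancel-form a h ah≡1 (f k) (λ x → trans (fd x) (F≡0 k x))
          where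
          fd : ∀ x → eval (f k) x * dot a x ≡ eval (F k) x
          fd x with k FinP.≟ k
          ... | yes _  = trans (solve 3 (λ f l e → f :* l := f :* l :+ e :* :0) refl (eval (f k) x) (dot a x) (δ k k))
                           (cong₂ (λ z w → eval (f k) x * z + δ k k * w) (sym (eval-lin a x)) (sym (S≡0 x)))
          ... | no k≢k = ⊥-elim (k≢k refl)

    addition : Basis (VanishesOnAll (a ∷ as)) θ′
    addition = record
      { member      = λ j → let v , vs = member′ j in v ∷ vs
      ; generates   = λ { φ (v ∷ vs) → let f , eq = generates φ vs in Gen.f′ φ v f eq , Gen.eq′ φ v f eq }
      ; independent = λ f eq j x → by-cases f eq j x (j FinP.≟ k) }
      where
      by-cases : ∀ f (eq : ∀ x i → Combination f θ′ x i ≡ 0ℚ) j x → Dec (j ≡ k) → eval (f j) x ≡ 0ℚ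
      by-cases f eq j x (yes refl) = Ind.row≡0 f eq x
      by-cases f eq j x (no j≢k)   = Ind.other≡0 f eq j j≢k x

-- Reflection of Boolean checks

∧-elim : ∀ {a b} → T (a ∧ b) → T a × T b
∧-elim = Equivalence.to T-∧

∨-elim : ∀ {a b} → T (a ∨ b) → T a ⊎ T b
∨-elim = Equivalence.to T-∨

allᶠ : ∀ {m} → (Fin m → Bool) → Bool
allᶠ {zero}  f = true
allᶠ {suc m} f = f fzero ∧ allᶠ (λ j → f (fsuc j))

allᶠ-elim : ∀ {m} (f : Fin m → Bool) → T (allᶠ f) → ∀ j → T (f j)
allᶠ-elim f h fzero    = proj₁ (∧-elim h)
allᶠ-elim f h (fsuc j) = allᶠ-elim (λ j → f (fsuc j)) (proj₂ (∧-elim {f fzero} h)) j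

-- Integral polynomial expressions, and their values in ℤ[s,t]

-- Integer literals keep the normalisation of fractions out of the computations left to the type
-- checker.
data Ex (n : ℕ) : Set where
  K       : ℤ → Ex n
  X       : Fin n → Ex n
  _⊹_ _⋆_ : Ex n → Ex n → Ex n

infixl 6 _⊹_
infixl 7 _⋆_

toP : ∀ {n} → Ex n → Poly n
toP (K z)   = con (ι z)
toP (X i)   = var i
toP (p ⊹ q) = toP p ⊕ toP q
toP (p ⋆ q) = toP p ⊗ toP q

ℤ[t]-Ev ℤ[s,t]-Ev : Ev
ℤ[t]-Ev   = listEv ℤ-Ev
ℤ[s,t]-Ev = listEv ℤ[t]-Ev

-- the outer variable is s, the inner one t
ℤ[s,t] : Set
ℤ[s,t] = List (List ℤ)

private
  module S = Ev ℤ[s,t]-Ev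
open S using (_+̇_; _*̇_; neg)

value : ℤ[s,t] → ℚ → ℚ → ℚ
value p s t = S.⟦ p ⟧ ((tt , t) , s)

-- Zero is the empty list, so that a product with the literal 0 collapses to the empty list instead
-- of producing a list of zeros.
constant : ℤ → ℤ[s,t]
constant (ℤ.+ 0) = []
constant z       = (z ∷ []) ∷ []

value-constant : ∀ z s t → value (constant z) s t ≡ ι z
value-constant z s t = go z
  where
  lemma : ∀ z → (ι z + t * 0ℚ) + s * 0ℚ ≡ ι z
  lemma z = solve 3 (λ z s t → (z :+ t :* :0) :+ s :* :0 := z) refl (ι z) s t
  go : ∀ z → value (constant z) s t ≡ ι z
  go (ℤ.+ 0)     = refl
  go ℤ.+[1+ n ]  = lemma ℤ.+[1+ n ]
  go ℤ.-[1+ n ]  = lemma ℤ.-[1+ n ]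

evaluate : ∀ {n} → Vec ℤ[s,t] n → Ex n → ℤ[s,t]
evaluate xs (K z)   = constant z
evaluate xs (X i)   = lookup xs i
evaluate xs (p ⊹ q) = evaluate xs p +̇ evaluate xs q
evaluate xs (p ⋆ q) = evaluate xs p *̇ evaluate xs q

module _ {n} {xs : Vec ℤ[s,t] n} {x : Pt n} {s t : ℚ} (xs≡x : ∀ i → value (lookup xs i) s t ≡ x i) where
  value-evaluate : ∀ p → value (evaluate xs p) s t ≡ eval (toP p) x
  value-evaluate (K z)   = value-constant z s t
  value-evaluate (X i)   = xs≡x i
  value-evaluate (p ⊹ q) = trans (S.⟦+⟧ (evaluate xs p) (evaluate xs q) _) (cong₂ _+_ (value-evaluate p) (value-evaluate q))
  value-evaluate (p ⋆ q) = trans (S.⟦*⟧ (evaluate xs p) (evaluate xs q) _) (cong₂ _*_ (value-evaluate p) (value-evaluate q))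

fm : ∀ {n} → Vec ℤ n → Form n
fm a i = ι (lookup a i)

linear : ∀ {n} → Vec ℤ n → Vec ℤ[s,t] n → ℤ[s,t]
linear []       []       = []
linear (a ∷ as) (x ∷ xs) = (constant a *̇ x) +̇ linear as xs

value-linear : ∀ {n} (a : Vec ℤ n) (xs : Vec ℤ[s,t] n) (x : Pt n) s t → (∀ i → value (lookup xs i) s t ≡ x i) →
  value (linear a xs) s t ≡ dot (fm a) x
value-linear []       []       x s t h = refl
value-linear (a ∷ as) (y ∷ ys) x s t h = trans (S.⟦+⟧ (constant a *̇ y) (linear as ys) _)
  (cong₂ _+_ (trans (S.⟦*⟧ (constant a) y _) (cong₂ _*_ (value-constant a s t) (h fzero)))
    (value-linear as ys (λ i → x (fsuc i)) s t (λ i → h (fsuc i))))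

isZeroℤ : ℤ → Bool
isZeroℤ (ℤ.+ 0) = true
isZeroℤ _       = false

isZero₁ : List ℤ → Bool
isZero₁ []       = true
isZero₁ (z ∷ zs) = isZeroℤ z ∧ isZero₁ zs

isZero : ℤ[s,t] → Bool
isZero []       = true
isZero (p ∷ ps) = isZero₁ p ∧ isZero ps

isZeroℤ-sound : ∀ z → T (isZeroℤ z) → z ≡ ℤ.+ 0
isZeroℤ-sound (ℤ.+ 0) _ = refl

value₁ : List ℤ → ℚ → ℚ
value₁ p t = Ev.⟦_⟧ ℤ[t]-Ev p (tt , t)

isZero₁-sound : ∀ p → T (isZero₁ p) → ∀ t → value₁ p t ≡ 0ℚ
isZero₁-sound []       h t = refl
isZero₁-sound (z ∷ zs) h t with ∧-elim {isZeroℤ z} h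
... | hz , hzs = trans (cong₂ (λ u v → ι u + t * v) (isZeroℤ-sound z hz) (isZero₁-sound zs hzs t))
  (solve 1 (λ t → :0 :+ t :* :0 := :0) refl t)

isZero-sound : ∀ p → T (isZero p) → ∀ s t → value p s t ≡ 0ℚ
isZero-sound []       h s t = refl
isZero-sound (p ∷ ps) h s t with ∧-elim {isZero₁ p} h
... | hp , hps = trans (cong₂ (λ u v → u + s * v) (isZero₁-sound p hp t) (isZero-sound ps hps s t))
  (solve 1 (λ t → :0 :+ t :* :0 := :0) refl s)

nonZeroℤ : ℤ → Bool
nonZeroℤ z = not (isZeroℤ z)

nonZeroℤ-sound : ∀ z → T (nonZeroℤ z) → ι z ≢ 0ℚ
nonZeroℤ-sound (ℤ.+ 0)     ()
nonZeroℤ-sound ℤ.+[1+ n ] _ ()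
nonZeroℤ-sound ℤ.-[1+ n ] _ ()

at₁ : List ℤ → ℤ → ℤ
at₁ []       t = ℤ.+ 0
at₁ (z ∷ zs) t = z ℤ.+ t ℤ.* at₁ zs t

at₂ : ℤ[s,t] → ℤ → ℤ → ℤ
at₂ []       s t = ℤ.+ 0
at₂ (p ∷ ps) s t = at₁ p t ℤ.+ s ℤ.* at₂ ps s t

at₁-sound : ∀ p t → value₁ p (ι t) ≡ ι (at₁ p t)
at₁-sound []       t = refl
at₁-sound (z ∷ zs) t = sym (trans (ι-+ z (t ℤ.* at₁ zs t)) (cong (ι z +_) (trans (ι-* t (at₁ zs t)) (cong (ι t *_) (sym (at₁-sound zs t))))))

at₂-sound : ∀ p s t → value p (ι s) (ι t) ≡ ι (at₂ p s t)
at₂-sound []       s t = refl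
at₂-sound (p ∷ ps) s t = sym (trans (ι-+ (at₁ p t) (s ℤ.* at₂ ps s t))
  (cong₂ _+_ (sym (at₁-sound p t)) (trans (ι-* s (at₂ ps s t)) (cong (ι s *_) (sym (at₂-sound ps s t))))))

-- Homogeneous polynomials

infixr 8 _·ᵖ_
_·ᵖ_ : ∀ {n} → ℚ → Pt n → Pt n
(t ·ᵖ x) i = t * x i

Homogeneous : ∀ {n} → ℕ → Poly n → Set
Homogeneous D f = ∀ t x → eval f (t ·ᵖ x) ≡ pw t D * eval f x

degree : ∀ {n} → Ex n → ℕ
degree (K _)   = 0
degree (X _)   = 1
degree (p ⊹ q) = degree p
degree (p ⋆ q) = degree p ℕ.+ degree q

isHomogeneous : ∀ {n} → Ex n → Bool
isHomogeneous (K _)   = true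
isHomogeneous (X _)   = true
isHomogeneous (p ⊹ q) = isHomogeneous p ∧ isHomogeneous q ∧ (degree p ≡ᵇ degree q)
isHomogeneous (p ⋆ q) = isHomogeneous p ∧ isHomogeneous q

homogeneous : ∀ {n} (p : Ex n) → T (isHomogeneous p) → Homogeneous (degree p) (toP p)
homogeneous (K z)   _ t x = sym (ℚP.*-identityˡ _)
homogeneous (X i)   _ t x = cong (_* x i) (sym (ℚP.*-identityʳ t))
homogeneous (p ⊹ q) h t x with ∧-elim {isHomogeneous p} h
... | hp , h′ with ∧-elim {isHomogeneous q} h′
... | hq , e = trans (cong₂ _+_ (homogeneous p hp t x)
    (trans (homogeneous q hq t x) (cong (λ d → pw t d * eval (toP q) x) (sym (ℕP.≡ᵇ⇒≡ (degree p) (degree q) e)))))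
  (sym (ℚP.*-distribˡ-+ _ _ _))
homogeneous (p ⋆ q) h t x with ∧-elim {isHomogeneous p} h
... | hp , hq = trans (cong₂ _*_ (homogeneous p hp t x) (homogeneous q hq t x))
  (trans (solve 4 (λ a b c d → (a :* b) :* (c :* d) := (a :* c) :* (b :* d)) refl
     (pw t (degree p)) (eval (toP p) x) (pw t (degree q)) (eval (toP q) x))
   (cong (_* (eval (toP p) x * eval (toP q) x)) (sym (pw-+ t (degree p) (degree q)))))

dot-homogeneous : ∀ {n} D (a : Form n) (θ : Der n) → (∀ i → Homogeneous D (θ i)) →
  ∀ t x → dot a (val θ (t ·ᵖ x)) ≡ pw t D * dot a (val θ x)
dot-homogeneous D a θ h t x = trans (dot-cong a (λ i → h i t x)) (dot-· a (pw t D) (val θ x))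

-- Points with `x z ≢ 0` are scaled into the chart. Hence `f` times the coordinate `x z` vanishes on
-- the whole hyperplane, and the coordinate is cancelled because it is nonzero at `p`.
vanish-chart : ∀ {n} (a : Form n) (z : Fin n) (f : Poly n) D → Homogeneous D f →
  (p : Pt n) → Ker a p → p z ≢ 0ℚ →
  (∀ x → Ker a x → x z ≡ 1ℚ → eval f x ≡ 0ℚ) → ∀ x → Ker a x → eval f x ≡ 0ℚ
vanish-chart a z f D hom p ap pz chart = cancel (Ker-flat a) f (var z) p ap pz product
  where
  product : ∀ x → Ker a x → eval f x * x z ≡ 0ℚ
  product x ax with x z ℚ.≟ 0ℚ
  ... | yes e = trans (cong (eval f x *_) e) (ℚP.*-zeroʳ _)
  ... | no ne with inv (x z) ne
  ...   | r , rx≡1 = trans (cong (_* x z) f≡0) (ℚP.*-zeroˡ _)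
    where
    f≡0 : eval f x ≡ 0ℚ
    f≡0 = begin
      eval f x                          ≡⟨ eval-cong f (λ i → trans (sym (ℚP.*-identityˡ (x i)))
                                             (trans (cong (_* x i) (trans (sym rx≡1) (ℚP.*-comm r (x z)))) (ℚP.*-assoc (x z) r (x i)))) ⟩
      eval f (x z ·ᵖ (r ·ᵖ x))          ≡⟨ hom (x z) (r ·ᵖ x) ⟩
      pw (x z) D * eval f (r ·ᵖ x)      ≡⟨ cong (pw (x z) D *_) (chart (r ·ᵖ x) (trans (dot-· a r x) (trans (cong (r *_) ax) (ℚP.*-zeroʳ r))) rx≡1) ⟩
      pw (x z) D * 0ℚ                   ≡⟨ ℚP.*-zeroʳ _ ⟩
      0ℚ ∎
      where open ≡-Reasoning

sum-punchIn : ∀ {n} (p : Fin (suc n)) (f : Fin (suc n) → ℚ) → sumℚ f ≡ f p + sumℚ (λ j → f (punchIn p j))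
sum-punchIn fzero f = refl
sum-punchIn {suc n} (fsuc p) f = trans (cong (f fzero +_) (sum-punchIn p (λ j → f (fsuc j))))
  (solve 3 (λ a b c → a :+ (b :+ c) := b :+ (a :+ c)) refl (f fzero) (f (fsuc p)) _)

-- The chart (s, t) ↦ x of the hyperplane a, a_p = ± 1, with the three
-- coordinates other than x_p equal to s, t, 1.

module Chart (a : Vec ℤ 4) (p : Fin 4) where
  free : Fin 3 → Fin 4
  free = punchIn p

  solved : ℤ[s,t]
  solved = (m ℤ.* b (fsuc (fsuc fzero)) ∷ m ℤ.* b (fsuc fzero) ∷ []) ∷ (m ℤ.* b fzero ∷ []) ∷ []
    where
    -- The coefficient `a_p`, being 1 or -1, is its own inverse, so solving for `x_p` stays within
    -- the integers.
    m = ℤ.- lookup a p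
    b : Fin 3 → ℤ
    b j = lookup a (free j)

  others : Vec ℤ[s,t] 3
  others = ([] ∷ (ℤ.+ 1 ∷ []) ∷ []) ∷ ((ℤ.+ 0 ∷ ℤ.+ 1 ∷ []) ∷ []) ∷ ((ℤ.+ 1 ∷ []) ∷ []) ∷ []

  coordinates : Vec ℤ[s,t] 4
  coordinates = insertAt others p solved

  point : ℚ → ℚ → Pt 4
  point s t i = value (lookup coordinates i) s t

  module _ (s t : ℚ) where
    freeVal : Fin 3 → ℚ
    freeVal fzero               = s
    freeVal (fsuc fzero)        = t
    freeVal (fsuc (fsuc fzero)) = 1ℚ

    point-free : ∀ j → point s t (free j) ≡ freeVal j
    point-free j = trans (cong (λ q → value q s t) (VecP.insertAt-punchIn others p solved j)) (go j)
      where
      go : ∀ j → value (lookup others j) s t ≡ freeVal j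
      go fzero = solve 2 (λ s t → :0 :+ s :* ((:1 :+ t :* :0) :+ s :* :0) := s) refl s t
      go (fsuc fzero) = solve 2 (λ s t → (:0 :+ t :* (:1 :+ t :* :0)) :+ s :* :0 := t) refl s t
      go (fsuc (fsuc fzero)) = solve 2 (λ s t → (:1 :+ t :* :0) :+ s :* :0 := :1) refl s t

    point-solved : point s t p ≡ - fm a p * sumℚ (λ j → fm a (free j) * freeVal j)
    point-solved = trans (cong (λ q → value q s t) (VecP.insertAt-lookup others p solved))
      (trans (cong₂ (λ u v → u + s * v)
           (cong₂ (λ u v → u + t * (v + t * 0ℚ)) (ι* (fsuc (fsuc fzero))) (ι* (fsuc fzero)))
           (cong (λ u → (u + t * 0ℚ) + s * 0ℚ) (ι* fzero)))
        (solve 6 (λ m a b c s t → (m :* c :+ t :* (m :* b :+ t :* :0)) :+ s :* ((m :* a :+ t :* :0) :+ s :* :0)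
                     := m :* (a :* s :+ (b :* t :+ (c :* :1 :+ :0)))) refl
           (- fm a p) (fm a (free fzero)) (fm a (free (fsuc fzero))) (fm a (free (fsuc (fsuc fzero)))) s t))
      where
      ι* : ∀ j → ι (ℤ.- lookup a p ℤ.* lookup a (free j)) ≡ - fm a p * fm a (free j)
      ι* j = trans (ι-* _ _) (cong (_* fm a (free j)) (ι-neg (lookup a p)))

  module _ (unit : lookup a p ℤ.* lookup a p ≡ ℤ.+ 1) where
    unitℚ : fm a p * fm a p ≡ 1ℚ
    unitℚ = trans (sym (ι-* _ _)) (cong ι unit)

    a_p≢0 : fm a p ≢ 0ℚ
    a_p≢0 e = 1≢0 (trans (sym unitℚ) (trans (cong (_* fm a p) e) (ℚP.*-zeroˡ _)))

    point∈Ker : ∀ s t → Ker (fm a) (point s t)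
    point∈Ker s t = trans (sum-punchIn p (λ i → fm a i * point s t i))
      (trans (cong₂ _+_ (trans (cong (fm a p *_) (point-solved s t))
           (trans (solve 2 (λ a r → a :* ((:- a) :* r) := :- (a :* a :* r)) refl (fm a p) R) (cong (λ z → - (z * R)) unitℚ)))
         (sum-cong (λ j → cong (fm a (free j) *_) (point-free s t j))))
       (solve 1 (λ r → (:- (:1 :* r)) :+ r := :0) refl R))
      where R = sumℚ (λ j → fm a (free j) * freeVal s t j)

    point-surjective : ∀ x → Ker (fm a) x → x (free (fsuc (fsuc fzero))) ≡ 1ℚ →
      ∀ i → point (x (free fzero)) (x (free (fsuc fzero))) i ≡ x i
    point-surjective x ax x₂≡1 i with i FinP.≟ p
    ... | no i≢p = trans (cong (point _ _) (sym e)) (trans (point-free _ _ j) (trans (go j) (cong x e)))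
      where
      j = punchOut (λ q → i≢p (sym q))
      e : free j ≡ i
      e = FinP.punchIn-punchOut (λ q → i≢p (sym q))
      go : ∀ j → freeVal (x (free fzero)) (x (free (fsuc fzero))) j ≡ x (free j)
      go fzero = refl
      go (fsuc fzero) = refl
      go (fsuc (fsuc fzero)) = sym x₂≡1
    ... | yes refl = begin
        point s t i                                          ≡⟨ point-solved s t ⟩
        - fm a i * R                                         ≡⟨ cong (- fm a i *_) (sum-cong (λ j → cong (fm a (free j) *_) (go j))) ⟩
        - fm a i * R′                                        ≡⟨ solve 3 (λ a r x → (:- a) :* r := (:- a) :* (a :* x :+ r) :+ a :* a :* x) refl (fm a i) R′ (x i) ⟩
        - fm a i * (fm a i * x i + R′) + fm a i * fm a i * x i ≡⟨ cong₂ (λ u v → - fm a i * u + v * x i) (trans (sym (sum-punchIn i (λ j → fm a j * x j))) ax) unitℚ ⟩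
        - fm a i * 0ℚ + 1ℚ * x i                             ≡⟨ solve 2 (λ a x → (:- a) :* :0 :+ :1 :* x := x) refl (fm a i) (x i) ⟩
        x i ∎
      where
      open ≡-Reasoning
      s = x (free fzero)
      t = x (free (fsuc fzero))
      R = sumℚ (λ j → fm a (free j) * freeVal s t j)
      R′ = sumℚ (λ j → fm a (free j) * x (free j))
      go : ∀ j → freeVal s t j ≡ x (free j)
      go fzero = refl
      go (fsuc fzero) = refl
      go (fsuc (fsuc fzero)) = sym x₂≡1

-- Bases of derivations given by a sequence of addition steps

record Step : Set where
  constructor step
  field
    normal : Vec ℤ 4
    pivot  : Fin 4          -- coordinate with coefficient ± 1
    row    : Fin 4          -- the derivation to be multiplied by the form
    -- Factors that clear denominators, so that all `coef` are integral.
    scal   : Vec ℤ 4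
    coef   : Vec (Ex 4) 4
open Step

module Add (s : Step) (θ : Fin 4 → Der 4) =
  Addition (fm (normal s)) (row s) (λ j → ι (lookup (scal s) j)) (λ j → toP (lookup (coef s) j)) θ

rows : List Step → Fin 4 → Der 4
rows []       j i = con (δ j i)
rows (s ∷ ss)     = Add.θ′ s (rows ss)

normals : List Step → List (Form 4)
normals = map (λ s → fm (normal s))

eliminate : ∀ {m} → Vec ℤ[s,t] 4 → ℤ[s,t] → Vec ℤ m → Vec (Ex 4) m → Vec ℤ[s,t] m → Vec ℤ[s,t] m
eliminate xs w []       []       []       = []
eliminate xs w (d ∷ ds) (c ∷ cs) (v ∷ vs) = ((constant d *̇ v) +̇ neg (evaluate xs c *̇ w)) ∷ eliminate xs w ds cs vs

-- The update overwrites whatever `eliminate` puts at the pivot row, so the entries of `scal` and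
-- `coef` at that position have no influence. Both parts use the pivot value from before the step.
advance : Vec ℤ[s,t] 4 → Step → Vec ℤ[s,t] 4 → Vec ℤ[s,t] 4
advance xs s v = eliminate xs (lookup v (row s)) (scal s) (coef s) v [ row s ]≔ (linear (normal s) xs *̇ lookup v (row s))

-- θ_j(a) for the rows θ_j of the current basis; only these, never the θ_j
-- themselves, are expanded
values : Vec ℤ[s,t] 4 → Vec ℤ 4 → List Step → Vec ℤ[s,t] 4
values xs a []       = Vec.map constant a
values xs a (s ∷ ss) = advance xs s (values xs a ss)

value-eliminate : ∀ {m} xs w (ds : Vec ℤ m) cs vs j s t →
  value (lookup (eliminate xs w ds cs vs) j) s t
    ≡ ι (lookup ds j) * value (lookup vs j) s t - value (evaluate xs (lookup cs j)) s t * value w s t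
value-eliminate xs w (d ∷ ds) (c ∷ cs) (v ∷ vs) fzero s t =
  trans (S.⟦+⟧ (constant d *̇ v) (neg (evaluate xs c *̇ w)) _)
    (cong₂ _+_ (trans (S.⟦*⟧ (constant d) v _) (cong (_* value v s t) (value-constant d s t)))
      (trans (S.⟦neg⟧ (evaluate xs c *̇ w) _) (cong -_ (S.⟦*⟧ (evaluate xs c) w _))))
value-eliminate xs w (d ∷ ds) (c ∷ cs) (v ∷ vs) (fsuc j) s t = value-eliminate xs w ds cs vs j s t

module _ {xs : Vec ℤ[s,t] 4} {x : Pt 4} {s t : ℚ} (xs≡x : ∀ i → value (lookup xs i) s t ≡ x i) (a : Vec ℤ 4) where

  advance-sound : ∀ st (θ : Fin 4 → Der 4) v →
    (∀ j → value (lookup v j) s t ≡ dot (fm a) (val (θ j) x)) →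
    ∀ j → value (lookup (advance xs st v) j) s t ≡ dot (fm a) (val (Add.θ′ st θ j) x)
  advance-sound st θ v ih j = by-cases (j FinP.≟ row st)
    where
    by-cases : Dec (j ≡ row st) → value (lookup (advance xs st v) j) s t ≡ dot (fm a) (val (Add.θ′ st θ j) x)
    by-cases (yes refl) = trans
      (cong (λ q → value q s t) (VecP.lookup∘update j (eliminate xs (lookup v j) (scal st) (coef st) v) _))
      (trans (S.⟦*⟧ (linear (normal st) xs) (lookup v j) _)
        (trans (cong₂ _*_ (value-linear (normal st) xs x s t xs≡x) (ih j)) (sym (Add.dot-row st θ (fm a) x))))
    by-cases (no j≢k) = trans
      (cong (λ q → value q s t) (VecP.lookup∘update′ j≢k (eliminate xs (lookup v (row st)) (scal st) (coef st) v) _))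
      (trans (value-eliminate xs (lookup v (row st)) (scal st) (coef st) v j s t)
        (trans (cong₂ (λ u w → ι (lookup (scal st) j) * u - w) (ih j)
                 (cong₂ _*_ (value-evaluate xs≡x (lookup (coef st) j)) (ih (row st))))
          (sym (Add.dot-other st θ (fm a) j j≢k x))))

  values-sound : ∀ ss j → value (lookup (values xs a ss) j) s t ≡ dot (fm a) (val (rows ss j) x)
  values-sound []        j = trans (cong (λ q → value q s t) (VecP.lookup-map j constant a))
    (trans (value-constant (lookup a j) s t)
      (sym (trans (sum-cong (λ i → ℚP.*-comm (fm a i) (δ j i))) (sum-δ j (fm a)))))
  values-sound (st ∷ ss) j = advance-sound st (rows ss) (values xs a ss) (values-sound ss) j

degrees : List Step → Vec ℕ 4
degrees []       = 0 ∷ 0 ∷ 0 ∷ 0 ∷ []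
degrees (s ∷ ss) = degrees ss [ row s ]≔ suc (lookup (degrees ss) (row s))

isK0 : ∀ {n} → Ex n → Bool
isK0 (K z) = isZeroℤ z
isK0 _     = false

isK0-sound : ∀ {n} (p : Ex n) → T (isK0 p) → ∀ x → eval (toP p) x ≡ 0ℚ
isK0-sound (K z) h x = cong ι (isZeroℤ-sound z h)

-- The literal 0 has `degree` 0 and would in general fail the comparison of degrees, although as a
-- polynomial it is homogeneous of every degree; hence the separate case.
coef-ok : ∀ {n} → Ex n → ℕ → ℕ → Bool
coef-ok c e e′ = isK0 c ∨ (isHomogeneous c ∧ (degree c ℕ.+ e ≡ᵇ e′))

-- the sample values of s and t, at which the pivot value must not vanish
s₀ t₀ : ℤ
s₀ = ℤ.+ 17
t₀ = ℤ.+ 41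

isRow : Fin 4 → Fin 4 → Bool
isRow j k = isYes (j FinP.≟ k)

row-ok : Step → Vec ℕ 4 → Vec ℤ[s,t] 4 → Fin 4 → Bool
row-ok s e w j = isRow j (row s) ∨
  (coef-ok (lookup (coef s) j) (lookup e (row s)) (lookup e j)
   ∧ nonZeroℤ (lookup (scal s) j) ∧ isZero (lookup w j))

step-ok′ : Step → Vec ℕ 4 → Vec ℤ[s,t] 4 → Vec ℤ[s,t] 4 → Bool
step-ok′ s e xs v = nonZeroℤ (at₂ (lookup v (row s)) s₀ t₀) ∧ allᶠ (row-ok s e (advance xs s v))

step-ok : Step → List Step → Bool
step-ok s ss = isYes (lookup (normal s) (pivot s) ℤ.* lookup (normal s) (pivot s) ℤ.≟ ℤ.+ 1)
  ∧ step-ok′ s (degrees ss) xs (values xs (normal s) ss)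
  where xs = Chart.coordinates (normal s) (pivot s)

steps-ok : List Step → Bool
steps-ok []       = true
steps-ok (s ∷ ss) = step-ok s ss ∧ steps-ok ss

isYes-sound : ∀ {P : Set} (d : Dec P) → T (isYes d) → P
isYes-sound (yes p) _ = p

module StepOK (s : Step) (ss : List Step) (ok : T (step-ok s ss)) where
  private
    a  = normal s
    k  = row s
    module C = Chart a (pivot s)
    xs = C.coordinates
    e  = degrees ss

  unit : lookup a (pivot s) ℤ.* lookup a (pivot s) ≡ ℤ.+ 1
  unit = isYes-sound (_ ℤ.≟ _) (proj₁ (∧-elim ok))

  private
    ok′ : T (step-ok′ s e xs (values xs a ss))
    ok′ = proj₂ (∧-elim {isYes (lookup a (pivot s) ℤ.* lookup a (pivot s) ℤ.≟ ℤ.+ 1)} ok)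
    all-rows : T (allᶠ (row-ok s e (advance xs s (values xs a ss))))
    all-rows = proj₂ (∧-elim {nonZeroℤ (at₂ (lookup (values xs a ss) k) s₀ t₀)} ok′)

    other : ∀ j → j ≢ k → T (coef-ok (lookup (coef s) j) (lookup e k) (lookup e j)
      ∧ nonZeroℤ (lookup (scal s) j) ∧ isZero (lookup (advance xs s (values xs a ss)) j))
    other j j≢k with ∨-elim {isRow j k} (allᶠ-elim (row-ok s e (advance xs s (values xs a ss))) all-rows j)
    ... | inj₁ y = ⊥-elim (j≢k (isYes-sound (j FinP.≟ k) y))
    ... | inj₂ h = h

  scal≢0 : ∀ j → j ≢ k → ι (lookup (scal s) j) ≢ 0ℚ
  scal≢0 j j≢k = nonZeroℤ-sound (lookup (scal s) j) (proj₁ (∧-elim (proj₂ (∧-elim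
    {coef-ok (lookup (coef s) j) (lookup e k) (lookup e j)} (other j j≢k)))))

  zero-on-chart : ∀ j → j ≢ k → ∀ u t → value (lookup (values xs a (s ∷ ss)) j) u t ≡ 0ℚ
  zero-on-chart j j≢k = isZero-sound (lookup (values xs a (s ∷ ss)) j) (proj₂ (∧-elim {nonZeroℤ (lookup (scal s) j)} (proj₂ (∧-elim
    {coef-ok (lookup (coef s) j) (lookup e k) (lookup e j)} (other j j≢k)))))

  coef-homogeneous : ∀ j → j ≢ k → T (coef-ok (lookup (coef s) j) (lookup e k) (lookup e j))
  coef-homogeneous j j≢k = proj₁ (∧-elim (other j j≢k))

  p : Pt 4
  p = C.point (ι s₀) (ι t₀)

  p∈Ker : Ker (fm a) p
  p∈Ker = C.point∈Ker unit (ι s₀) (ι t₀)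

  row≢0 : dot (fm a) (val (rows ss k) p) ≢ 0ℚ
  row≢0 z = nonZeroℤ-sound (at₂ (lookup (values xs a ss) k) s₀ t₀) (proj₁ (∧-elim ok′))
    (trans (sym (at₂-sound (lookup (values xs a ss) k) s₀ t₀))
      (trans (values-sound {xs} {p} {ι s₀} {ι t₀} (λ i → refl) a ss k) z))

  -- Homogeneity has to be carried through all steps, because the zero test of a step sees only an
  -- affine chart of the hyperplane. The degree bookkeeping fits: only the pivot row gains one, and
  -- each coefficient makes up the difference of two degrees.
  next-homogeneous : (∀ j i → Homogeneous (lookup e j) (rows ss j i)) →
    ∀ j i → Homogeneous (lookup (degrees (s ∷ ss)) j) (rows (s ∷ ss) j i)
  next-homogeneous hom j i t x = by-cases (j FinP.≟ k)
    where
    module A = Add s (rows ss)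
    by-cases : Dec (j ≡ k) → eval (A.θ′ j i) (t ·ᵖ x) ≡ pw t (lookup (degrees (s ∷ ss)) j) * eval (A.θ′ j i) x
    by-cases (yes refl) = begin
      eval (A.θ′ j i) (t ·ᵖ x)                           ≡⟨ A.θ′-row i (t ·ᵖ x) ⟩
      dot (fm a) (t ·ᵖ x) * eval (rows ss j i) (t ·ᵖ x)  ≡⟨ cong₂ _*_ (dot-· (fm a) t x) (hom j i t x) ⟩
      t * dot (fm a) x * (pw t (lookup e j) * eval (rows ss j i) x)
        ≡⟨ solve 4 (λ t d w r → t :* d :* (w :* r) := t :* w :* (d :* r)) refl t (dot (fm a) x) (pw t (lookup e j)) (eval (rows ss j i) x) ⟩
      pw t (suc (lookup e j)) * (dot (fm a) x * eval (rows ss j i) x)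
        ≡⟨ cong₂ (λ d r → pw t d * r) (sym (VecP.lookup∘update j e (suc (lookup e j)))) (sym (A.θ′-row i x)) ⟩
      pw t (lookup (degrees (s ∷ ss)) j) * eval (A.θ′ j i) x ∎
      where open ≡-Reasoning
    by-cases (no j≢k) = begin
      eval (A.θ′ j i) (t ·ᵖ x)
        ≡⟨ A.θ′-other j j≢k i (t ·ᵖ x) ⟩
      D * eval (rows ss j i) (t ·ᵖ x) - eval c (t ·ᵖ x) * eval (rows ss k i) (t ·ᵖ x)
        ≡⟨ cong₂ (λ u w → D * u - w) (hom j i t x) (c-hom (∨-elim {isK0 (lookup (coef s) j)} (coef-homogeneous j j≢k))) ⟩
      D * (pw t (lookup e j) * eval (rows ss j i) x) - pw t (lookup e j) * (eval c x * eval (rows ss k i) x)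
        ≡⟨ solve 4 (λ d w r q → d :* (w :* r) :- w :* q := w :* (d :* r :- q)) refl D (pw t (lookup e j)) (eval (rows ss j i) x) (eval c x * eval (rows ss k i) x) ⟩
      pw t (lookup e j) * (D * eval (rows ss j i) x - eval c x * eval (rows ss k i) x)
        ≡⟨ cong₂ (λ d r → pw t d * r) (sym (VecP.lookup∘update′ j≢k e (suc (lookup e k)))) (sym (A.θ′-other j j≢k i x)) ⟩
      pw t (lookup (degrees (s ∷ ss)) j) * eval (A.θ′ j i) x ∎
      where
      open ≡-Reasoning
      D = ι (lookup (scal s) j)
      c = toP (lookup (coef s) j)
      c-hom : T (isK0 (lookup (coef s) j)) ⊎ T (isHomogeneous (lookup (coef s) j) ∧ (degree (lookup (coef s) j) ℕ.+ lookup e k ≡ᵇ lookup e j)) →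
        eval c (t ·ᵖ x) * eval (rows ss k i) (t ·ᵖ x) ≡ pw t (lookup e j) * (eval c x * eval (rows ss k i) x)
      c-hom (inj₁ z) = trans (cong (_* eval (rows ss k i) (t ·ᵖ x)) (isK0-sound (lookup (coef s) j) z (t ·ᵖ x)))
        (trans (solve 3 (λ r w q → :0 :* r := w :* (:0 :* q)) refl (eval (rows ss k i) (t ·ᵖ x)) (pw t (lookup e j)) (eval (rows ss k i) x))
          (cong (λ u → pw t (lookup e j) * (u * eval (rows ss k i) x)) (sym (isK0-sound (lookup (coef s) j) z x))))
      c-hom (inj₂ h) with ∧-elim {isHomogeneous (lookup (coef s) j)} h
      ... | hc , de = trans (cong₂ _*_ (homogeneous (lookup (coef s) j) hc t x) (hom k i t x))
        (trans (solve 4 (λ a b c d → (a :* b) :* (c :* d) := (a :* c) :* (b :* d)) refl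
            (pw t (degree (lookup (coef s) j))) (eval c x) (pw t (lookup e k)) (eval (rows ss k i) x))
          (cong (_* (eval c x * eval (rows ss k i) x)) (trans (sym (pw-+ t (degree (lookup (coef s) j)) (lookup e k)))
            (cong (pw t) (ℕP.≡ᵇ⇒≡ (degree (lookup (coef s) j) ℕ.+ lookup e k) (lookup e j) de)))))

  other-tangent : (∀ j i → Homogeneous (lookup (degrees (s ∷ ss)) j) (rows (s ∷ ss) j i)) →
    ∀ j → j ≢ k → VanishesOn (fm a) (rows (s ∷ ss) j)
  other-tangent hom j j≢k x ax = trans (sym (eval-applyDer (rows (s ∷ ss) j) (fm a) x))
    (vanish-chart (fm a) z (applyDer (rows (s ∷ ss) j) (fm a)) (lookup (degrees (s ∷ ss)) j)
      (λ t x → trans (eval-applyDer (rows (s ∷ ss) j) (fm a) (t ·ᵖ x))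
        (trans (dot-homogeneous (lookup (degrees (s ∷ ss)) j) (fm a) (rows (s ∷ ss) j) (hom j) t x)
          (cong (pw t (lookup (degrees (s ∷ ss)) j) *_) (sym (eval-applyDer (rows (s ∷ ss) j) (fm a) x)))))
      p p∈Ker (λ q → 1≢0 (trans (sym (C.point-free (ι s₀) (ι t₀) (fsuc (fsuc fzero)))) q))
      (λ y ay y₂ → trans (eval-applyDer (rows (s ∷ ss) j) (fm a) y)
        (trans (sym (values-sound {xs} {y} {y (C.free fzero)} {y (C.free (fsuc fzero))} (C.point-surjective unit y ay y₂) a (s ∷ ss) j))
          (zero-on-chart j j≢k (y (C.free fzero)) (y (C.free (fsuc fzero)))))) x ax)
    where
    z = C.free (fsuc (fsuc fzero))

standard-basis : Basis (VanishesOnAll []) (rows [])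
standard-basis = record
  { member      = λ j → []
  ; generates   = λ φ _ → φ , λ x i → sym (trans (sum-cong (λ j → comm (val φ x) j i)) (sum-δ i (val φ x)))
  ; independent = λ c e j x → trans (sym (trans (sum-cong (λ l → comm (λ l → eval (c l) x) l j)) (sum-δ j (λ l → eval (c l) x)))) (e x j) }
  where
  comm : ∀ {m} (f : Fin m → ℚ) j i → f j * δ j i ≡ δ i j * f j
  comm f j i = trans (ℚP.*-comm (f j) (δ j i)) (cong (_* f j) (δ-sym j i))

steps-basis : ∀ ss → T (steps-ok ss) →
  Basis (VanishesOnAll (normals ss)) (rows ss) × (∀ j i → Homogeneous (lookup (degrees ss) j) (rows ss j i))
steps-basis [] _ = standard-basis , λ j i t x → trans (sym (ℚP.*-identityˡ (δ j i))) (cong (λ d → pw t d * δ j i) (zeros j))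
  where
  zeros : ∀ j → 0 ≡ lookup (0 ∷ 0 ∷ 0 ∷ 0 ∷ []) j
  zeros fzero = refl
  zeros (fsuc fzero) = refl
  zeros (fsuc (fsuc fzero)) = refl
  zeros (fsuc (fsuc (fsuc fzero))) = refl
steps-basis (s ∷ ss) ok with ∧-elim {step-ok s ss} ok
... | ok-s , ok-ss with steps-basis ss ok-ss
...   | B , hom = Add.addition s (rows ss) h ah (normals ss) B scal≢0 (other-tangent hom′) p p∈Ker row≢0 , hom′
  where
  open StepOK s ss ok-s
  hom′ = next-homogeneous hom
  unit-pt = unit-point (fm (normal s)) (pivot s) (Chart.a_p≢0 (normal s) (pivot s) unit)
  h  = proj₁ unit-pt
  ah = proj₂ unit-pt

-- Expansion along rays through the origin

hd : List ℚ → ℚ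
hd []      = 0ℚ
hd (c ∷ _) = c

tl : List ℚ → List ℚ
tl []      = []
tl (_ ∷ u) = u

ev-hd-tl : ∀ u t → ev u t ≡ hd u + t * ev (tl u) t
ev-hd-tl []      t = solve 1 (λ t → :0 := :0 :+ t :* :0) refl t
ev-hd-tl (c ∷ u) t = refl

ev-hd : ∀ u → ev u 0ℚ ≡ hd u
ev-hd []      = refl
ev-hd (c ∷ u) = ev-0 c u

ev-tl : ∀ u → hd u ≡ 0ℚ → ∀ t → ev u t ≡ t * ev (tl u) t
ev-tl u h t = trans (ev-hd-tl u t) (trans (cong (_+ t * ev (tl u) t) h) (ℚP.+-identityˡ _))

sumU : ∀ {m} → (Fin m → List ℚ) → List ℚ
sumU {zero}  f = []
sumU {suc m} f = U.add (f fzero) (sumU (λ j → f (fsuc j)))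

ev-sumU : ∀ {m} (f : Fin m → List ℚ) t → ev (sumU f) t ≡ sumℚ (λ j → ev (f j) t)
ev-sumU {zero}  f t = refl
ev-sumU {suc m} f t = trans (U.horner-add (f fzero) (sumU (λ j → f (fsuc j))) (tt , t)) (cong (ev (f fzero) t +_) (ev-sumU (λ j → f (fsuc j)) t))

ev-mul : ∀ u w t → ev (U.mul u w) t ≡ ev u t * ev w t
ev-mul u w t = U.horner-mul u w (tt , t)

ev-add : ∀ u w t → ev (U.add u w) t ≡ ev u t + ev w t
ev-add u w t = U.horner-add u w (tt , t)

ev-const : ∀ c t → ev (c ∷ []) t ≡ c
ev-const c t = solve 2 (λ c t → c :+ t :* :0 := c) refl c t

monomial : ℕ → List ℚ
monomial zero    = 1ℚ ∷ []
monomial (suc e) = 0ℚ ∷ monomial e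

ev-monomial : ∀ e t → ev (monomial e) t ≡ pw t e
ev-monomial zero    t = ev-const 1ℚ t
ev-monomial (suc e) t = trans (ℚP.+-identityˡ _) (cong (t *_) (ev-monomial e t))

sum-δʳ : ∀ {m} (k : Fin m) (f : Fin m → ℚ) → sumℚ (λ j → f j * δ j k) ≡ f k
sum-δʳ k f = trans (sum-cong (λ j → trans (ℚP.*-comm (f j) (δ j k)) (cong (_* f j) (δ-sym j k)))) (sum-δ k f)

-- A matrix that is the identity at the origin can be cancelled without inverting it: at `t = 0` the
-- relation shows that the constant terms of `u` vanish, and the tails satisfy the same relation
-- after division by `t`. The bound `L` on the lengths drops by one.
cancel-matrix : ∀ {r} L (u : Fin r → List ℚ) (W : Fin r → Fin r → List ℚ) → (∀ j → length (u j) ℕ.≤ L) →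
  (∀ j i → ev (W j i) 0ℚ ≡ δ j i) → (∀ t i → sumℚ (λ j → ev (u j) t * ev (W j i) t) ≡ 0ℚ) →
  ∀ j t → ev (u j) t ≡ 0ℚ
cancel-matrix {r} zero u W len W₀ uW j t with u j | len j
... | [] | _ = refl
cancel-matrix {r} (suc L) u W len W₀ uW j t =
  trans (ev-tl (u j) (hd≡0 j) t) (trans (cong (t *_) (cancel-matrix L (λ j → tl (u j)) W len′ W₀ uW′ j t)) (ℚP.*-zeroʳ t))
  where
  hd≡0 : ∀ i → hd (u i) ≡ 0ℚ
  hd≡0 i = trans (sym (ev-hd (u i))) (trans (sym (sum-δʳ i (λ j → ev (u j) 0ℚ)))
    (trans (sum-cong (λ j → cong (ev (u j) 0ℚ *_) (sym (W₀ j i)))) (uW 0ℚ i)))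
  len′ : ∀ j → length (tl (u j)) ℕ.≤ L
  len′ j = go (u j) (len j)
    where
    go : ∀ v → length v ℕ.≤ suc L → length (tl v) ℕ.≤ L
    go []      _         = ℕ.z≤n
    go (c ∷ v) (ℕ.s≤s l) = l
  uW′ : ∀ t i → sumℚ (λ j → ev (tl (u j)) t * ev (W j i) t) ≡ 0ℚ
  uW′ t i = trans (sym (spec t)) (vanish-≢0 (sumU (λ j → U.mul (tl (u j)) (W j i))) (λ s s≢0 →
      *-zero-split s _ (trans (cong (s *_) (spec s)) (trans (sym (sum-*ˡ s (λ j → ev (tl (u j)) s * ev (W j i) s)))
        (trans (sum-cong (λ j → trans (sym (ℚP.*-assoc s (ev (tl (u j)) s) (ev (W j i) s)))
            (cong (_* ev (W j i) s) (sym (ev-tl (u j) (hd≡0 j) s))))) (uW s i)))) s≢0) t)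
    where
    spec : ∀ s → ev (sumU (λ j → U.mul (tl (u j)) (W j i))) s ≡ sumℚ (λ j → ev (tl (u j)) s * ev (W j i) s)
    spec s = trans (ev-sumU (λ j → U.mul (tl (u j)) (W j i)) s) (sum-cong (λ j → ev-mul (tl (u j)) (W j i) s))

maxLength : ∀ {r} → (Fin r → List ℚ) → ℕ
maxLength {zero}  u = 0
maxLength {suc r} u = length (u fzero) ℕ.⊔ maxLength (λ j → u (fsuc j))

≤-maxLength : ∀ {r} (u : Fin r → List ℚ) j → length (u j) ℕ.≤ maxLength u
≤-maxLength u fzero    = ℕP.m≤m⊔n _ _
≤-maxLength u (fsuc j) = ℕP.≤-trans (≤-maxLength (λ j → u (fsuc j)) j) (ℕP.m≤n⊔m (length (u fzero)) _)

0ᵖ : ∀ {n} → Pt n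
0ᵖ _ = 0ℚ

ray : ∀ {n} → Poly n → Pt n → List ℚ
ray f x = line f 0ᵖ x

ev-ray : ∀ {n} (f : Poly n) x t → ev (ray f x) t ≡ eval f (t ·ᵖ x)
ev-ray f x t = trans (ev-line f 0ᵖ x t) (eval-cong f (λ i → ℚP.+-identityˡ (t * x i)))

eval-0· : ∀ {n} (f : Poly n) x → eval f (0ℚ ·ᵖ x) ≡ eval f 0ᵖ
eval-0· f x = eval-cong f (λ i → ℚP.*-zeroˡ (x i))

-- Let ψ be a basis of D ⊆ D′ and α D′ ⊆ D.  If expressing α φ by ψ, for φ in
-- D′, only takes coefficients vanishing at the origin, then D′ has no basis
-- unless D′ is tangent to ker α.  Indeed with transition matrices M, N
-- between ψ and a basis of D′ we have M N = α and N M = α; the first gives a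
-- constant matrix R with M(0) R = 1, so that M R is invertible near 0, and
-- then N M R = 0 on ker α gives N = 0 there.

module NotFree {n r} (D D′ : Der n → Set) (a : Form n) (h : Pt n) (ah≡1 : dot a h ≡ 1ℚ)
  (ψ : Fin r → Der n) (Bψ : Basis D ψ)
  (D⊆D′ : ∀ j → D′ (ψ j))
  (αD′⊆D : ∀ φ → D′ φ → D (λ i → lin a ⊗ φ i))
  (key : ∀ φ c → (∀ x i → dot a x * val φ x i ≡ Combination c ψ x i) → ∀ j → eval (c j) 0ᵖ ≡ 0ℚ)
  (tangent : ∀ j → VanishesOn a (ψ j))
  (χ : Der n) (χ∈D′ : D′ χ) (q : Pt n) (q∈ker : Ker a q) (χ≢0 : dot a (val χ q) ≢ 0ℚ) where

  module _ {m} (φ : Fin m → Der n) (Bφ : Basis D′ φ) where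
    private
      module ψ = Basis Bψ
      module φ = Basis Bφ

      αφ : ∀ l → Σ (Fin r → Poly n) λ c → ∀ x i → dot a x * val (φ l) x i ≡ Combination c ψ x i
      αφ l = let c , e = ψ.generates (λ i → lin a ⊗ φ l i) (αD′⊆D (φ l) (φ.member l)) in
        c , λ x i → trans (cong (_* val (φ l) x i) (sym (eval-lin a x))) (e x i)

      N : Fin m → Fin r → Poly n
      N l = proj₁ (αφ l)

      N₀ : ∀ l j → eval (N l j) 0ᵖ ≡ 0ℚ
      N₀ l = key (φ l) (N l) (proj₂ (αφ l))

      M : Fin r → Fin m → Poly n
      M j = proj₁ (φ.generates (ψ j) (D⊆D′ j))

      ψ≡Mφ : ∀ j x i → val (ψ j) x i ≡ Combination (M j) φ x i
      ψ≡Mφ j = proj₂ (φ.generates (ψ j) (D⊆D′ j))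

      exchange : ∀ {k l} (A : Fin k → ℚ) (B : Fin k → Fin l → ℚ) (v : Fin l → ℚ) →
        sumℚ (λ j → A j * sumℚ (λ s → B j s * v s)) ≡ sumℚ (λ s → sumℚ (λ j → A j * B j s) * v s)
      exchange A B v = trans (sum-cong (λ j → trans (sym (sum-*ˡ (A j) (λ s → B j s * v s)))
          (sum-cong (λ s → sym (ℚP.*-assoc (A j) (B j s) (v s))))))
        (trans (sum-swap (λ j s → A j * B j s * v s)) (sum-cong (λ s → sum-*ʳ (v s) (λ j → A j * B j s))))

      -- In `a φ = N ψ = N M φ` the coefficients with respect to `φ` are compared, using the
      -- independence of `φ`. The companion `MN` compares those of `a ψ = M N ψ` with respect to
      -- `ψ`.
      NM : ∀ l s x → sumℚ (λ j → eval (N l j) x * eval (M j s) x) ≡ dot a x * δ l s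
      NM l s x = p-q≡0⇒p≡q _ _ (trans (sym (spec s x)) (φ.independent F F≡0 s x))
        where
        F : Fin m → Poly n
        F s = polySum (λ j → N l j ⊗ M j s) ⊕ (⊝ (lin a ⊗ con (δ l s)))
        spec : ∀ s x → eval (F s) x ≡ sumℚ (λ j → eval (N l j) x * eval (M j s) x) - dot a x * δ l s
        spec s x = cong₂ (λ u w → u - w * δ l s) (eval-sum (λ j → N l j ⊗ M j s) x) (eval-lin a x)
        F≡0 : ∀ x i → Combination F φ x i ≡ 0ℚ
        F≡0 x i = begin
          sumℚ (λ s → eval (F s) x * eval (φ s i) x)
            ≡⟨ sum-cong (λ s → trans (cong (_* eval (φ s i) x) (spec s x))
                 (solve 4 (λ u a d f → (u :- a :* d) :* f := u :* f :+ (:- a) :* (d :* f)) refl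
                   (sumℚ (λ j → eval (N l j) x * eval (M j s) x)) (dot a x) (δ l s) (eval (φ s i) x))) ⟩
          sumℚ (λ s → sumℚ (λ j → eval (N l j) x * eval (M j s) x) * eval (φ s i) x + - dot a x * (δ l s * eval (φ s i) x))
            ≡⟨ sum-+ (λ s → sumℚ (λ j → eval (N l j) x * eval (M j s) x) * eval (φ s i) x) (λ s → - dot a x * (δ l s * eval (φ s i) x)) ⟩
          sumℚ (λ s → sumℚ (λ j → eval (N l j) x * eval (M j s) x) * eval (φ s i) x) + sumℚ (λ s → - dot a x * (δ l s * eval (φ s i) x))
            ≡⟨ cong₂ _+_ (sym (exchange (λ j → eval (N l j) x) (λ j s → eval (M j s) x) (λ s → eval (φ s i) x)))
                 (trans (sum-*ˡ (- dot a x) (λ s → δ l s * eval (φ s i) x)) (cong (- dot a x *_) (sum-δ l (λ s → eval (φ s i) x)))) ⟩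
          sumℚ (λ j → eval (N l j) x * Combination (M j) φ x i) + - dot a x * eval (φ l i) x
            ≡⟨ cong (_+ - dot a x * eval (φ l i) x) (trans (sum-cong (λ j → cong (eval (N l j) x *_) (sym (ψ≡Mφ j x i)))) (sym (proj₂ (αφ l) x i))) ⟩
          dot a x * eval (φ l i) x + - dot a x * eval (φ l i) x
            ≡⟨ solve 2 (λ a f → a :* f :+ (:- a) :* f := :0) refl (dot a x) (eval (φ l i) x) ⟩
          0ℚ ∎
          where open ≡-Reasoning

      MN : ∀ j s x → sumℚ (λ l → eval (M j l) x * eval (N l s) x) ≡ dot a x * δ j s
      MN j s x = p-q≡0⇒p≡q _ _ (trans (sym (spec s x)) (ψ.independent F F≡0 s x))
        where
        F : Fin r → Poly n
        F s = polySum (λ l → M j l ⊗ N l s) ⊕ (⊝ (lin a ⊗ con (δ j s)))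
        spec : ∀ s x → eval (F s) x ≡ sumℚ (λ l → eval (M j l) x * eval (N l s) x) - dot a x * δ j s
        spec s x = cong₂ (λ u w → u - w * δ j s) (eval-sum (λ l → M j l ⊗ N l s) x) (eval-lin a x)
        F≡0 : ∀ x i → Combination F ψ x i ≡ 0ℚ
        F≡0 x i = begin
          sumℚ (λ s → eval (F s) x * eval (ψ s i) x)
            ≡⟨ sum-cong (λ s → trans (cong (_* eval (ψ s i) x) (spec s x))
                 (solve 4 (λ u a d f → (u :- a :* d) :* f := u :* f :+ (:- a) :* (d :* f)) refl
                   (sumℚ (λ l → eval (M j l) x * eval (N l s) x)) (dot a x) (δ j s) (eval (ψ s i) x))) ⟩
          sumℚ (λ s → sumℚ (λ l → eval (M j l) x * eval (N l s) x) * eval (ψ s i) x + - dot a x * (δ j s * eval (ψ s i) x))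
            ≡⟨ sum-+ (λ s → sumℚ (λ l → eval (M j l) x * eval (N l s) x) * eval (ψ s i) x) (λ s → - dot a x * (δ j s * eval (ψ s i) x)) ⟩
          sumℚ (λ s → sumℚ (λ l → eval (M j l) x * eval (N l s) x) * eval (ψ s i) x) + sumℚ (λ s → - dot a x * (δ j s * eval (ψ s i) x))
            ≡⟨ cong₂ _+_ (sym (exchange (λ l → eval (M j l) x) (λ l s → eval (N l s) x) (λ s → eval (ψ s i) x)))
                 (trans (sum-*ˡ (- dot a x) (λ s → δ j s * eval (ψ s i) x)) (cong (- dot a x *_) (sum-δ j (λ s → eval (ψ s i) x)))) ⟩
          sumℚ (λ l → eval (M j l) x * Combination (N l) ψ x i) + - dot a x * eval (ψ j i) x
            ≡⟨ cong (_+ - dot a x * eval (ψ j i) x) (trans (sum-cong (λ l → trans (cong (eval (M j l) x *_) (sym (proj₂ (αφ l) x i)))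
                   (solve 3 (λ m a f → m :* (a :* f) := a :* (m :* f)) refl (eval (M j l) x) (dot a x) (eval (φ l i) x))))
                 (trans (sum-*ˡ (dot a x) (λ l → eval (M j l) x * eval (φ l i) x)) (cong (dot a x *_) (sym (ψ≡Mφ j x i))))) ⟩
          dot a x * eval (ψ j i) x + - dot a x * eval (ψ j i) x
            ≡⟨ solve 2 (λ a f → a :* f :+ (:- a) :* f := :0) refl (dot a x) (eval (ψ j i) x) ⟩
          0ℚ ∎
          where open ≡-Reasoning

      -- the linear part of N in direction h
      R : Fin m → Fin r → ℚ
      R l s = ev (tl (ray (N l s) h)) 0ℚ

      -- The derivative of `M N = a` at the origin in direction `h`: since `N` vanishes there, only
      -- `M` at the origin times the linear part `R` of `N` survives, while the form has derivative
      -- 1. Formally, `t` is cancelled from the identity on the ray through `h`.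
      M₀R : ∀ j s → sumℚ (λ l → eval (M j l) 0ᵖ * R l s) ≡ δ j s
      M₀R j s = p-q≡0⇒p≡q _ _ (begin
          sumℚ (λ l → eval (M j l) 0ᵖ * R l s) - δ j s
            ≡⟨ cong (_- δ j s) (sum-cong (λ l → cong (_* R l s) (sym (trans (ev-ray (M j l) h 0ℚ) (eval-0· (M j l) h))))) ⟩
          sumℚ (λ l → ev (ray (M j l) h) 0ℚ * R l s) - δ j s
            ≡⟨ sym (spec 0ℚ) ⟩
          ev u 0ℚ
            ≡⟨ vanish-≢0 u u≡0 0ℚ ⟩
          0ℚ ∎)
        where
        open ≡-Reasoning
        prods : Fin m → List ℚ
        prods l = U.mul (ray (M j l) h) (tl (ray (N l s) h))
        u : List ℚ
        u = U.add (sumU prods) ((- δ j s) ∷ [])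
        spec : ∀ t → ev u t ≡ sumℚ (λ l → ev (ray (M j l) h) t * ev (tl (ray (N l s) h)) t) - δ j s
        spec t = trans (ev-add (sumU prods) ((- δ j s) ∷ []) t)
          (cong₂ _+_ (trans (ev-sumU prods t) (sum-cong (λ l → ev-mul (ray (M j l) h) (tl (ray (N l s) h)) t))) (ev-const (- δ j s) t))
        hd≡0 : ∀ l → hd (ray (N l s) h) ≡ 0ℚ
        hd≡0 l = trans (sym (ev-hd (ray (N l s) h))) (trans (ev-ray (N l s) h 0ℚ) (trans (eval-0· (N l s) h) (N₀ l s)))
        u≡0 : ∀ t → t ≢ 0ℚ → ev u t ≡ 0ℚ
        u≡0 t t≢0 = *-zero-split t (ev u t) (begin
          t * ev u t
            ≡⟨ cong (t *_) (spec t) ⟩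
          t * (sumℚ (λ l → ev (ray (M j l) h) t * ev (tl (ray (N l s) h)) t) - δ j s)
            ≡⟨ solve 3 (λ t u d → t :* (u :- d) := t :* u :- t :* d) refl t (sumℚ (λ l → ev (ray (M j l) h) t * ev (tl (ray (N l s) h)) t)) (δ j s) ⟩
          t * sumℚ (λ l → ev (ray (M j l) h) t * ev (tl (ray (N l s) h)) t) - t * δ j s
            ≡⟨ cong (_- t * δ j s) (trans (sym (sum-*ˡ t (λ l → ev (ray (M j l) h) t * ev (tl (ray (N l s) h)) t)))
                 (sum-cong (λ l → trans (solve 3 (λ t m k → t :* (m :* k) := m :* (t :* k)) refl t (ev (ray (M j l) h) t) (ev (tl (ray (N l s) h)) t))
                   (cong₂ _*_ (ev-ray (M j l) h t) (trans (sym (ev-tl (ray (N l s) h) (hd≡0 l) t)) (ev-ray (N l s) h t)))))) ⟩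
          sumℚ (λ l → eval (M j l) (t ·ᵖ h) * eval (N l s) (t ·ᵖ h)) - t * δ j s
            ≡⟨ cong (_- t * δ j s) (trans (MN j s (t ·ᵖ h)) (cong (_* δ j s) (trans (dot-· a t h) (trans (cong (t *_) ah≡1) (ℚP.*-identityʳ t))))) ⟩
          t * δ j s - t * δ j s
            ≡⟨ ℚP.+-inverseʳ _ ⟩
          0ℚ ∎) t≢0

      Kᴹ : Fin r → Fin r → Poly n
      Kᴹ j s = polySum (λ l → M j l ⊗ con (R l s))

      eval-K : ∀ j s x → eval (Kᴹ j s) x ≡ sumℚ (λ l → eval (M j l) x * R l s)
      eval-K j s x = eval-sum (λ l → M j l ⊗ con (R l s)) x

      -- On the ray through a point of the hyperplane, `N (M R) = (N M) R = a R = 0`, and `M R` is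
      -- the identity at the origin, so `cancel-matrix` applies. The square matrix `M R` makes this
      -- work even if the two bases had different lengths.
      N≡0 : ∀ l j x → Ker a x → eval (N l j) x ≡ 0ℚ
      N≡0 l j x ax = trans (trans (eval-cong (N l j) (λ i → sym (ℚP.*-identityˡ (x i)))) (sym (ev-ray (N l j) x 1ℚ)))
        (cancel-matrix (maxLength u) u (λ j s → ray (Kᴹ j s) x) (≤-maxLength u)
          (λ j s → trans (ev-ray (Kᴹ j s) x 0ℚ) (trans (eval-0· (Kᴹ j s) x) (trans (eval-K j s 0ᵖ) (M₀R j s)))) product j 1ℚ)
        where
        open ≡-Reasoning
        u : Fin r → List ℚ
        u j = ray (N l j) x
        product : ∀ t s → sumℚ (λ j → ev (u j) t * ev (ray (Kᴹ j s) x) t) ≡ 0ℚ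
        product t s = begin
          sumℚ (λ j → ev (u j) t * ev (ray (Kᴹ j s) x) t)
            ≡⟨ sum-cong (λ j → cong₂ _*_ (ev-ray (N l j) x t) (trans (ev-ray (Kᴹ j s) x t) (eval-K j s y))) ⟩
          sumℚ (λ j → eval (N l j) y * sumℚ (λ k → eval (M j k) y * R k s))
            ≡⟨ exchange (λ j → eval (N l j) y) (λ j k → eval (M j k) y) (λ k → R k s) ⟩
          sumℚ (λ k → sumℚ (λ j → eval (N l j) y * eval (M j k) y) * R k s)
            ≡⟨ sum-0 (λ k → trans (cong (_* R k s) (trans (NM l k y) (trans (cong (_* δ l k) ay) (ℚP.*-zeroˡ _)))) (ℚP.*-zeroˡ _)) ⟩
          0ℚ ∎
          where
          y = t ·ᵖ x
          ay : dot a y ≡ 0ℚ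
          ay = trans (dot-· a t x) (trans (cong (t *_) ax) (ℚP.*-zeroʳ t))

      N′ : Fin m → Fin r → Poly n
      N′ l j = cofactor a h ah≡1 (N l j)

      φ≡N′ψ : ∀ l x i → val (φ l) x i ≡ Combination (N′ l) ψ x i
      φ≡N′ψ l x i = p-q≡0⇒p≡q _ _ (trans (sym (spec x)) (cancel-form a h ah≡1 F (λ y → begin
          eval F y * dot a y
            ≡⟨ trans (cong (_* dot a y) (spec y)) (solve 3 (λ f c a → (f :- c) :* a := a :* f :- a :* c) refl (val (φ l) y i) (Combination (N′ l) ψ y i) (dot a y)) ⟩
          dot a y * val (φ l) y i - dot a y * Combination (N′ l) ψ y i
            ≡⟨ p≡q⇒p-q≡0 (trans (proj₂ (αφ l) y i) (trans (sum-cong (λ j → trans (cong (_* eval (ψ j i) y) (divide a h ah≡1 (N l j) (N≡0 l j) y))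
                 (ℚP.*-assoc (dot a y) (eval (N′ l j) y) (eval (ψ j i) y)))) (sum-*ˡ (dot a y) (λ j → eval (N′ l j) y * eval (ψ j i) y)))) ⟩
          0ℚ ∎) x))
        where
        open ≡-Reasoning
        F : Poly n
        F = φ l i ⊕ (⊝ polySum (λ j → N′ l j ⊗ ψ j i))
        spec : ∀ y → eval F y ≡ val (φ l) y i - Combination (N′ l) ψ y i
        spec y = cong (λ z → eval (φ l i) y - z) (eval-sum (λ j → N′ l j ⊗ ψ j i) y)

      dot-combination : ∀ {k} (c : Fin k → Poly n) (θ : Fin k → Der n) x → (∀ j → dot a (val (θ j) x) ≡ 0ℚ) → dot a (Combination c θ x) ≡ 0ℚ
      dot-combination c θ x t = trans (dot-sum a (λ j i → eval (c j) x * eval (θ j i) x))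
        (sum-0 (λ j → trans (dot-· a (eval (c j) x) (val (θ j) x)) (trans (cong (eval (c j) x *_) (t j)) (ℚP.*-zeroʳ _))))

    -- Dividing `N` by the form expresses all `φ` by `ψ` itself. So every member of `D′` would be
    -- tangent to the hyperplane, which `χ` is not.
    not-free : ⊥
    not-free = let c , e = φ.generates χ χ∈D′ in
      χ≢0 (trans (dot-cong a (e q)) (dot-combination c φ q (λ l →
        trans (dot-cong a (φ≡N′ψ l q)) (dot-combination (N′ l) ψ q (λ j → tangent j q q∈ker)))))

-- Determinants of three vectors

cross : Fin 3 → Pt 3 → Pt 3 → ℚ
cross 0F u v = u 1F * v 2F - u 2F * v 1F
cross 1F u v = u 2F * v 0F - u 0F * v 2F
cross 2F u v = u 0F * v 1F - u 1F * v 0F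

det : Pt 3 → Pt 3 → Pt 3 → ℚ
det u v w = u 0F * cross 0F v w + (u 1F * cross 1F v w + u 2F * cross 2F v w)

crossᴾ : Fin 3 → Der 3 → Der 3 → Poly 3
crossᴾ 0F u v = (u 1F ⊗ v 2F) ⊕ (⊝ (u 2F ⊗ v 1F))
crossᴾ 1F u v = (u 2F ⊗ v 0F) ⊕ (⊝ (u 0F ⊗ v 2F))
crossᴾ 2F u v = (u 0F ⊗ v 1F) ⊕ (⊝ (u 1F ⊗ v 0F))

detᴾ : Der 3 → Der 3 → Der 3 → Poly 3
detᴾ u v w = (u 0F ⊗ crossᴾ 0F v w) ⊕ ((u 1F ⊗ crossᴾ 1F v w) ⊕ (u 2F ⊗ crossᴾ 2F v w))

-- The adjugate identity. If all three vectors lie in the kernel of `a`, it makes every `a i` times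
-- the determinant zero, which is how `det-tangent` uses it.
det-form : ∀ i (a : Form 3) u v w →
  a i * det u v w ≡ dot a u * cross i v w + (dot a v * cross i w u + dot a w * cross i u v)
det-form 0F a u v w = solve 12 (λ a b c u0 u1 u2 v0 v1 v2 w0 w1 w2 →
    a :* (u0 :* (v1 :* w2 :- v2 :* w1) :+ (u1 :* (v2 :* w0 :- v0 :* w2) :+ u2 :* (v0 :* w1 :- v1 :* w0))) :=
    (a :* u0 :+ (b :* u1 :+ (c :* u2 :+ :0))) :* (v1 :* w2 :- v2 :* w1) :+
    ((a :* v0 :+ (b :* v1 :+ (c :* v2 :+ :0))) :* (w1 :* u2 :- w2 :* u1) :+
     (a :* w0 :+ (b :* w1 :+ (c :* w2 :+ :0))) :* (u1 :* v2 :- u2 :* v1))) refl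
  (a 0F) (a 1F) (a 2F) (u 0F) (u 1F) (u 2F) (v 0F) (v 1F) (v 2F) (w 0F) (w 1F) (w 2F)
det-form 1F a u v w = solve 12 (λ a b c u0 u1 u2 v0 v1 v2 w0 w1 w2 →
    b :* (u0 :* (v1 :* w2 :- v2 :* w1) :+ (u1 :* (v2 :* w0 :- v0 :* w2) :+ u2 :* (v0 :* w1 :- v1 :* w0))) :=
    (a :* u0 :+ (b :* u1 :+ (c :* u2 :+ :0))) :* (v2 :* w0 :- v0 :* w2) :+
    ((a :* v0 :+ (b :* v1 :+ (c :* v2 :+ :0))) :* (w2 :* u0 :- w0 :* u2) :+
     (a :* w0 :+ (b :* w1 :+ (c :* w2 :+ :0))) :* (u2 :* v0 :- u0 :* v2))) refl
  (a 0F) (a 1F) (a 2F) (u 0F) (u 1F) (u 2F) (v 0F) (v 1F) (v 2F) (w 0F) (w 1F) (w 2F)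
det-form 2F a u v w = solve 12 (λ a b c u0 u1 u2 v0 v1 v2 w0 w1 w2 →
    c :* (u0 :* (v1 :* w2 :- v2 :* w1) :+ (u1 :* (v2 :* w0 :- v0 :* w2) :+ u2 :* (v0 :* w1 :- v1 :* w0))) :=
    (a :* u0 :+ (b :* u1 :+ (c :* u2 :+ :0))) :* (v0 :* w1 :- v1 :* w0) :+
    ((a :* v0 :+ (b :* v1 :+ (c :* v2 :+ :0))) :* (w0 :* u1 :- w1 :* u0) :+
     (a :* w0 :+ (b :* w1 :+ (c :* w2 :+ :0))) :* (u0 :* v1 :- u1 :* v0))) refl
  (a 0F) (a 1F) (a 2F) (u 0F) (u 1F) (u 2F) (v 0F) (v 1F) (v 2F) (w 0F) (w 1F) (w 2F)

det-tangent : ∀ (a : Form 3) h → dot a h ≡ 1ℚ → ∀ u v w → Ker a u → Ker a v → Ker a w → det u v w ≡ 0ℚ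
det-tangent a h ah u v w au av aw = begin
  det u v w                               ≡⟨ sym (ℚP.*-identityʳ _) ⟩
  det u v w * 1ℚ                          ≡⟨ cong (det u v w *_) (sym ah) ⟩
  det u v w * dot a h                     ≡⟨ sym (sum-*ˡ (det u v w) (λ i → a i * h i)) ⟩
  sumℚ (λ i → det u v w * (a i * h i))    ≡⟨ sum-0 (λ i → trans
       (solve 3 (λ d a h → d :* (a :* h) := (a :* d) :* h) refl (det u v w) (a i) (h i))
       (trans (cong (_* h i) (trans (det-form i a u v w)
         (trans (cong₂ _+_ (cong (_* cross i v w) au) (cong₂ _+_ (cong (_* cross i w u) av) (cong (_* cross i u v) aw)))
           (solve 3 (λ x y z → :0 :* x :+ (:0 :* y :+ :0 :* z) := :0) refl (cross i v w) (cross i w u) (cross i u v)))))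
         (ℚP.*-zeroˡ _))) ⟩
  0ℚ ∎
  where open ≡-Reasoning

cramer : ∀ i u v w y → det u v w * y i ≡ det y v w * u i + (det u y w * v i + det u v y * w i)
cramer 0F u v w y = solve 12 (λ y0 y1 y2 u0 u1 u2 v0 v1 v2 w0 w1 w2 →
    (u0 :* (v1 :* w2 :- v2 :* w1) :+ (u1 :* (v2 :* w0 :- v0 :* w2) :+ u2 :* (v0 :* w1 :- v1 :* w0))) :* y0 :=
    (y0 :* (v1 :* w2 :- v2 :* w1) :+ (y1 :* (v2 :* w0 :- v0 :* w2) :+ y2 :* (v0 :* w1 :- v1 :* w0))) :* u0 :+
    ((u0 :* (y1 :* w2 :- y2 :* w1) :+ (u1 :* (y2 :* w0 :- y0 :* w2) :+ u2 :* (y0 :* w1 :- y1 :* w0))) :* v0 :+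
     (u0 :* (v1 :* y2 :- v2 :* y1) :+ (u1 :* (v2 :* y0 :- v0 :* y2) :+ u2 :* (v0 :* y1 :- v1 :* y0))) :* w0)) refl
  (y 0F) (y 1F) (y 2F) (u 0F) (u 1F) (u 2F) (v 0F) (v 1F) (v 2F) (w 0F) (w 1F) (w 2F)
cramer 1F u v w y = solve 12 (λ y0 y1 y2 u0 u1 u2 v0 v1 v2 w0 w1 w2 →
    (u0 :* (v1 :* w2 :- v2 :* w1) :+ (u1 :* (v2 :* w0 :- v0 :* w2) :+ u2 :* (v0 :* w1 :- v1 :* w0))) :* y1 :=
    (y0 :* (v1 :* w2 :- v2 :* w1) :+ (y1 :* (v2 :* w0 :- v0 :* w2) :+ y2 :* (v0 :* w1 :- v1 :* w0))) :* u1 :+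
    ((u0 :* (y1 :* w2 :- y2 :* w1) :+ (u1 :* (y2 :* w0 :- y0 :* w2) :+ u2 :* (y0 :* w1 :- y1 :* w0))) :* v1 :+
     (u0 :* (v1 :* y2 :- v2 :* y1) :+ (u1 :* (v2 :* y0 :- v0 :* y2) :+ u2 :* (v0 :* y1 :- v1 :* y0))) :* w1)) refl
  (y 0F) (y 1F) (y 2F) (u 0F) (u 1F) (u 2F) (v 0F) (v 1F) (v 2F) (w 0F) (w 1F) (w 2F)
cramer 2F u v w y = solve 12 (λ y0 y1 y2 u0 u1 u2 v0 v1 v2 w0 w1 w2 →
    (u0 :* (v1 :* w2 :- v2 :* w1) :+ (u1 :* (v2 :* w0 :- v0 :* w2) :+ u2 :* (v0 :* w1 :- v1 :* w0))) :* y2 :=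
    (y0 :* (v1 :* w2 :- v2 :* w1) :+ (y1 :* (v2 :* w0 :- v0 :* w2) :+ y2 :* (v0 :* w1 :- v1 :* w0))) :* u2 :+
    ((u0 :* (y1 :* w2 :- y2 :* w1) :+ (u1 :* (y2 :* w0 :- y0 :* w2) :+ u2 :* (y0 :* w1 :- y1 :* w0))) :* v2 :+
     (u0 :* (v1 :* y2 :- v2 :* y1) :+ (u1 :* (v2 :* y0 :- v0 :* y2) :+ u2 :* (v0 :* y1 :- v1 :* y0))) :* w2)) refl
  (y 0F) (y 1F) (y 2F) (u 0F) (u 1F) (u 2F) (v 0F) (v 1F) (v 2F) (w 0F) (w 1F) (w 2F)

det-expand₁ : ∀ a b c u v w → det (λ i → a * u i + (b * v i + c * w i)) v w ≡ a * det u v w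
det-expand₁ a b c u v w = solve 12 (λ a b c u0 u1 u2 v0 v1 v2 w0 w1 w2 →
    (a :* u0 :+ (b :* v0 :+ c :* w0)) :* (v1 :* w2 :- v2 :* w1) :+ ((a :* u1 :+ (b :* v1 :+ c :* w1)) :* (v2 :* w0 :- v0 :* w2) :+ (a :* u2 :+ (b :* v2 :+ c :* w2)) :* (v0 :* w1 :- v1 :* w0)) :=
    a :* (u0 :* (v1 :* w2 :- v2 :* w1) :+ (u1 :* (v2 :* w0 :- v0 :* w2) :+ u2 :* (v0 :* w1 :- v1 :* w0)))) refl
  a b c (u 0F) (u 1F) (u 2F) (v 0F) (v 1F) (v 2F) (w 0F) (w 1F) (w 2F)

det-cycle : ∀ u v w → det u v w ≡ det v w u
det-cycle u v w = solve 9 (λ u0 u1 u2 v0 v1 v2 w0 w1 w2 →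
    u0 :* (v1 :* w2 :- v2 :* w1) :+ (u1 :* (v2 :* w0 :- v0 :* w2) :+ u2 :* (v0 :* w1 :- v1 :* w0)) :=
    v0 :* (w1 :* u2 :- w2 :* u1) :+ (v1 :* (w2 :* u0 :- w0 :* u2) :+ v2 :* (w0 :* u1 :- w1 :* u0))) refl
  (u 0F) (u 1F) (u 2F) (v 0F) (v 1F) (v 2F) (w 0F) (w 1F) (w 2F)

-- The cross product with `u` removes the multiple of `u`, here the Euler part of a relation, and
-- keeps a relation between the other two vectors.
cross-ray : ∀ i a b c s u v w → (∀ j → a * (s * u j) + (b * v j + c * w j) ≡ 0ℚ) → b * cross i u v + c * cross i u w ≡ 0ℚ
cross-ray i a b c s u v w e = trans (identity i) (zero′ i)
  where
  y : Pt 3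
  y j = a * (s * u j) + (b * v j + c * w j)
  identity : ∀ i → b * cross i u v + c * cross i u w ≡ cross i u y
  identity 0F = solve 10 (λ a b c s u1 u2 v1 v2 w1 w2 → b :* (u1 :* v2 :- u2 :* v1) :+ c :* (u1 :* w2 :- u2 :* w1) :=
     u1 :* (a :* (s :* u2) :+ (b :* v2 :+ c :* w2)) :- u2 :* (a :* (s :* u1) :+ (b :* v1 :+ c :* w1))) refl a b c s (u 1F) (u 2F) (v 1F) (v 2F) (w 1F) (w 2F)
  identity 1F = solve 10 (λ a b c s u1 u2 v1 v2 w1 w2 → b :* (u1 :* v2 :- u2 :* v1) :+ c :* (u1 :* w2 :- u2 :* w1) :=
     u1 :* (a :* (s :* u2) :+ (b :* v2 :+ c :* w2)) :- u2 :* (a :* (s :* u1) :+ (b :* v1 :+ c :* w1))) refl a b c s (u 2F) (u 0F) (v 2F) (v 0F) (w 2F) (w 0F)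
  identity 2F = solve 10 (λ a b c s u1 u2 v1 v2 w1 w2 → b :* (u1 :* v2 :- u2 :* v1) :+ c :* (u1 :* w2 :- u2 :* w1) :=
     u1 :* (a :* (s :* u2) :+ (b :* v2 :+ c :* w2)) :- u2 :* (a :* (s :* u1) :+ (b :* v1 :+ c :* w1))) refl a b c s (u 0F) (u 1F) (v 0F) (v 1F) (w 0F) (w 1F)
  zero″ : ∀ j k → u j * y k - u k * y j ≡ 0ℚ
  zero″ j k = trans (cong₂ (λ p q → u j * p - u k * q) (e k) (e j)) (solve 2 (λ p q → p :* :0 :- q :* :0 := :0) refl (u j) (u k))
  zero′ : ∀ i → cross i u y ≡ 0ℚ
  zero′ 0F = zero″ 1F 2F
  zero′ 1F = zero″ 2F 0F
  zero′ 2F = zero″ 0F 1F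

cross-· : ∀ i s t u v → cross i (s ·ᵖ u) (t ·ᵖ v) ≡ s * t * cross i u v
cross-· 0F s t u v = solve 6 (λ s t a b c d → (s :* a) :* (t :* d) :- (s :* b) :* (t :* c) := s :* t :* (a :* d :- b :* c)) refl s t (u 1F) (u 2F) (v 1F) (v 2F)
cross-· 1F s t u v = solve 6 (λ s t a b c d → (s :* a) :* (t :* d) :- (s :* b) :* (t :* c) := s :* t :* (a :* d :- b :* c)) refl s t (u 2F) (u 0F) (v 2F) (v 0F)
cross-· 2F s t u v = solve 6 (λ s t a b c d → (s :* a) :* (t :* d) :- (s :* b) :* (t :* c) := s :* t :* (a :* d :- b :* c)) refl s t (u 0F) (u 1F) (v 0F) (v 1F)

-- Sums of multiplicities and products of powers

sumℕ : ∀ {m} → (Fin m → ℕ) → ℕ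
sumℕ {zero}  f = 0
sumℕ {suc m} f = f fzero ℕ.+ sumℕ (λ j → f (fsuc j))

sumℕ-1 : ∀ m → sumℕ {m} (λ _ → 1) ≡ m
sumℕ-1 zero    = refl
sumℕ-1 (suc m) = cong suc (sumℕ-1 m)

sumℕ-mono : ∀ {m} {f g : Fin m → ℕ} → (∀ j → f j ℕ.≤ g j) → sumℕ f ℕ.≤ sumℕ g
sumℕ-mono {zero}  h = ℕ.z≤n
sumℕ-mono {suc m} h = ℕP.+-mono-≤ (h fzero) (sumℕ-mono (λ j → h (fsuc j)))

prod-homogeneous : ∀ {m} t (d : Fin m → ℚ) (e : Fin m → ℕ) →
  prodℚ (λ k → pw (t * d k) (e k)) ≡ pw t (sumℕ e) * prodℚ (λ k → pw (d k) (e k))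
prod-homogeneous {zero}  t d e = sym (ℚP.*-identityˡ 1ℚ)
prod-homogeneous {suc m} t d e = trans (cong₂ _*_ (pw-* t (d fzero) (e fzero)) (prod-homogeneous t (λ k → d (fsuc k)) (λ k → e (fsuc k))))
  (trans (solve 4 (λ a b c d → (a :* b) :* (c :* d) := (a :* c) :* (b :* d)) refl (pw t (e fzero)) (pw (d fzero) (e fzero)) (pw t (sumℕ (λ k → e (fsuc k)))) _)
    (cong (_* (pw (d fzero) (e fzero) * prodℚ (λ k → pw (d (fsuc k)) (e (fsuc k))))) (sym (pw-+ t (e fzero) (sumℕ (λ k → e (fsuc k)))))))

powers-homogeneous : ∀ {m n} (a : Fin m → Form n) e → Homogeneous (sumℕ e) (powers a e)
powers-homogeneous a e t x = trans (eval-powers a e (t ·ᵖ x))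
  (trans (prod-cong (λ k → cong (λ z → pw z (e k)) (dot-· (a k) t x)))
    (trans (prod-homogeneous t (λ k → dot (a k) x) e) (cong (pw t (sumℕ e) *_) (sym (eval-powers a e x)))))

powers-factor : ∀ {m n} (a : Fin m → Form n) e k → Σ (Poly n) λ g → ∀ x → eval (powers a e) x ≡ pw (dot (a k) x) (e k) * eval g x
powers-factor {suc m} a e fzero = powers (λ k → a (fsuc k)) (λ k → e (fsuc k)) , λ x →
  cong (_* eval (powers (λ k → a (fsuc k)) (λ k → e (fsuc k))) x)
    (trans (eval-^ (lin (a fzero)) (e fzero) x) (cong (λ z → pw z (e fzero)) (eval-lin (a fzero) x)))
powers-factor {suc m} a e (fsuc k) =
  let g , eq = powers-factor (λ k → a (fsuc k)) (λ k → e (fsuc k)) k in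
  (lin (a fzero) ^ e fzero) ⊗ g , λ x → trans (cong (eval (lin (a fzero) ^ e fzero) x *_) (eq x))
    (solve 3 (λ l w g → l :* (w :* g) := w :* (l :* g)) refl (eval (lin (a fzero) ^ e fzero) x) (pw (dot (a (fsuc k)) x) (e (fsuc k))) (eval g x))

powers≢0 : ∀ {m n} (a : Fin m → Form n) e x → (∀ k → e k ≢ 0 → dot (a k) x ≢ 0ℚ) → eval (powers a e) x ≢ 0ℚ
powers≢0 a e x h z = prod≢0 (λ k → nz k (e k) refl) (trans (sym (eval-powers a e x)) z)
  where
  nz : ∀ k n → n ≡ e k → pw (dot (a k) x) n ≢ 0ℚ
  nz k zero    _ = λ ()
  nz k (suc n) q = pw≢0 (suc n) (h k (λ e≡0 → contra (trans q e≡0)))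
    where
    contra : suc n ≡ 0 → ⊥
    contra ()

weaken : ∀ {n} (a : Form n) {k l} (θ : Der n) → k ℕ.≤ l → Tangent a l θ → Tangent a k θ
weaken a {k} {l} θ k≤l (g , e) = (lin a ^ (l ℕ.∸ k)) ⊗ g , λ x → begin
    dot a (val θ x)                                        ≡⟨ e x ⟩
    pw (dot a x) l * eval g x                              ≡⟨ cong (λ j → pw (dot a x) j * eval g x) (sym (ℕP.m+[n∸m]≡n k≤l)) ⟩
    pw (dot a x) (k ℕ.+ (l ℕ.∸ k)) * eval g x              ≡⟨ cong (_* eval g x) (pw-+ (dot a x) k (l ℕ.∸ k)) ⟩
    pw (dot a x) k * pw (dot a x) (l ℕ.∸ k) * eval g x     ≡⟨ ℚP.*-assoc _ _ _ ⟩
    pw (dot a x) k * (pw (dot a x) (l ℕ.∸ k) * eval g x)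
      ≡⟨ cong (λ z → pw (dot a x) k * (z * eval g x)) (sym (trans (eval-^ (lin a) (l ℕ.∸ k) x) (cong (λ z → pw z (l ℕ.∸ k)) (eval-lin a x)))) ⟩
    pw (dot a x) k * eval ((lin a ^ (l ℕ.∸ k)) ⊗ g) x ∎
  where open ≡-Reasoning

tangent⇒vanishes : ∀ {n} (a : Form n) {k} (θ : Der n) → 1 ℕ.≤ k → Tangent a k θ → VanishesOn a θ
tangent⇒vanishes a θ 1≤k t x ax = let g , e = weaken a θ 1≤k t in
  trans (e x) (trans (cong (λ z → z * 1ℚ * eval g x) ax) (solve 1 (λ g → :0 :* :1 :* g := :0) refl (eval g x)))

det-cong : ∀ {u u′ v v′ w w′ : Pt 3} → (∀ i → u i ≡ u′ i) → (∀ i → v i ≡ v′ i) → (∀ i → w i ≡ w′ i) → det u v w ≡ det u′ v′ w′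
det-cong eu ev ew = cong₂ _+_ (cong₂ _*_ (eu 0F) (cr 1F 2F)) (cong₂ _+_ (cong₂ _*_ (eu 1F) (cr 2F 0F)) (cong₂ _*_ (eu 2F) (cr 0F 1F)))
  where
  cr : ∀ i j → _ * _ - _ * _ ≡ _ * _ - _ * _
  cr i j = cong₂ _-_ (cong₂ _*_ (ev i) (ew j)) (cong₂ _*_ (ev j) (ew i))

det-· : ∀ r s t u v w → det (r ·ᵖ u) (s ·ᵖ v) (t ·ᵖ w) ≡ r * (s * t) * det u v w
det-· r s t u v w = trans (cong₂ (λ x y → r * u 0F * x + y) (cross-· 0F s t v w)
    (cong₂ (λ x y → r * u 1F * x + r * u 2F * y) (cross-· 1F s t v w) (cross-· 2F s t v w)))
  (solve 9 (λ r s t a b c x y z → (r :* a) :* (s :* t :* x) :+ ((r :* b) :* (s :* t :* y) :+ (r :* c) :* (s :* t :* z))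
      := r :* (s :* t) :* (a :* x :+ (b :* y :+ c :* z))) refl r s t (u 0F) (u 1F) (u 2F) (cross 0F v w) (cross 1F v w) (cross 2F v w))

-- Rank three: multiplicities between 1 and κ, and their deletions

euler : Der 3
euler i = var i

-- A multiarrangement of m lines in the projective plane with multiplicity κ,
-- such that the simple arrangement has the basis  θ_E, θ₂, θ₃  with θ₂, θ₃ of
-- degree D contained even in D(κ).  By ω≢0 no constant combination of θ₂, θ₃
-- is on a line a multiple of θ_E, unless it is zero.
record Setting (m : ℕ) : Set where
  field
    b       : Fin m → Form 3
    h       : Fin m → Pt 3
    bh      : ∀ k → dot (b k) (h k) ≡ 1ℚ
    κ       : Fin m → ℕ
    1≤κ     : ∀ k → 1 ℕ.≤ κ k
    D       : ℕ
    -- The degree condition of Saito's criterion: the determinant of θ_E, θ₂, θ₃ has as many linear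
    -- factors as there are lines.
    size    : suc (D ℕ.+ D) ≡ m
    -- The left side is the degree of the product of the `b k` to the powers `κ k - 1`, times θ_E.
    excess  : suc (sumℕ (λ k → κ k ℕ.∸ 1)) ℕ.≤ D
    θ₂ θ₃   : Der 3
    hom₂    : ∀ i → Homogeneous D (θ₂ i)
    hom₃    : ∀ i → Homogeneous D (θ₃ i)
    tan₂    : ∀ k → Tangent (b k) (κ k) θ₂
    tan₃    : ∀ k → Tangent (b k) (κ k) θ₃
    p       : Fin m → Pt 3
    p∈      : ∀ k → Ker (b k) (p k)
    generic : ∀ k l → l ≢ k → dot (b l) (p k) ≢ 0ℚ
    z       : Fin m → Fin 3
    pz≢0    : ∀ k → p k (z k) ≢ 0ℚ
    q       : Fin m → Pt 3
    q∈      : ∀ k → Ker (b k) (q k)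
    c       : Fin m → Fin 3
    ω≢0     : ∀ k → cross (c k) (p k) (val θ₂ (p k)) * cross (c k) (q k) (val θ₃ (q k))
                  - cross (c k) (p k) (val θ₃ (p k)) * cross (c k) (q k) (val θ₂ (q k)) ≢ 0ℚ
    p₀      : Pt 3
    Δp₀≢0   : det p₀ (val θ₂ p₀) (val θ₃ p₀) ≢ 0ℚ

module Rank3 {m : ℕ} (R : Setting m) where
  open Setting R

  van₂ : ∀ k → VanishesOn (b k) θ₂
  van₂ k = tangent⇒vanishes (b k) θ₂ (1≤κ k) (tan₂ k)

  van₃ : ∀ k → VanishesOn (b k) θ₃
  van₃ k = tangent⇒vanishes (b k) θ₃ (1≤κ k) (tan₃ k)

  Q Δ : Poly 3
  Q = powers b (λ _ → 1)
  Δ = detᴾ euler θ₂ θ₃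

  Q-divides : ∀ f → (∀ k x → Ker (b k) x → eval f x ≡ 0ℚ) → Σ (Poly 3) λ g → ∀ x → eval f x ≡ eval Q x * eval g x
  Q-divides f van = divide-powers b h bh p p∈ generic (λ _ → 1) f (λ k → cofactor (b k) (h k) (bh k) f , λ x →
    trans (divide (b k) (h k) (bh k) f (van k) x) (cong (_* eval (cofactor (b k) (h k) (bh k) f) x) (sym (ℚP.*-identityʳ _))))

  Q-divides-det : ∀ u v w → (∀ k → VanishesOn (b k) u) → (∀ k → VanishesOn (b k) v) → (∀ k → VanishesOn (b k) w) →
    Σ (Poly 3) λ g → ∀ x → eval (detᴾ u v w) x ≡ eval Q x * eval g x
  Q-divides-det u v w hu hv hw = Q-divides (detᴾ u v w) (λ k x bx →
    det-tangent (b k) (h k) (bh k) (val u x) (val v x) (val w x) (hu k x bx) (hv k x bx) (hw k x bx))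

  euler-van : ∀ k → VanishesOn (b k) euler
  euler-van k x bx = bx

  private
    Δ/Q = Q-divides-det euler θ₂ θ₃ euler-van van₂ van₃
    u = proj₁ Δ/Q
    u₀ = eval u 0ᵖ

  Δ-homogeneous : Homogeneous m Δ
  Δ-homogeneous t x = trans (det-cong {u = t ·ᵖ x} (λ _ → refl) (λ i → hom₂ i t x) (λ i → hom₃ i t x))
    (trans (det-· t (pw t D) (pw t D) x (val θ₂ x) (val θ₃ x))
      (cong (_* eval Δ x) (trans (cong (t *_) (sym (pw-+ t D D))) (cong (pw t) size))))

  Q-homogeneous : Homogeneous m Q
  Q-homogeneous t x = trans (powers-homogeneous b (λ _ → 1) t x) (cong (λ d → pw t d * eval Q x) (sumℕ-1 m))

  -- Δ and Q have the same degree, so their quotient is constant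
  Δ≡u₀Q : ∀ x → eval Δ x ≡ eval Q x * u₀
  Δ≡u₀Q x = by-cases (eval Q x ℚ.≟ 0ℚ)
    where
    w = U.add (ray u x) ((- eval u x) ∷ [])
    spec : ∀ t → ev w t ≡ eval u (t ·ᵖ x) - eval u x
    spec t = trans (ev-add (ray u x) ((- eval u x) ∷ []) t) (cong₂ _+_ (ev-ray u x t) (ev-const _ t))
    w≡0 : eval Q x ≢ 0ℚ → ∀ t → t ≢ 0ℚ → ev w t ≡ 0ℚ
    w≡0 Qx≢0 t t≢0 = *-zero-split (pw t m * eval Q x) (ev w t) (begin
      pw t m * eval Q x * ev w t
        ≡⟨ cong (pw t m * eval Q x *_) (spec t) ⟩
      pw t m * eval Q x * (eval u (t ·ᵖ x) - eval u x)
        ≡⟨ solve 4 (λ t q a b → t :* q :* (a :- b) := (t :* q) :* a :- t :* (q :* b)) refl (pw t m) (eval Q x) (eval u (t ·ᵖ x)) (eval u x) ⟩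
      (pw t m * eval Q x) * eval u (t ·ᵖ x) - pw t m * (eval Q x * eval u x)
        ≡⟨ p≡q⇒p-q≡0 (begin
             (pw t m * eval Q x) * eval u (t ·ᵖ x)  ≡⟨ cong (_* eval u (t ·ᵖ x)) (sym (Q-homogeneous t x)) ⟩
             eval Q (t ·ᵖ x) * eval u (t ·ᵖ x)      ≡⟨ sym (proj₂ Δ/Q (t ·ᵖ x)) ⟩
             eval Δ (t ·ᵖ x)                        ≡⟨ Δ-homogeneous t x ⟩
             pw t m * eval Δ x                      ≡⟨ cong (pw t m *_) (proj₂ Δ/Q x) ⟩
             pw t m * (eval Q x * eval u x)         ∎) ⟩
      0ℚ ∎) (*-nonzero (pw≢0 m t≢0) Qx≢0)
      where open ≡-Reasoning
    by-cases : Dec (eval Q x ≡ 0ℚ) → eval Δ x ≡ eval Q x * u₀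
    by-cases (yes e)   = trans (proj₂ Δ/Q x) (trans (cong (_* eval u x) e) (trans (ℚP.*-zeroˡ _) (sym (trans (cong (_* u₀) e) (ℚP.*-zeroˡ _)))))
    by-cases (no Qx≢0) = trans (proj₂ Δ/Q x) (cong (eval Q x *_) (sym (p-q≡0⇒p≡q u₀ (eval u x)
      (trans (sym (trans (spec 0ℚ) (cong (_- eval u x) (eval-0· u x)))) (vanish-≢0 w (w≡0 Qx≢0) 0ℚ)))))

  u₀≢0 : u₀ ≢ 0ℚ
  u₀≢0 e = Δp₀≢0 (trans (Δ≡u₀Q p₀) (trans (cong (eval Q p₀ *_) e) (ℚP.*-zeroʳ _)))

  Qp₀≢0 : eval Q p₀ ≢ 0ℚ
  Qp₀≢0 e = Δp₀≢0 (trans (Δ≡u₀Q p₀) (trans (cong (_* u₀) e) (ℚP.*-zeroˡ _)))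

  bp₀≢0 : ∀ k → dot (b k) p₀ ≢ 0ℚ
  bp₀≢0 k e = Δp₀≢0 (det-tangent (b k) (h k) (bh k) p₀ (val θ₂ p₀) (val θ₃ p₀) e (van₂ k p₀ e) (van₃ k p₀ e))

  -- Cramer's rule writes `Δ φ` through θ_E, θ₂, θ₃ with determinants as coefficients. Each of these
  -- is divisible by `Q`, its three columns being tangent to all lines, and `Δ` is a nonzero
  -- constant times `Q`, so `Q` cancels.
  saito : ∀ φ → (∀ k → VanishesOn (b k) φ) → Σ (Poly 3) λ c₁ → Σ (Poly 3) λ c₂ → Σ (Poly 3) λ c₃ →
    ∀ x i → val φ x i ≡ eval c₁ x * x i + (eval c₂ x * val θ₂ x i + eval c₃ x * val θ₃ x i)
  saito φ van = con r ⊗ g₁ , con r ⊗ g₂ , con r ⊗ g₃ , λ x i → begin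
      φv x i                       ≡⟨ sym (ℚP.*-identityˡ _) ⟩
      1ℚ * φv x i                  ≡⟨ cong (_* φv x i) (sym ru₀≡1) ⟩
      r * u₀ * φv x i              ≡⟨ ℚP.*-assoc r u₀ (φv x i) ⟩
      r * (u₀ * φv x i)            ≡⟨ cong (r *_) (p-q≡0⇒p≡q _ _ (F≡0 i x)) ⟩
      r * G x i
        ≡⟨ solve 7 (λ r a b c x y z → r :* (a :* x :+ (b :* y :+ c :* z)) := (r :* a) :* x :+ ((r :* b) :* y :+ (r :* c) :* z)) refl
             r (eval g₁ x) (eval g₂ x) (eval g₃ x) (x i) (val θ₂ x i) (val θ₃ x i) ⟩
      r * eval g₁ x * x i + (r * eval g₂ x * val θ₂ x i + r * eval g₃ x * val θ₃ x i) ∎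
    where
    open ≡-Reasoning
    φv = val φ
    d₁ = Q-divides-det φ θ₂ θ₃ van van₂ van₃
    d₂ = Q-divides-det euler φ θ₃ euler-van van van₃
    d₃ = Q-divides-det euler θ₂ φ euler-van van₂ van
    g₁ = proj₁ d₁ ; g₂ = proj₁ d₂ ; g₃ = proj₁ d₃
    r = proj₁ (inv u₀ u₀≢0)
    ru₀≡1 = proj₂ (inv u₀ u₀≢0)
    G : Pt 3 → Pt 3
    G x i = eval g₁ x * x i + (eval g₂ x * val θ₂ x i + eval g₃ x * val θ₃ x i)
    F≡0 : ∀ i x → u₀ * φv x i - G x i ≡ 0ℚ
    F≡0 i = cancel-all ((con u₀ ⊗ φ i) ⊕ (⊝ ((g₁ ⊗ var i) ⊕ ((g₂ ⊗ θ₂ i) ⊕ (g₃ ⊗ θ₃ i))))) Q p₀ Qp₀≢0 (λ x → begin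
      (u₀ * φv x i - G x i) * eval Q x
        ≡⟨ solve 9 (λ u f q a b c x y z → (u :* f :- (a :* x :+ (b :* y :+ c :* z))) :* q
             := (q :* u) :* f :- ((q :* a) :* x :+ ((q :* b) :* y :+ (q :* c) :* z))) refl
             u₀ (φv x i) (eval Q x) (eval g₁ x) (eval g₂ x) (eval g₃ x) (x i) (val θ₂ x i) (val θ₃ x i) ⟩
      (eval Q x * u₀) * φv x i - ((eval Q x * eval g₁ x) * x i + ((eval Q x * eval g₂ x) * val θ₂ x i + (eval Q x * eval g₃ x) * val θ₃ x i))
        ≡⟨ p≡q⇒p-q≡0 (trans (cong (_* φv x i) (sym (Δ≡u₀Q x))) (trans (cramer i x (val θ₂ x) (val θ₃ x) (φv x))
             (cong₂ _+_ (cong (_* x i) (proj₂ d₁ x)) (cong₂ _+_ (cong (_* val θ₂ x i) (proj₂ d₂ x)) (cong (_* val θ₃ x i) (proj₂ d₃ x)))))) ⟩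
      0ℚ ∎)

  dot₃ : ∀ (a : Form 3) c₁ c₂ c₃ u v w → dot a (λ i → c₁ * u i + (c₂ * v i + c₃ * w i)) ≡ c₁ * dot a u + (c₂ * dot a v + c₃ * dot a w)
  dot₃ a c₁ c₂ c₃ u v w = trans
    (sum-cong (λ i → solve 7 (λ a c1 c2 c3 u v w → a :* (c1 :* u :+ (c2 :* v :+ c3 :* w)) := c1 :* (a :* u) :+ (c2 :* (a :* v) :+ c3 :* (a :* w)))
       refl (a i) c₁ c₂ c₃ (u i) (v i) (w i)))
    (trans (sum-+ (λ i → c₁ * (a i * u i)) (λ i → c₂ * (a i * v i) + c₃ * (a i * w i)))
      (cong₂ _+_ (sum-*ˡ c₁ (λ i → a i * u i)) (trans (sum-+ (λ i → c₂ * (a i * v i)) (λ i → c₃ * (a i * w i)))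
        (cong₂ _+_ (sum-*ˡ c₂ (λ i → a i * v i)) (sum-*ˡ c₃ (λ i → a i * w i))))))

  Tangents : (Fin m → ℕ) → Der 3 → Set
  Tangents μ φ = ∀ k → Tangent (b k) (μ k) φ

  module Between (μ : Fin m → ℕ) (1≤μ : ∀ k → 1 ℕ.≤ μ k) (μ≤κ : ∀ k → μ k ℕ.≤ κ k) where

    ν : Fin m → ℕ
    ν k = μ k ℕ.∸ 1

    Qν : Poly 3
    Qν = powers b ν

    μ≡1+ν : ∀ k → μ k ≡ suc (ν k)
    μ≡1+ν k = sym (ℕP.m+[n∸m]≡n (1≤μ k))

    ψ : Fin 3 → Der 3
    ψ 0F i = Qν ⊗ var i
    ψ 1F   = θ₂
    ψ 2F   = θ₃

    combination : ∀ (f : Fin 3 → Poly 3) x i → Combination f ψ x i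
      ≡ (eval (f 0F) x * eval Qν x) * x i + (eval (f 1F) x * val θ₂ x i + eval (f 2F) x * val θ₃ x i)
    combination f x i = solve 7 (λ a q x b y c z → a :* (q :* x) :+ (b :* y :+ (c :* z :+ :0)) := (a :* q) :* x :+ (b :* y :+ c :* z)) refl
      (eval (f 0F) x) (eval Qν x) (x i) (eval (f 1F) x) (val θ₂ x i) (eval (f 2F) x) (val θ₃ x i)

    Qν≢0 : ∀ x → (∀ k → μ k ≢ 1 → dot (b k) x ≢ 0ℚ) → eval Qν x ≢ 0ℚ
    Qν≢0 x hx = powers≢0 b ν x (λ k ν≢0 → hx k (λ e → ν≢0 (cong (ℕ._∸ 1) e)))

    ψ-tangent : ∀ j → Tangents μ (ψ j)
    ψ-tangent 0F k = let g , e = powers-factor b ν k in g , λ x →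
      trans (dot-· (b k) (eval Qν x) x) (trans (cong (_* dot (b k) x) (e x))
        (trans (solve 3 (λ w g d → (w :* g) :* d := (d :* w) :* g) refl (pw (dot (b k) x) (ν k)) (eval g x) (dot (b k) x))
          (cong (λ n → pw (dot (b k) x) n * eval g x) (sym (μ≡1+ν k)))))
    ψ-tangent 1F k = weaken (b k) θ₂ (μ≤κ k) (tan₂ k)
    ψ-tangent 2F k = weaken (b k) θ₃ (μ≤κ k) (tan₃ k)

    ψ-basis : Basis (Tangents μ) ψ
    ψ-basis = record { member = ψ-tangent ; generates = gen ; independent = ind }
      where
      gen : ∀ φ → Tangents μ φ → Σ (Fin 3 → Poly 3) λ f → ∀ x i → val φ x i ≡ Combination f ψ x i
      gen φ t = f , λ x i → trans (eq x i) (trans (cong (λ w → w * x i + (eval c₂ x * val θ₂ x i + eval c₃ x * val θ₃ x i))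
          (trans (c₁≡Qg x) (ℚP.*-comm (eval Qν x) (eval g x)))) (sym (combination f x i)))
        where
        s = saito φ (λ k → tangent⇒vanishes (b k) φ (1≤μ k) (t k))
        c₁ = proj₁ s ; c₂ = proj₁ (proj₂ s) ; c₃ = proj₁ (proj₂ (proj₂ s))
        eq = proj₂ (proj₂ (proj₂ s))
        -- Applied to `b k`, the expression of `φ` gives `c₁` times `b k` as a combination of values
        -- divisible by the power `μ k` of `b k`. Cancelling one factor leaves the power `ν k` in
        -- `c₁`; coprimality of the lines then yields the whole of `Qν`.
        divides : ∀ k → Σ (Poly 3) λ g → ∀ x → eval c₁ x ≡ pw (dot (b k) x) (ν k) * eval g x
        divides k = G , λ x → p-q≡0⇒p≡q _ _ (trans (sym (spec x)) (cancel-form (b k) (h k) (bh k) (c₁ ⊕ (⊝ ((lin (b k) ^ ν k) ⊗ G))) product x))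
          where
          open ≡-Reasoning
          t₁ = t k
          t₂ = weaken (b k) θ₂ (μ≤κ k) (tan₂ k)
          t₃ = weaken (b k) θ₃ (μ≤κ k) (tan₃ k)
          G = proj₁ t₁ ⊕ (⊝ ((c₂ ⊗ proj₁ t₂) ⊕ (c₃ ⊗ proj₁ t₃)))
          spec : ∀ x → eval (c₁ ⊕ (⊝ ((lin (b k) ^ ν k) ⊗ G))) x ≡ eval c₁ x - pw (dot (b k) x) (ν k) * eval G x
          spec x = cong (λ w → eval c₁ x - w * eval G x) (trans (eval-^ (lin (b k)) (ν k) x) (cong (λ w → pw w (ν k)) (eval-lin (b k) x)))
          product : ∀ x → eval (c₁ ⊕ (⊝ ((lin (b k) ^ ν k) ⊗ G))) x * dot (b k) x ≡ 0ℚ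
          product x = begin
            eval (c₁ ⊕ (⊝ ((lin (b k) ^ ν k) ⊗ G))) x * d
              ≡⟨ cong (_* d) (spec x) ⟩
            (C₁ - W * (g₁ - (C₂ * g₂ + C₃ * g₃))) * d
              ≡⟨ solve 8 (λ c1 w g1 c2 g2 c3 g3 d → (c1 :- w :* (g1 :- (c2 :* g2 :+ c3 :* g3))) :* d
                   := (c1 :* d :+ (c2 :* ((d :* w) :* g2) :+ c3 :* ((d :* w) :* g3))) :- (d :* w) :* g1) refl C₁ W g₁ C₂ g₂ C₃ g₃ d ⟩
            (C₁ * d + (C₂ * (d * W * g₂) + C₃ * (d * W * g₃))) - d * W * g₁
              ≡⟨ cong (λ w → (C₁ * d + (C₂ * (w * g₂) + C₃ * (w * g₃))) - w * g₁) (cong (pw d) (sym (μ≡1+ν k))) ⟩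
            (C₁ * d + (C₂ * (pw d (μ k) * g₂) + C₃ * (pw d (μ k) * g₃))) - pw d (μ k) * g₁
              ≡⟨ p≡q⇒p-q≡0 (begin
                   C₁ * d + (C₂ * (pw d (μ k) * g₂) + C₃ * (pw d (μ k) * g₃))
                     ≡⟨ cong (C₁ * d +_) (cong₂ (λ v w → C₂ * v + C₃ * w) (sym (proj₂ t₂ x)) (sym (proj₂ t₃ x))) ⟩
                   C₁ * d + (C₂ * dot (b k) (val θ₂ x) + C₃ * dot (b k) (val θ₃ x))
                     ≡⟨ sym (dot₃ (b k) C₁ C₂ C₃ x (val θ₂ x) (val θ₃ x)) ⟩
                   dot (b k) (λ i → C₁ * x i + (C₂ * val θ₂ x i + C₃ * val θ₃ x i))
                     ≡⟨ dot-cong (b k) (λ i → sym (eq x i)) ⟩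
                   dot (b k) (val φ x)
                     ≡⟨ proj₂ t₁ x ⟩
                   pw d (μ k) * g₁ ∎) ⟩
            0ℚ ∎
            where
            d = dot (b k) x ; W = pw d (ν k)
            C₁ = eval c₁ x ; C₂ = eval c₂ x ; C₃ = eval c₃ x
            g₁ = eval (proj₁ t₁) x ; g₂ = eval (proj₁ t₂) x ; g₃ = eval (proj₁ t₃) x
        dp = divide-powers b h bh p p∈ generic ν c₁ divides
        g = proj₁ dp
        c₁≡Qg = proj₂ dp
        f : Fin 3 → Poly 3
        f 0F = g
        f 1F = c₂
        f 2F = c₃

      ind : ∀ f → (∀ x i → Combination f ψ x i ≡ 0ℚ) → ∀ j x → eval (f j) x ≡ 0ℚ
      ind f e = λ { 0F → f₀≡0 ; 1F → f₁≡0 ; 2F → f₂≡0 }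
        where
        open ≡-Reasoning
        A B C : Pt 3 → ℚ
        A x = eval (f 0F) x * eval Qν x
        B x = eval (f 1F) x
        C x = eval (f 2F) x
        e′ : ∀ x i → A x * x i + (B x * val θ₂ x i + C x * val θ₃ x i) ≡ 0ℚ
        e′ x i = trans (sym (combination f x i)) (e x i)
        det-zero : ∀ u v w → (∀ i → u i ≡ 0ℚ) → det u v w ≡ 0ℚ
        det-zero u v w u≡0 = trans (cong₂ _+_ (cong (_* cross 0F v w) (u≡0 0F))
            (cong₂ _+_ (cong (_* cross 1F v w) (u≡0 1F)) (cong (_* cross 2F v w) (u≡0 2F))))
          (solve 3 (λ x y z → :0 :* x :+ (:0 :* y :+ :0 :* z) := :0) refl (cross 0F v w) (cross 1F v w) (cross 2F v w))
        -- Putting the relation in place of one argument of `Δ` multiplies the determinant by the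
        -- coefficient of that argument. For this first coefficient `Qν` has to be cancelled as
        -- well.
        f₀≡0 : ∀ x → eval (f 0F) x ≡ 0ℚ
        f₀≡0 = cancel-all (f 0F) (Qν ⊗ Δ) p₀ (*-nonzero (Qν≢0 p₀ (λ k _ → bp₀≢0 k)) Δp₀≢0) (λ x → begin
          eval (f 0F) x * (eval Qν x * eval Δ x)  ≡⟨ sym (ℚP.*-assoc _ _ _) ⟩
          A x * det x (val θ₂ x) (val θ₃ x)       ≡⟨ sym (det-expand₁ (A x) (B x) (C x) x (val θ₂ x) (val θ₃ x)) ⟩
          det (λ i → A x * x i + (B x * val θ₂ x i + C x * val θ₃ x i)) (val θ₂ x) (val θ₃ x)
            ≡⟨ det-zero _ (val θ₂ x) (val θ₃ x) (e′ x) ⟩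
          0ℚ ∎)
        f₁≡0 : ∀ x → eval (f 1F) x ≡ 0ℚ
        f₁≡0 = cancel-all (f 1F) Δ p₀ Δp₀≢0 (λ x → begin
          B x * det x (val θ₂ x) (val θ₃ x)       ≡⟨ cong (B x *_) (det-cycle x (val θ₂ x) (val θ₃ x)) ⟩
          B x * det (val θ₂ x) (val θ₃ x) x       ≡⟨ sym (det-expand₁ (B x) (C x) (A x) (val θ₂ x) (val θ₃ x) x) ⟩
          det (λ i → B x * val θ₂ x i + (C x * val θ₃ x i + A x * x i)) (val θ₃ x) x
            ≡⟨ det-zero _ (val θ₃ x) x (λ i → trans (solve 3 (λ a b c → b :+ (c :+ a) := a :+ (b :+ c)) refl (A x * x i) (B x * val θ₂ x i) (C x * val θ₃ x i)) (e′ x i)) ⟩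
          0ℚ ∎)
        f₂≡0 : ∀ x → eval (f 2F) x ≡ 0ℚ
        f₂≡0 = cancel-all (f 2F) Δ p₀ Δp₀≢0 (λ x → begin
          C x * det x (val θ₂ x) (val θ₃ x)       ≡⟨ cong (C x *_) (trans (det-cycle x (val θ₂ x) (val θ₃ x)) (det-cycle (val θ₂ x) (val θ₃ x) x)) ⟩
          C x * det (val θ₃ x) x (val θ₂ x)       ≡⟨ sym (det-expand₁ (C x) (A x) (B x) (val θ₃ x) x (val θ₂ x)) ⟩
          det (λ i → C x * val θ₃ x i + (A x * x i + B x * val θ₂ x i)) x (val θ₂ x)
            ≡⟨ det-zero _ x (val θ₂ x) (λ i → trans (solve 3 (λ a b c → c :+ (a :+ b) := a :+ (b :+ c)) refl (A x * x i) (B x * val θ₂ x i) (C x * val θ₃ x i)) (e′ x i)) ⟩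
          0ℚ ∎)

    -- In a relation modulo the line b_k between the members of the basis all
    -- coefficients vanish at the origin: restricted to the ray through a
    -- point of the line, the lowest order terms give relations between
    -- the values of θ_E, θ₂, θ₃ at that point.
    module Key (k : Fin m) (μk≡1 : μ k ≡ 1) (φ : Der 3) (f : Fin 3 → Poly 3)
      (eq : ∀ x i → dot (b k) x * val φ x i ≡ Combination f ψ x i) where
      private
        |ν| = sumℕ ν
        ν≤ : |ν| ℕ.≤ sumℕ (λ k → κ k ℕ.∸ 1)
        ν≤ = sumℕ-mono (λ k → ℕP.∸-monoˡ-≤ 1 (μ≤κ k))
        -- The amount by which the degree of θ₂ and θ₃ exceeds that of `ψ 0F`. It may be 0; in the
        -- application this happens for `μ = κ`.
        e = D ℕ.∸ suc |ν|
        D≡ : suc |ν| ℕ.+ e ≡ D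
        D≡ = ℕP.m+[n∸m]≡n (ℕP.≤-trans (ℕ.s≤s ν≤) excess)

        on-ray : ∀ x → Ker (b k) x → ∀ t i →
          (eval (f 0F) (t ·ᵖ x) * (pw t |ν| * eval Qν x)) * (t * x i)
            + ((eval (f 1F) (t ·ᵖ x) * pw t D) * val θ₂ x i + (eval (f 2F) (t ·ᵖ x) * pw t D) * val θ₃ x i) ≡ 0ℚ
        on-ray x bx t i = begin
          (eval (f 0F) y * (pw t |ν| * eval Qν x)) * (t * x i) + ((eval (f 1F) y * pw t D) * val θ₂ x i + (eval (f 2F) y * pw t D) * val θ₃ x i)
            ≡⟨ cong₂ _+_ (cong (λ w → (eval (f 0F) y * w) * (t * x i)) (sym (powers-homogeneous b ν t x)))
                 (cong₂ _+_ (trans (ℚP.*-assoc _ _ _) (cong (eval (f 1F) y *_) (sym (hom₂ i t x))))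
                            (trans (ℚP.*-assoc _ _ _) (cong (eval (f 2F) y *_) (sym (hom₃ i t x))))) ⟩
          (eval (f 0F) y * eval Qν y) * y i + (eval (f 1F) y * val θ₂ y i + eval (f 2F) y * val θ₃ y i)
            ≡⟨ sym (combination f y i) ⟩
          Combination f ψ y i
            ≡⟨ sym (eq y i) ⟩
          dot (b k) y * val φ y i
            ≡⟨ cong (_* val φ y i) (trans (dot-· (b k) t x) (trans (cong (t *_) bx) (ℚP.*-zeroʳ t))) ⟩
          0ℚ * val φ y i
            ≡⟨ ℚP.*-zeroˡ _ ⟩
          0ℚ ∎
          where
          open ≡-Reasoning
          y = t ·ᵖ x

        ω : Der 3 → Pt 3 → ℚ
        ω θ x = cross (c k) x (val θ x)

        -- The cross product with `x` removes the Euler term of the relation on the ray. The common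
        -- factor `pw t D` is then cancelled, and `t = 0` leaves the coefficients at the origin.
        relation : ∀ x → Ker (b k) x → eval (f 1F) 0ᵖ * ω θ₂ x + eval (f 2F) 0ᵖ * ω θ₃ x ≡ 0ℚ
        relation x bx = trans (cong₂ (λ v w → v * ω θ₂ x + w * ω θ₃ x) (sym (eval-0· (f 1F) x)) (sym (eval-0· (f 2F) x)))
          (trans (sym (spec 0ℚ)) (vanish-≢0 w w≡0 0ℚ))
          where
          w = U.add (U.scale (ω θ₂ x) (ray (f 1F) x)) (U.scale (ω θ₃ x) (ray (f 2F) x))
          spec : ∀ t → ev w t ≡ eval (f 1F) (t ·ᵖ x) * ω θ₂ x + eval (f 2F) (t ·ᵖ x) * ω θ₃ x
          spec t = trans (ev-add (U.scale (ω θ₂ x) (ray (f 1F) x)) (U.scale (ω θ₃ x) (ray (f 2F) x)) t)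
            (cong₂ _+_ (trans (U.horner-scale (ω θ₂ x) (ray (f 1F) x) tt t) (trans (cong (ω θ₂ x *_) (ev-ray (f 1F) x t)) (ℚP.*-comm _ _)))
                       (trans (U.horner-scale (ω θ₃ x) (ray (f 2F) x) tt t) (trans (cong (ω θ₃ x *_) (ev-ray (f 2F) x t)) (ℚP.*-comm _ _))))
          w≡0 : ∀ t → t ≢ 0ℚ → ev w t ≡ 0ℚ
          w≡0 t t≢0 = trans (spec t) (*-zero-split (pw t D) _
            (trans (solve 5 (λ d a x b y → d :* (a :* x :+ b :* y) := (a :* d) :* x :+ (b :* d) :* y) refl (pw t D) (eval (f 1F) (t ·ᵖ x)) (ω θ₂ x) (eval (f 2F) (t ·ᵖ x)) (ω θ₃ x))
              (cross-ray (c k) (eval (f 0F) (t ·ᵖ x) * (pw t |ν| * eval Qν x)) (eval (f 1F) (t ·ᵖ x) * pw t D) (eval (f 2F) (t ·ᵖ x) * pw t D) t x (val θ₂ x) (val θ₃ x) (on-ray x bx t)))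
            (pw≢0 D t≢0))

        W = ω θ₂ (p k) * ω θ₃ (q k) - ω θ₃ (p k) * ω θ₂ (q k)

        -- The relations at `p k` and `q k` form a linear system for the two coefficients at the
        -- origin, with determinant `W`.
        f₁≡0 : eval (f 1F) 0ᵖ ≡ 0ℚ
        f₁≡0 = *-zero-split W _ (trans (solve 6 (λ a b c d x y → (a :* d :- b :* c) :* x := d :* (x :* a :+ y :* b) :- b :* (x :* c :+ y :* d)) refl
            (ω θ₂ (p k)) (ω θ₃ (p k)) (ω θ₂ (q k)) (ω θ₃ (q k)) (eval (f 1F) 0ᵖ) (eval (f 2F) 0ᵖ))
          (trans (cong₂ (λ v w → ω θ₃ (q k) * v - ω θ₃ (p k) * w) (relation (p k) (p∈ k)) (relation (q k) (q∈ k)))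
            (solve 2 (λ a b → a :* :0 :- b :* :0 := :0) refl (ω θ₃ (q k)) (ω θ₃ (p k))))) (ω≢0 k)

        f₂≡0 : eval (f 2F) 0ᵖ ≡ 0ℚ
        f₂≡0 = *-zero-split W _ (trans (solve 6 (λ a b c d x y → (a :* d :- b :* c) :* y := a :* (x :* c :+ y :* d) :- c :* (x :* a :+ y :* b)) refl
            (ω θ₂ (p k)) (ω θ₃ (p k)) (ω θ₂ (q k)) (ω θ₃ (q k)) (eval (f 1F) 0ᵖ) (eval (f 2F) 0ᵖ))
          (trans (cong₂ (λ v w → ω θ₂ (p k) * v - ω θ₂ (q k) * w) (relation (q k) (q∈ k)) (relation (p k) (p∈ k)))
            (solve 2 (λ a b → a :* :0 :- b :* :0 := :0) refl (ω θ₂ (p k)) (ω θ₂ (q k))))) (ω≢0 k)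

        -- The form `b k` does not divide `Qν` because `μ k` is 1, and all other lines avoid `p k`.
        Qνp≢0 : eval Qν (p k) ≢ 0ℚ
        Qνp≢0 = Qν≢0 (p k) (λ l μl≢1 → generic k l (λ { refl → μl≢1 μk≡1 }))

        -- After division by `pw t (suc |ν|)` the terms of θ₂ and θ₃ carry the factor `pw t e`. For
        -- `e = 0` this is no help at `t = 0`; they drop out because `f₁≡0` and `f₂≡0` are already
        -- known.
        f₀≡0 : eval (f 0F) 0ᵖ ≡ 0ℚ
        f₀≡0 = *-zero-split A _ (trans (sym at-0) (vanish-≢0 w w≡0 0ℚ)) (*-nonzero Qνp≢0 (pz≢0 k))
          where
          open ≡-Reasoning
          x = p k
          i = z k
          A = eval Qν x * x i
          r₁ = U.scale (val θ₂ x i) (ray (f 1F) x)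
          r₂ = U.scale (val θ₃ x i) (ray (f 2F) x)
          w = U.add (U.scale A (ray (f 0F) x)) (U.mul (monomial e) (U.add r₁ r₂))
          spec : ∀ t → ev w t ≡ A * eval (f 0F) (t ·ᵖ x) + pw t e * (val θ₂ x i * eval (f 1F) (t ·ᵖ x) + val θ₃ x i * eval (f 2F) (t ·ᵖ x))
          spec t = trans (ev-add (U.scale A (ray (f 0F) x)) (U.mul (monomial e) (U.add r₁ r₂)) t)
            (cong₂ _+_ (trans (U.horner-scale A (ray (f 0F) x) tt t) (cong (A *_) (ev-ray (f 0F) x t)))
              (trans (ev-mul (monomial e) (U.add r₁ r₂) t) (cong₂ _*_ (ev-monomial e t)
                (trans (ev-add r₁ r₂ t) (cong₂ _+_ (trans (U.horner-scale (val θ₂ x i) (ray (f 1F) x) tt t) (cong (val θ₂ x i *_) (ev-ray (f 1F) x t)))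
                                                   (trans (U.horner-scale (val θ₃ x i) (ray (f 2F) x) tt t) (cong (val θ₃ x i *_) (ev-ray (f 2F) x t))))))))
          at-0 : ev w 0ℚ ≡ A * eval (f 0F) 0ᵖ
          at-0 = trans (spec 0ℚ) (trans (cong₂ _+_ (cong (A *_) (eval-0· (f 0F) x))
              (cong₂ (λ u v → pw 0ℚ e * (val θ₂ x i * u + val θ₃ x i * v)) (trans (eval-0· (f 1F) x) f₁≡0) (trans (eval-0· (f 2F) x) f₂≡0)))
            (solve 4 (λ a m u v → a :+ m :* (u :* :0 :+ v :* :0) := a) refl (A * eval (f 0F) 0ᵖ) (pw 0ℚ e) (val θ₂ x i) (val θ₃ x i)))
          w≡0 : ∀ t → t ≢ 0ℚ → ev w t ≡ 0ℚ
          w≡0 t t≢0 = *-zero-split (pw t (suc |ν|)) (ev w t) (begin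
            t * pw t |ν| * ev w t
              ≡⟨ cong (t * pw t |ν| *_) (spec t) ⟩
            t * pw t |ν| * (eval Qν x * x i * F₀ + pw t e * (val θ₂ x i * F₁ + val θ₃ x i * F₂))
              ≡⟨ solve 9 (λ t m q x f w a b c → t :* m :* (q :* x :* f :+ w :* (a :* b :+ c)) :=
                   (f :* (m :* q)) :* (t :* x) :+ ((b :* (t :* m :* w)) :* a :+ (t :* m :* w) :* c)) refl
                   t (pw t |ν|) (eval Qν x) (x i) F₀ (pw t e) (val θ₂ x i) F₁ (val θ₃ x i * F₂) ⟩
            (F₀ * (pw t |ν| * eval Qν x)) * (t * x i) + ((F₁ * (t * pw t |ν| * pw t e)) * val θ₂ x i + (t * pw t |ν| * pw t e) * (val θ₃ x i * F₂))
              ≡⟨ cong (λ d → (F₀ * (pw t |ν| * eval Qν x)) * (t * x i) + ((F₁ * d) * val θ₂ x i + d * (val θ₃ x i * F₂)))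
                   (trans (sym (pw-+ t (suc |ν|) e)) (cong (pw t) D≡)) ⟩
            (F₀ * (pw t |ν| * eval Qν x)) * (t * x i) + ((F₁ * pw t D) * val θ₂ x i + pw t D * (val θ₃ x i * F₂))
              ≡⟨ cong (λ d → (F₀ * (pw t |ν| * eval Qν x)) * (t * x i) + ((F₁ * pw t D) * val θ₂ x i + d))
                   (solve 3 (λ d a f → d :* (a :* f) := f :* d :* a) refl (pw t D) (val θ₃ x i) F₂) ⟩
            (F₀ * (pw t |ν| * eval Qν x)) * (t * x i) + ((F₁ * pw t D) * val θ₂ x i + (F₂ * pw t D) * val θ₃ x i)
              ≡⟨ on-ray x (p∈ k) t i ⟩
            0ℚ ∎) (pw≢0 (suc |ν|) t≢0)
            where
            F₀ = eval (f 0F) (t ·ᵖ x)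
            F₁ = eval (f 1F) (t ·ᵖ x)
            F₂ = eval (f 2F) (t ·ᵖ x)

      key : ∀ j → eval (f j) 0ᵖ ≡ 0ℚ
      key 0F = f₀≡0
      key 1F = f₁≡0
      key 2F = f₂≡0

    module Deleted (k : Fin m) (μk≡1 : μ k ≡ 1) (μ′ : Fin m → ℕ) (μ′k≡0 : μ′ k ≡ 0) (μ′≡μ : ∀ l → l ≢ k → μ′ l ≡ μ l) where
      private
        μ′≤μ : ∀ l → μ′ l ℕ.≤ μ l
        μ′≤μ l with l FinP.≟ k
        ... | yes refl = subst (ℕ._≤ μ k) (sym μ′k≡0) ℕ.z≤n
        ... | no l≢k   = ℕP.≤-reflexive (μ′≡μ l l≢k)

        α = b k

        αD′⊆D : ∀ φ → Tangents μ′ φ → Tangents μ (λ i → lin α ⊗ φ i)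
        αD′⊆D φ t l = by-cases (l FinP.≟ k)
          where
          αφ : ∀ x → dot (b l) (val (λ i → lin α ⊗ φ i) x) ≡ dot α x * dot (b l) (val φ x)
          αφ x = trans (dot-· (b l) (eval (lin α) x) (val φ x)) (cong (_* dot (b l) (val φ x)) (eval-lin α x))
          by-cases : Dec (l ≡ k) → Tangent (b l) (μ l) (λ i → lin α ⊗ φ i)
          by-cases (yes refl) = applyDer φ α , λ x → trans (αφ x)
            (cong₂ _*_ (trans (sym (ℚP.*-identityʳ _)) (cong (pw (dot α x)) (sym μk≡1))) (sym (eval-applyDer φ α x)))
          by-cases (no l≢k) = lin α ⊗ proj₁ (t l) , λ x → trans (αφ x) (trans (cong (dot α x *_) (proj₂ (t l) x))
            (trans (solve 3 (λ a w g → a :* (w :* g) := w :* (a :* g)) refl (dot α x) (pw (dot (b l) x) (μ′ l)) (eval (proj₁ (t l)) x))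
              (cong₂ (λ n a → pw (dot (b l) x) n * (a * eval (proj₁ (t l)) x)) (μ′≡μ l l≢k) (sym (eval-lin α x)))))

        -- A constant field in the direction `h k`, multiplied by just the powers that `μ′` demands.
        -- As `μ′ k` is 0, the form `b k` is not among them, so `χ` is transversal to this line at
        -- `p k`.
        χ : Der 3
        χ i = powers b μ′ ⊗ con (h k i)

        dot-χ : ∀ l x → dot (b l) (val χ x) ≡ eval (powers b μ′) x * dot (b l) (h k)
        dot-χ l x = dot-· (b l) (eval (powers b μ′) x) (h k)

        χ∈D′ : Tangents μ′ χ
        χ∈D′ l = let g , e = powers-factor b μ′ l in g ⊗ con (dot (b l) (h k)) , λ x →
          trans (dot-χ l x) (trans (cong (_* dot (b l) (h k)) (e x)) (ℚP.*-assoc _ _ _))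

        χ≢0 : dot α (val χ (p k)) ≢ 0ℚ
        χ≢0 e = powers≢0 b μ′ (p k) (λ l μ′l≢0 → generic k l (λ { refl → μ′l≢0 μ′k≡0 }))
          (trans (sym (ℚP.*-identityʳ _)) (trans (cong (eval (powers b μ′) (p k) *_) (sym (bh k))) (trans (sym (dot-χ k (p k))) e)))

      not-free : ∀ {r} (φ : Fin r → Der 3) → Basis (Tangents μ′) φ → ⊥
      not-free = NotFree.not-free (Tangents μ) (Tangents μ′) α (h k) (bh k) ψ ψ-basis
        (λ j l → weaken (b l) (ψ j) (μ′≤μ l) (ψ-tangent j l)) αD′⊆D
        (λ φ f eq → Key.key k μk≡1 φ f eq)
        (λ j → tangent⇒vanishes α (ψ j) (1≤μ k) (ψ-tangent j k))
        χ χ∈D′ (p k) (p∈ k) χ≢0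

-- Coordinates s = a(x), t, 1 near the line a in the projective plane, a_p = ± 1

module PlaneChart (a : Vec ℤ 3) (p : Fin 3) where
  free : Fin 2 → Fin 3
  free = punchIn p

  solved : ℤ[s,t]
  solved = (m ℤ.* lookup a (free 1F) ∷ m ℤ.* lookup a (free 0F) ∷ []) ∷ (lookup a p ∷ []) ∷ []
    where m = ℤ.- lookup a p

  others : Vec ℤ[s,t] 2
  others = ((ℤ.+ 0 ∷ ℤ.+ 1 ∷ []) ∷ []) ∷ ((ℤ.+ 1 ∷ []) ∷ []) ∷ []

  coordinates : Vec ℤ[s,t] 3
  coordinates = insertAt others p solved

  point : ℚ → ℚ → Pt 3
  point s t i = value (lookup coordinates i) s t

  freeVal : ℚ → Fin 2 → ℚ
  freeVal t 0F = t
  freeVal t 1F = 1ℚ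

  point-free : ∀ s t j → point s t (free j) ≡ freeVal t j
  point-free s t j = trans (cong (λ q → value q s t) (VecP.insertAt-punchIn others p solved j)) (go j)
    where
    go : ∀ j → value (lookup others j) s t ≡ freeVal t j
    go 0F = solve 2 (λ s t → (:0 :+ t :* (:1 :+ t :* :0)) :+ s :* :0 := t) refl s t
    go 1F = solve 2 (λ s t → (:1 :+ t :* :0) :+ s :* :0 := :1) refl s t

  point-solved : ∀ s t → point s t p ≡ fm a p * (s - sumℚ (λ j → fm a (free j) * freeVal t j))
  point-solved s t = trans (cong (λ q → value q s t) (VecP.insertAt-lookup others p solved))
    (trans (cong₂ (λ u v → u + t * (v + t * 0ℚ) + s * ((fm a p + t * 0ℚ) + s * 0ℚ)) (ι* 1F) (ι* 0F))
      (solve 5 (λ m b c s t → ((:- m) :* c :+ t :* ((:- m) :* b :+ t :* :0)) :+ s :* ((m :+ t :* :0) :+ s :* :0)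
                 := m :* (s :- (b :* t :+ (c :* :1 :+ :0)))) refl (fm a p) (fm a (free 0F)) (fm a (free 1F)) s t))
    where
    ι* : ∀ j → ι (ℤ.- lookup a p ℤ.* lookup a (free j)) ≡ - fm a p * fm a (free j)
    ι* j = trans (ι-* _ _) (cong (_* fm a (free j)) (ι-neg (lookup a p)))

  module _ (unit : lookup a p ℤ.* lookup a p ≡ ℤ.+ 1) where
    unitℚ : fm a p * fm a p ≡ 1ℚ
    unitℚ = trans (sym (ι-* _ _)) (cong ι unit)

    normal-vector : Pt 3
    normal-vector i = δ p i * fm a p

    normal-unit : dot (fm a) normal-vector ≡ 1ℚ
    normal-unit = trans (sum-cong (λ i → solve 3 (λ a d m → a :* (d :* m) := d :* (a :* m)) refl (fm a i) (δ p i) (fm a p)))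
      (trans (sum-δ p (λ i → fm a i * fm a p)) unitℚ)

    normal-free : ∀ j → normal-vector (free j) ≡ 0ℚ
    normal-free j = trans (cong (_* fm a p) (δ-≢ (λ e → FinP.punchInᵢ≢i p j (sym e)))) (ℚP.*-zeroˡ _)

    dot-point : ∀ s t → dot (fm a) (point s t) ≡ s
    dot-point s t = trans (sum-punchIn p (λ i → fm a i * point s t i))
      (trans (cong₂ _+_ (trans (cong (fm a p *_) (point-solved s t))
           (trans (sym (ℚP.*-assoc _ _ _)) (cong (_* (s - R)) unitℚ)))
         (sum-cong (λ j → cong (fm a (free j) *_) (point-free s t j))))
       (solve 2 (λ s r → :1 :* (s :- r) :+ r := s) refl s R))
      where R = sumℚ (λ j → fm a (free j) * freeVal t j)

    point-surjective : ∀ x → x (free 1F) ≡ 1ℚ → ∀ i → point (dot (fm a) x) (x (free 0F)) i ≡ x i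
    point-surjective x x₁≡1 i with i FinP.≟ p
    ... | no i≢p = trans (cong (point _ _) (sym e)) (trans (point-free (dot (fm a) x) (x (free 0F)) j) (trans (go j) (cong x e)))
      where
      j = punchOut (λ q → i≢p (sym q))
      e : free j ≡ i
      e = FinP.punchIn-punchOut (λ q → i≢p (sym q))
      go : ∀ j → freeVal (x (free 0F)) j ≡ x (free j)
      go 0F = refl
      go 1F = sym x₁≡1
    ... | yes refl = begin
        point s t i                             ≡⟨ point-solved s t ⟩
        fm a i * (s - sumℚ (λ j → fm a (free j) * freeVal t j))
          ≡⟨ cong₂ (λ u v → fm a i * (u - v)) (sum-punchIn i (λ j → fm a j * x j)) (sum-cong (λ j → cong (fm a (free j) *_) (go j))) ⟩
        fm a i * ((fm a i * x i + R) - R)       ≡⟨ solve 3 (λ a x r → a :* ((a :* x :+ r) :- r) := (a :* a) :* x) refl (fm a i) (x i) R ⟩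
        (fm a i * fm a i) * x i                 ≡⟨ cong (_* x i) unitℚ ⟩
        1ℚ * x i                                ≡⟨ ℚP.*-identityˡ _ ⟩
        x i ∎
      where
      open ≡-Reasoning
      s = dot (fm a) x
      t = x (free 0F)
      R = sumℚ (λ j → fm a (free j) * x (free j))
      go : ∀ j → freeVal t j ≡ x (free j)
      go 0F = refl
      go 1F = sym x₁≡1

toD : Vec (Ex 3) 3 → Der 3
toD θ i = toP (lookup θ i)

evaluateAll : Vec ℤ[s,t] 3 → Vec (Ex 3) 3 → Vec ℤ[s,t] 3
evaluateAll xs θ = Vec.map (evaluate xs) θ

value-drop : ∀ k f → T (isZero (take k f)) → ∀ s t → value f s t ≡ pw s k * value (drop k f) s t
value-drop zero    f       h s t = sym (ℚP.*-identityˡ _)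
value-drop (suc k) []      h s t = sym (ℚP.*-zeroʳ _)
value-drop (suc k) (c ∷ f) h s t with ∧-elim {isZero₁ c} h
... | hc , hf = trans (cong₂ (λ u v → u + s * v) (isZero₁-sound c hc t) (value-drop k f hf s t))
  (trans (ℚP.+-identityˡ _) (sym (ℚP.*-assoc s _ _)))

at-t : List (List ℤ) → ℚ → List ℚ
at-t f t = map (λ c → value₁ c t) f

ev-at-t : ∀ f t s → ev (at-t f t) s ≡ value f s t
ev-at-t []      t s = refl
ev-at-t (c ∷ f) t s = cong (λ w → value₁ c t + s * w) (ev-at-t f t s)

-- Tangency of order k is read off from the expansion in powers of s = a(x);
-- the affine chart suffices by homogeneity and continuity.

module TangentChart (a : Vec ℤ 3) (p : Fin 3) (unit : lookup a p ℤ.* lookup a p ≡ ℤ.+ 1)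
  (θ : Vec (Ex 3) 3) (D : ℕ) (hom : ∀ i → Homogeneous D (toD θ i)) (k : ℕ)
  (ok : T (isZero (take k (linear a (evaluateAll (PlaneChart.coordinates a p) θ))))) where
  private
    module C = PlaneChart a p
    α = fm a
    h = C.normal-vector unit
    αh = C.normal-unit unit
    xs = C.coordinates
    f = linear a (evaluateAll xs θ)
    F = applyDer (toD θ) α

    F-hom : Homogeneous D F
    F-hom t x = trans (eval-applyDer (toD θ) α (t ·ᵖ x)) (trans (dot-homogeneous D α (toD θ) hom t x)
      (cong (pw t D *_) (sym (eval-applyDer (toD θ) α x))))

    on-chart : ∀ x → x (C.free 1F) ≡ 1ℚ → eval F x ≡ pw (dot α x) k * value (drop k f) (dot α x) (x (C.free 0F))
    on-chart x x₁ = trans (eval-applyDer (toD θ) α x) (trans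
      (sym (value-linear a (evaluateAll xs θ) (val (toD θ) x) (dot α x) (x (C.free 0F))
        (λ i → trans (cong (λ q → value q (dot α x) (x (C.free 0F))) (VecP.lookup-map i (evaluate xs) θ))
          (value-evaluate (C.point-surjective unit x x₁) (lookup θ i)))))
      (value-drop k f ok (dot α x) (x (C.free 0F))))

    -- Suppose `j < k` factors have been split off. Through a point `x` of the line with `w ≢ 0`
    -- runs the curve `Z τ`, equal to `w` times a chart point on which the form takes the value `τ`.
    -- Comparing `F = α^j g` with the chart expansion, which starts at order `k`, and cancelling
    -- `pw τ j` shows that `g` vanishes at `τ = 0`. The points with `w = 0` follow by cancelling
    -- that coordinate.
    cofactor-vanishes : ∀ j e → j ℕ.+ suc e ≡ k → (g : Poly 3) → (∀ x → eval F x ≡ pw (dot α x) j * eval g x) →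
      ∀ x → Ker α x → eval g x ≡ 0ℚ
    cofactor-vanishes j e j+e≡k g Fg = cancel (λ {x} {y} → Ker-flat α {x} {y}) g (var (C.free 1F)) (C.point 0ℚ 0ℚ) (C.dot-point unit 0ℚ 0ℚ)
        (λ q → 1≢0 (trans (sym (C.point-free 0ℚ 0ℚ 1F)) q)) product
      where
      product : ∀ x → Ker α x → eval g x * x (C.free 1F) ≡ 0ℚ
      product x ax with x (C.free 1F) ℚ.≟ 0ℚ
      ... | yes w≡0 = trans (cong (eval g x *_) w≡0) (ℚP.*-zeroʳ _)
      ... | no  w≢0 with inv (x (C.free 1F)) w≢0
      ...   | r , rw≡1 = trans (cong (_* x (C.free 1F)) g≡0) (ℚP.*-zeroˡ _)
        where
        open ≡-Reasoning
        w = x (C.free 1F)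
        t₁ = r * x (C.free 0F)
        Y : ℚ → Pt 3
        Y τ = (r ·ᵖ x) +· τ ∙ h
        αY : ∀ τ → dot α (Y τ) ≡ τ
        αY τ = trans (dot-+· α (r ·ᵖ x) τ h) (trans (cong₂ (λ u v → u + τ * v) (trans (dot-· α r x) (trans (cong (r *_) ax) (ℚP.*-zeroʳ r))) αh)
          (solve 1 (λ t → :0 :+ t :* :1 := t) refl τ))
        Y-free : ∀ τ j → Y τ (C.free j) ≡ r * x (C.free j)
        Y-free τ j = trans (cong (λ u → r * x (C.free j) + τ * u) (C.normal-free unit j)) (solve 2 (λ u t → u :+ t :* :0 := u) refl _ τ)
        Z : ℚ → Pt 3
        Z τ = x +· τ ∙ (w ·ᵖ h)
        Z≡wY : ∀ τ i → Z τ i ≡ w * Y τ i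
        Z≡wY τ i = trans (cong (_+ τ * (w * h i)) (trans (sym (ℚP.*-identityˡ (x i))) (cong (_* x i) (sym rw≡1))))
          (solve 5 (λ r w x t h → (r :* w) :* x :+ t :* (w :* h) := w :* (r :* x :+ t :* h)) refl r w (x i) τ (h i))
        R = at-t (drop k f) t₁
        v = U.add (U.scale (pw w j) (line g x (w ·ᵖ h))) (U.scale (- pw w D) (U.mul (monomial (suc e)) R))
        spec : ∀ τ → ev v τ ≡ pw w j * eval g (Z τ) + - pw w D * (pw τ (suc e) * ev R τ)
        spec τ = trans (ev-add (U.scale (pw w j) (line g x (w ·ᵖ h))) (U.scale (- pw w D) (U.mul (monomial (suc e)) R)) τ)
          (cong₂ _+_ (trans (U.horner-scale (pw w j) (line g x (w ·ᵖ h)) tt τ) (cong (pw w j *_) (ev-line g x (w ·ᵖ h) τ)))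
            (trans (U.horner-scale (- pw w D) (U.mul (monomial (suc e)) R) tt τ) (cong (- pw w D *_)
              (trans (ev-mul (monomial (suc e)) R τ) (cong (_* ev R τ) (ev-monomial (suc e) τ))))))
        F-Z : ∀ τ → eval F (Z τ) ≡ pw w D * (pw τ k * ev R τ)
        F-Z τ = trans (eval-cong F (Z≡wY τ)) (trans (F-hom w (Y τ)) (cong (pw w D *_)
          (trans (on-chart (Y τ) (trans (Y-free τ 1F) rw≡1))
            (trans (cong₂ (λ s t → pw s k * value (drop k f) s t) (αY τ) (Y-free τ 0F))
              (cong (pw τ k *_) (sym (ev-at-t (drop k f) t₁ τ)))))))
        F-Z′ : ∀ τ → eval F (Z τ) ≡ pw w j * pw τ j * eval g (Z τ)
        F-Z′ τ = trans (Fg (Z τ)) (cong (_* eval g (Z τ)) (trans (cong (λ s → pw s j)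
          (trans (dot-cong α (Z≡wY τ)) (trans (dot-· α w (Y τ)) (cong (w *_) (αY τ))))) (pw-* w τ j)))
        v≡0 : ∀ τ → τ ≢ 0ℚ → ev v τ ≡ 0ℚ
        v≡0 τ τ≢0 = *-zero-split (pw τ j) (ev v τ) (begin
          pw τ j * ev v τ ≡⟨ cong (pw τ j *_) (spec τ) ⟩
          pw τ j * (pw w j * eval g (Z τ) + - pw w D * (pw τ (suc e) * ev R τ))
            ≡⟨ solve 6 (λ t w g d m r → t :* (w :* g :+ (:- d) :* (m :* r)) := (w :* t) :* g :- d :* ((t :* m) :* r)) refl
                 (pw τ j) (pw w j) (eval g (Z τ)) (pw w D) (pw τ (suc e)) (ev R τ) ⟩
          (pw w j * pw τ j) * eval g (Z τ) - pw w D * ((pw τ j * pw τ (suc e)) * ev R τ)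
            ≡⟨ p≡q⇒p-q≡0 (trans (sym (F-Z′ τ)) (trans (F-Z τ) (cong (λ u → pw w D * (u * ev R τ))
                 (trans (cong (pw τ) (sym j+e≡k)) (pw-+ τ j (suc e)))))) ⟩
          0ℚ ∎) (pw≢0 j τ≢0)
        g≡0 : eval g x ≡ 0ℚ
        g≡0 = *-zero-split (pw w j) (eval g x) (begin
          pw w j * eval g x
            ≡⟨ solve 4 (λ a d m r → a := a :+ (:- d) :* ((:0 :* m) :* r)) refl (pw w j * eval g x) (pw w D) (pw 0ℚ e) (ev R 0ℚ) ⟩
          pw w j * eval g x + - pw w D * (pw 0ℚ (suc e) * ev R 0ℚ)
            ≡⟨ cong (λ u → pw w j * u + - pw w D * (pw 0ℚ (suc e) * ev R 0ℚ)) (eval-cong g (λ i → solve 2 (λ x u → x := x :+ :0 :* u) refl (x i) (w * h i))) ⟩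
          pw w j * eval g (Z 0ℚ) + - pw w D * (pw 0ℚ (suc e) * ev R 0ℚ)
            ≡⟨ sym (spec 0ℚ) ⟩
          ev v 0ℚ ≡⟨ vanish-≢0 v v≡0 0ℚ ⟩
          0ℚ ∎) (pw≢0 j w≢0)

    divided : ∀ j → j ℕ.≤ k → Σ (Poly 3) λ g → ∀ x → eval F x ≡ pw (dot α x) j * eval g x
    divided zero    _   = F , λ x → sym (ℚP.*-identityˡ _)
    divided (suc j) j<k with divided j (ℕP.<⇒≤ j<k)
    ... | g , Fg = cofactor α h αh g , λ x → trans (Fg x) (trans (cong (pw (dot α x) j *_)
        (divide α h αh g (cofactor-vanishes j (k ℕ.∸ suc j) (trans (ℕP.+-suc j _) (ℕP.m+[n∸m]≡n j<k)) g Fg) x))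
      (solve 3 (λ w d g → w :* (d :* g) := (d :* w) :* g) refl (pw (dot α x) j) (dot α x) (eval (cofactor α h αh g) x)))

  tangent : Tangent α k (toD θ)
  tangent = let g , e = divided k ℕP.≤-refl in g , λ x → trans (sym (eval-applyDer (toD θ) α x)) (e x)

-- Integral arrangements

allᶠ-intro : ∀ {m} (f : Fin m → Bool) → (∀ j → T (f j)) → T (allᶠ f)
allᶠ-intro {zero}  f h = tt
allᶠ-intro {suc m} f h = pair (h fzero) (allᶠ-intro (λ j → f (fsuc j)) (λ j → h (fsuc j)))
  where
  pair : ∀ {a b} → T a → T b → T (a ∧ b)
  pair {true} _ b = b

minor : ∀ {n} → Vec ℤ n → Vec ℤ n → Fin n → Fin n → ℤ
minor a b i j = lookup a i ℤ.* lookup b j ℤ.- lookup a j ℤ.* lookup b i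

parallel : ∀ {n} → Vec ℤ n → Vec ℤ n → Bool
parallel a b = allᶠ (λ i → allᶠ (λ j → isZeroℤ (minor a b i j)))

proportional⇒parallel : ∀ {n} (a b : Vec ℤ n) → Proportional (fm a) (fm b) → T (parallel a b)
proportional⇒parallel a b (c , _ , e) = allᶠ-intro _ (λ i → allᶠ-intro _ (λ j → zero-ok (minor a b i j) (ι-injective (minor≡0 i j))))
  where
  zero-ok : ∀ z → z ≡ ℤ.+ 0 → T (isZeroℤ z)
  zero-ok _ refl = tt
  e′ : ∀ i → fm a i ≡ c * fm b i
  e′ i = trans (e i) (*-def c (fm b i))
  minor≡0 : ∀ i j → ι (minor a b i j) ≡ ι (ℤ.+ 0)
  minor≡0 i j = trans (ι-+ _ _) (trans (cong₂ _+_ (ι-* _ _) (trans (ι-neg _) (cong -_ (ι-* _ _))))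
    (trans (cong₂ (λ u v → u * fm b j - v * fm b i) (e′ i) (e′ j))
      (solve 3 (λ c x y → (c :* x) :* y :- (c :* y) :* x := :0) refl c (fm b i) (fm b j))))

distinct-ok : ∀ {m n} → (Fin m → Vec ℤ n) → Bool
distinct-ok v = allᶠ (λ k → allᶠ (λ l → isYes (k FinP.≟ l) ∨ not (parallel (v k) (v l))))

not-both : ∀ b → T b → T (not b) → ⊥
not-both true  _ ()

integral : ∀ {m n} (v : Fin m → Vec ℤ n) (p : Fin m → Fin n) → T (allᶠ (λ k → nonZeroℤ (lookup (v k) (p k)))) →
  T (distinct-ok v) → Arrangement n
integral {m} v p nz dist = record
  { n = m
  ; form = λ k → fm (v k)
  ; nonzero = λ k → p k , nonZeroℤ-sound (lookup (v k) (p k)) (allᶠ-elim (λ k → nonZeroℤ (lookup (v k) (p k))) nz k)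
  ; distinct = dis }
  where
  dis : ∀ k l → Proportional (fm (v k)) (fm (v l)) → k ≡ l
  dis k l pr with ∨-elim {isYes (k FinP.≟ l)} (allᶠ-elim (λ l → isYes (k FinP.≟ l) ∨ not (parallel (v k) (v l)))
                    (allᶠ-elim (λ k → allᶠ (λ l → isYes (k FinP.≟ l) ∨ not (parallel (v k) (v l)))) dist k) l)
  ... | inj₁ y = isYes-sound (k FinP.≟ l) y
  ... | inj₂ h = ⊥-elim (not-both (parallel (v k) (v l)) (proportional⇒parallel (v k) (v l) pr) h)

-- Chains of multiplicities

sum-allFin : ∀ {m} (f : Fin m → ℕ) → sum (map f (allFin m)) ≡ sumℕ f
sum-allFin {m} f = trans (cong sum (ListP.map-tabulate (λ i → i) f)) (go f)
  where
  go : ∀ {m} (f : Fin m → ℕ) → sum (List.tabulate f) ≡ sumℕ f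
  go {zero}  f = refl
  go {suc m} f = cong (f fzero ℕ.+_) (go (λ i → f (fsuc i)))

tight : ∀ {a b c d} → a ℕ.≤ b → c ℕ.≤ d → a ℕ.+ c ≡ b ℕ.+ d → (a ≡ b) × (c ≡ d)
tight {a} {b} {c} {d} a≤b c≤d e = a≡b , ℕP.+-cancelˡ-≡ a c d (trans e (cong (ℕ._+ d) (sym a≡b)))
  where
  a≡b : a ≡ b
  a≡b = ℕP.≤-antisym a≤b (ℕP.+-cancelʳ-≤ c b a (ℕP.≤-trans (ℕP.+-monoʳ-≤ b c≤d) (ℕP.≤-reflexive (sym e))))

sumℕ-tight : ∀ {m} (f g : Fin m → ℕ) → (∀ j → f j ℕ.≤ g j) → sumℕ f ≡ sumℕ g → ∀ j → f j ≡ g j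
sumℕ-tight f g f≤g e fzero    = proj₁ (tight (f≤g fzero) (sumℕ-mono (λ j → f≤g (fsuc j))) e)
sumℕ-tight f g f≤g e (fsuc j) = sumℕ-tight (λ j → f (fsuc j)) (λ j → g (fsuc j)) (λ j → f≤g (fsuc j))
  (proj₂ (tight (f≤g fzero) (sumℕ-mono (λ j → f≤g (fsuc j))) e)) j

sumℕ-step : ∀ {m} (f g : Fin m → ℕ) k → (∀ j → f j ℕ.≤ g j) → f k ℕ.< g k → suc (sumℕ f) ≡ sumℕ g →
  (suc (f k) ≡ g k) × (∀ j → j ≢ k → f j ≡ g j)
sumℕ-step f g fzero f≤g f<g e = proj₁ t , λ { fzero 0≢0 → ⊥-elim (0≢0 refl)
    ; (fsuc j) _ → sumℕ-tight (λ j → f (fsuc j)) (λ j → g (fsuc j)) (λ j → f≤g (fsuc j)) (proj₂ t) j }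
  where t = tight f<g (sumℕ-mono (λ j → f≤g (fsuc j))) e
sumℕ-step f g (fsuc k) f≤g f<g e = proj₁ IH , λ { fzero _ → proj₁ t ; (fsuc j) ne → proj₂ IH j (λ q → ne (cong fsuc q)) }
  where
  strict : ∀ {m} (f g : Fin m → ℕ) k → (∀ j → f j ℕ.≤ g j) → f k ℕ.< g k → suc (sumℕ f) ℕ.≤ sumℕ g
  strict f g fzero    f≤g f<g = ℕP.+-mono-≤ f<g (sumℕ-mono (λ j → f≤g (fsuc j)))
  strict f g (fsuc k) f≤g f<g = ℕP.≤-trans (ℕP.≤-reflexive (sym (ℕP.+-suc (f fzero) _)))
    (ℕP.+-mono-≤ (f≤g fzero) (strict (λ j → f (fsuc j)) (λ j → g (fsuc j)) k (λ j → f≤g (fsuc j)) f<g))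
  t = tight (f≤g fzero) (strict (λ j → f (fsuc j)) (λ j → g (fsuc j)) k (λ j → f≤g (fsuc j)) f<g) (trans (ℕP.+-suc (f fzero) _) e)
  IH = sumℕ-step (λ j → f (fsuc j)) (λ j → g (fsuc j)) k (λ j → f≤g (fsuc j)) f<g (proj₂ t)

-- If no multiplicity obtained from 1 ≤ μ ≤ κ by deleting a hyperplane is free,
-- a chain descending from κ stays above 1 and never reaches 0.
not-additively-free : ∀ {ℓ} (B : Arrangement ℓ) (κ : Multiplicity B) → (∀ k → 1 ℕ.≤ κ k) → (k₀ : Fin (n B)) →
  (∀ (μ μ′ : Multiplicity B) k → (∀ l → 1 ℕ.≤ μ l) → (∀ l → μ l ℕ.≤ κ l) → μ k ≡ 1 → μ′ k ≡ 0 → (∀ l → l ≢ k → μ′ l ≡ μ l) → ¬ Free B μ′) →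
  ¬ AdditivelyFree B κ
not-additively-free B κ 1≤κ k₀ del (c , free , mono , last) = absurd (proj₁ (above ∣κ∣ 0 (ℕP.+-identityʳ ∣κ∣)) k₀)
  where
  ∣κ∣ = ∣_∣ {A = B} κ
  Above : ℕ → Set
  Above i = (∀ k → 1 ℕ.≤ c i k) × (∀ k → c i k ℕ.≤ κ k)
  size : ∀ i → i ℕ.≤ ∣κ∣ → sumℕ (c i) ≡ i
  size i i≤ = trans (sym (sum-allFin (c i))) (proj₁ (free i i≤))
  below : ∀ i → i ℕ.< ∣κ∣ → Above (suc i) → Above i
  below i i< (1≤ , ≤κ) = positive , λ k → ℕP.≤-trans (mono i i< k) (≤κ k)
    where
    positive : ∀ k → 1 ℕ.≤ c i k
    positive k with c i k in eq
    ... | suc _ = ℕ.s≤s ℕ.z≤n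
    -- The sizes of `c i` and `c (suc i)` differ by one, and this whole difference occurs at `k`. So
    -- `c (suc i) k` is 1 and all other entries agree: the deletion excluded by `del`.
    ... | zero  = ⊥-elim (del (c (suc i)) (c i) k 1≤ ≤κ (trans (sym (proj₁ st)) (cong suc eq)) eq (proj₂ st) (proj₂ (free i (ℕP.<⇒≤ i<))))
      where
      st = sumℕ-step (c i) (c (suc i)) k (mono i i<) (subst (ℕ._< c (suc i) k) (sym eq) (1≤ k))
        (trans (cong suc (size i (ℕP.<⇒≤ i<))) (sym (size (suc i) i<)))
  above : ∀ d i → d ℕ.+ i ≡ ∣κ∣ → Above i
  above zero    i refl = (λ k → subst (1 ℕ.≤_) (sym (last k)) (1≤κ k)) , (λ k → ℕP.≤-reflexive (last k))
  above (suc d) i e    = below i (ℕP.≤-trans (ℕP.m≤n+m (suc i) d) (ℕP.≤-reflexive (trans (ℕP.+-suc d i) e)))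
    (above d (suc i) (trans (ℕP.+-suc d i) e))
  absurd : ¬ (1 ℕ.≤ c 0 k₀)
  absurd h = ℕP.<⇒≢ (ℕP.≤-trans h (le (c 0) k₀)) (sym (size 0 ℕ.z≤n))
    where
    le : ∀ {m} (f : Fin m → ℕ) k → f k ℕ.≤ sumℕ f
    le f fzero    = ℕP.m≤m+n _ _
    le f (fsuc k) = ℕP.≤-trans (le (λ j → f (fsuc j)) k) (ℕP.m≤n+m _ (f fzero))

-- Integral certificates for the rank three setting

crossℤ : Fin 3 → (Fin 3 → ℤ) → (Fin 3 → ℤ) → ℤ
crossℤ 0F u v = u 1F ℤ.* v 2F ℤ.- u 2F ℤ.* v 1F
crossℤ 1F u v = u 2F ℤ.* v 0F ℤ.- u 0F ℤ.* v 2F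
crossℤ 2F u v = u 0F ℤ.* v 1F ℤ.- u 1F ℤ.* v 0F

minus-ι : ∀ a b c d → ι (a ℤ.* b ℤ.- c ℤ.* d) ≡ ι a * ι b - ι c * ι d
minus-ι a b c d = trans (ι-+ _ _) (cong₂ _+_ (ι-* a b) (trans (ι-neg _) (cong -_ (ι-* c d))))

cross-ι : ∀ i u v → ι (crossℤ i u v) ≡ cross i (λ j → ι (u j)) (λ j → ι (v j))
cross-ι 0F u v = minus-ι _ _ _ _
cross-ι 1F u v = minus-ι _ _ _ _
cross-ι 2F u v = minus-ι _ _ _ _

cross-cong : ∀ i {u u′ v v′ : Pt 3} → (∀ j → u j ≡ u′ j) → (∀ j → v j ≡ v′ j) → cross i u v ≡ cross i u′ v′
cross-cong 0F eu ev = cong₂ _-_ (cong₂ _*_ (eu 1F) (ev 2F)) (cong₂ _*_ (eu 2F) (ev 1F))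
cross-cong 1F eu ev = cong₂ _-_ (cong₂ _*_ (eu 2F) (ev 0F)) (cong₂ _*_ (eu 0F) (ev 2F))
cross-cong 2F eu ev = cong₂ _-_ (cong₂ _*_ (eu 0F) (ev 1F)) (cong₂ _*_ (eu 1F) (ev 0F))

detℤ : (u v w : Fin 3 → ℤ) → ℤ
detℤ u v w = u 0F ℤ.* crossℤ 0F v w ℤ.+ (u 1F ℤ.* crossℤ 1F v w ℤ.+ u 2F ℤ.* crossℤ 2F v w)

det-ι : ∀ u v w → ι (detℤ u v w) ≡ det (λ j → ι (u j)) (λ j → ι (v j)) (λ j → ι (w j))
det-ι u v w = trans (ι-+ _ _) (cong₂ _+_ (term 0F) (trans (ι-+ _ _) (cong₂ _+_ (term 1F) (term 2F))))
  where
  term : ∀ i → ι (u i ℤ.* crossℤ i v w) ≡ ι (u i) * cross i (λ j → ι (v j)) (λ j → ι (w j))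
  term i = trans (ι-* _ _) (cong (ι (u i) *_) (cross-ι i v w))

-- In the plane chart `s` is the value of the normal form, so `s = 0` selects a point of the line
-- itself.
at-point : Vec ℤ[s,t] 3 → ℤ → Fin 3 → ℤ
at-point v t i = at₂ (lookup v i) (ℤ.+ 0) t

value-at : ∀ xs (θ : Vec (Ex 3) 3) (u : Pt 3) t → (∀ i → value (lookup xs i) 0ℚ (ι t) ≡ u i) →
  ∀ i → ι (at-point (evaluateAll xs θ) t i) ≡ val (toD θ) u i
value-at xs θ u t e i = trans (sym (at₂-sound (lookup (evaluateAll xs θ) i) (ℤ.+ 0) t))
  (trans (cong (λ q → value q 0ℚ (ι t)) (VecP.lookup-map i (evaluate xs) θ)) (value-evaluate e (lookup θ i)))

-- A tangent derivation at a point of the line gives a vector of the same plane as the point, so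
-- their cross product is a multiple of the normal. With `c` the pivot, where the normal is 1 or -1,
-- a single component determines it.
wedge : Fin 3 → Vec ℤ[s,t] 3 → Vec ℤ[s,t] 3 → ℤ → ℤ
wedge c xs v t = crossℤ c (at-point xs t) (at-point v t)

wedges : ℤ → ℤ → Fin 3 → Vec ℤ[s,t] 3 → Vec ℤ[s,t] 3 → Vec ℤ[s,t] 3 → ℤ
wedges t₁ t₂ c xs v₂ v₃ = wedge c xs v₂ t₁ ℤ.* wedge c xs v₃ t₂ ℤ.- wedge c xs v₃ t₁ ℤ.* wedge c xs v₂ t₂

-- Integral data from which a Setting is obtained by computation
record Certificate (m : ℕ) : Set where
  field
    normalOf  : Fin m → Vec ℤ 3
    pivotOf   : Fin m → Fin 3
    mult      : Fin m → ℕ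
    deg       : ℕ
    η₂ η₃     : Vec (Ex 3) 3
    p₀        : Vec ℤ 3
    -- the points of a line at which the derivations are evaluated
    t₁ t₂     : ℤ

module Check {m} (𝒞 : Certificate m) where
  open Certificate 𝒞

  coords : Fin m → Vec ℤ[s,t] 3
  coords k = PlaneChart.coordinates (normalOf k) (pivotOf k)

  generic-ok : Fin m → Vec ℤ[s,t] 3 → Fin m → Bool
  generic-ok k xs l = isYes (l FinP.≟ k) ∨ nonZeroℤ (at₂ (linear (normalOf l) xs) (ℤ.+ 0) t₁)

  -- The expansions `v₂` and `v₃` are arguments, so that the tangency test and the test of the
  -- wedges can share them.
  values-ok : Fin m → Vec ℤ[s,t] 3 → Vec ℤ[s,t] 3 → Vec ℤ[s,t] 3 → Bool
  values-ok k xs v₂ v₃ =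
      isZero (take (mult k) (linear (normalOf k) v₂))
    ∧ isZero (take (mult k) (linear (normalOf k) v₃))
    ∧ allᶠ (generic-ok k xs)
    ∧ nonZeroℤ (wedges t₁ t₂ (pivotOf k) xs v₂ v₃)

  unit? : ∀ k → Dec (lookup (normalOf k) (pivotOf k) ℤ.* lookup (normalOf k) (pivotOf k) ≡ ℤ.+ 1)
  unit? k = _ ℤ.≟ _

  line-ok : Fin m → Bool
  line-ok k = isYes (unit? k) ∧ values-ok k (coords k) (evaluateAll (coords k) η₂) (evaluateAll (coords k) η₃)

  constants : Vec ℤ[s,t] 3
  constants = Vec.map constant p₀

  detAt : ℤ
  detAt = detℤ (lookup p₀) (at-point (evaluateAll constants η₂) (ℤ.+ 0)) (at-point (evaluateAll constants η₃) (ℤ.+ 0))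

  component-ok : Ex 3 → Bool
  component-ok e = isHomogeneous e ∧ (degree e ≡ᵇ deg)

  homogeneous-ok : Vec (Ex 3) 3 → Bool
  homogeneous-ok θ = allᶠ (λ i → component-ok (lookup θ i))

  record Valid : Set where
    field
      lines-ok  : T (allᶠ line-ok)
      det-ok    : T (nonZeroℤ detAt)
      hom₂-ok   : T (homogeneous-ok η₂)
      hom₃-ok   : T (homogeneous-ok η₃)
      mult-ok   : T (allᶠ (λ k → 1 ≤ᵇ mult k))
      size-ok   : suc (deg ℕ.+ deg) ≡ m
      excess-ok : T (suc (sumℕ (λ k → mult k ℕ.∸ 1)) ≤ᵇ deg)

module Certified {m} (𝒞 : Certificate m) (valid : Check.Valid 𝒞) where
  open Certificate 𝒞
  open Check 𝒞
  open Valid valid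

  toD-homogeneous : ∀ θ → T (homogeneous-ok θ) → ∀ i → Homogeneous deg (toD θ i)
  toD-homogeneous θ ok i t x =
    let h , d = ∧-elim {isHomogeneous (lookup θ i)} (allᶠ-elim (λ i → component-ok (lookup θ i)) ok i) in
    trans (homogeneous (lookup θ i) h t x) (cong (λ e → pw t e * eval (toD θ i) x) (ℕP.≡ᵇ⇒≡ (degree (lookup θ i)) deg d))

  module Line (k : Fin m) where
    private
      module C = PlaneChart (normalOf k) (pivotOf k)
      xs = coords k
      v₂ = evaluateAll xs η₂
      v₃ = evaluateAll xs η₃
      ok = ∧-elim {isYes (unit? k)} (allᶠ-elim line-ok lines-ok k)
      ok₂ = ∧-elim {isZero (take (mult k) (linear (normalOf k) v₂))} (proj₂ ok)
      ok₃ = ∧-elim {isZero (take (mult k) (linear (normalOf k) v₃))} (proj₂ ok₂)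
      ok₄ = ∧-elim {allᶠ (generic-ok k xs)} (proj₂ ok₃)

    unit : lookup (normalOf k) (pivotOf k) ℤ.* lookup (normalOf k) (pivotOf k) ≡ ℤ.+ 1
    unit = isYes-sound (unit? k) (proj₁ ok)

    tangent₂ : Tangent (fm (normalOf k)) (mult k) (toD η₂)
    tangent₂ = TangentChart.tangent (normalOf k) (pivotOf k) unit η₂ deg (toD-homogeneous η₂ hom₂-ok) (mult k) (proj₁ ok₂)

    tangent₃ : Tangent (fm (normalOf k)) (mult k) (toD η₃)
    tangent₃ = TangentChart.tangent (normalOf k) (pivotOf k) unit η₃ deg (toD-homogeneous η₃ hom₃-ok) (mult k) (proj₁ ok₃)

    pt : ℤ → Pt 3
    pt t = C.point 0ℚ (ι t)

    pt∈Ker : ∀ t → Ker (fm (normalOf k)) (pt t)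
    pt∈Ker t = C.dot-point unit 0ℚ (ι t)

    pt-generic : ∀ l → l ≢ k → dot (fm (normalOf l)) (pt t₁) ≢ 0ℚ
    pt-generic l l≢k e with ∨-elim {isYes (l FinP.≟ k)} (allᶠ-elim (generic-ok k xs) (proj₁ ok₄) l)
    ... | inj₁ y = l≢k (isYes-sound (l FinP.≟ k) y)
    ... | inj₂ h = nonZeroℤ-sound (at₂ (linear (normalOf l) xs) (ℤ.+ 0) t₁) h
      (trans (sym (at₂-sound (linear (normalOf l) xs) (ℤ.+ 0) t₁)) (trans (value-linear (normalOf l) xs (pt t₁) 0ℚ (ι t₁) (λ i → refl)) e))

    freeCoordinate : Fin 3
    freeCoordinate = C.free 1F

    pt-coordinate : pt t₁ freeCoordinate ≢ 0ℚ
    pt-coordinate e = 1≢0 (trans (sym (C.point-free 0ℚ (ι t₁) 1F)) e)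

    ω : Vec (Ex 3) 3 → ℤ → ℚ
    ω θ t = cross (pivotOf k) (pt t) (val (toD θ) (pt t))

    wedge-ι : ∀ θ t → ι (wedge (pivotOf k) xs (evaluateAll xs θ) t) ≡ ω θ t
    wedge-ι θ t = trans (cross-ι (pivotOf k) (at-point xs t) (at-point (evaluateAll xs θ) t))
      (cross-cong (pivotOf k) (λ i → sym (at₂-sound (lookup xs i) (ℤ.+ 0) t)) (value-at xs θ (pt t) t (λ i → refl)))

    ω≢0 : ω η₂ t₁ * ω η₃ t₂ - ω η₃ t₁ * ω η₂ t₂ ≢ 0ℚ
    ω≢0 e = nonZeroℤ-sound (wedges t₁ t₂ (pivotOf k) xs v₂ v₃) (proj₂ ok₄)
      (trans (minus-ι (wedge (pivotOf k) xs v₂ t₁) (wedge (pivotOf k) xs v₃ t₂) (wedge (pivotOf k) xs v₃ t₁) (wedge (pivotOf k) xs v₂ t₂))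
        (trans (cong₂ _-_ (cong₂ _*_ (wedge-ι η₂ t₁) (wedge-ι η₃ t₂)) (cong₂ _*_ (wedge-ι η₃ t₁) (wedge-ι η₂ t₂))) e))

  setting : Setting m
  setting = record
    { b = λ k → fm (normalOf k)
    ; h = λ k → PlaneChart.normal-vector (normalOf k) (pivotOf k) (Line.unit k)
    ; bh = λ k → PlaneChart.normal-unit (normalOf k) (pivotOf k) (Line.unit k)
    ; κ = mult
    ; 1≤κ = λ k → ℕP.≤ᵇ⇒≤ 1 (mult k) (allᶠ-elim (λ k → 1 ≤ᵇ mult k) mult-ok k)
    ; D = deg
    ; size = size-ok
    ; excess = ℕP.≤ᵇ⇒≤ (suc (sumℕ (λ k → mult k ℕ.∸ 1))) deg excess-ok
    ; θ₂ = toD η₂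
    ; θ₃ = toD η₃
    ; hom₂ = toD-homogeneous η₂ hom₂-ok
    ; hom₃ = toD-homogeneous η₃ hom₃-ok
    ; tan₂ = Line.tangent₂
    ; tan₃ = Line.tangent₃
    ; p = λ k → Line.pt k t₁
    ; p∈ = λ k → Line.pt∈Ker k t₁
    ; generic = Line.pt-generic
    ; z = Line.freeCoordinate
    ; pz≢0 = Line.pt-coordinate
    ; q = λ k → Line.pt k t₂
    ; q∈ = λ k → Line.pt∈Ker k t₂
    ; c = pivotOf
    ; ω≢0 = Line.ω≢0
    ; p₀ = fm p₀
    ; Δp₀≢0 = λ e → nonZeroℤ-sound detAt det-ok
        (trans (det-ι (lookup p₀) (at-point (evaluateAll constants η₂) (ℤ.+ 0)) (at-point (evaluateAll constants η₃) (ℤ.+ 0)))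
          (trans (det-cong {u = fm p₀} (λ _ → refl) (at-p₀ η₂) (at-p₀ η₃)) e)) }
    where
    at-p₀ : ∀ θ i → ι (at-point (evaluateAll constants θ) (ℤ.+ 0) i) ≡ val (toD θ) (fm p₀) i
    at-p₀ θ = value-at constants θ (fm p₀) (ℤ.+ 0) (λ i →
      trans (cong (λ q → value q 0ℚ 0ℚ) (VecP.lookup-map i constant p₀)) (value-constant (lookup p₀ i) 0ℚ 0ℚ))

-- The chain of subarrangements given by a list of steps

steps-ok-drop : ∀ m L → T (steps-ok L) → T (steps-ok (drop m L))
steps-ok-drop zero    L       h = h
steps-ok-drop (suc m) []      h = h
steps-ok-drop (suc m) (s ∷ L) h = steps-ok-drop m L (proj₂ (∧-elim {step-ok s L} h))

module _ {X Y : Set} (F : X → Y) {P : Y → Set} where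
  suffix→ : ∀ L m → All P (map F (drop m L)) → ∀ k → m ℕ.≤ toℕ k → P (F (List.lookup L k))
  suffix→ (x ∷ L) zero    (p ∷ ps) fzero    _         = p
  suffix→ (x ∷ L) zero    (p ∷ ps) (fsuc k) _         = suffix→ L zero ps k ℕ.z≤n
  suffix→ (x ∷ L) (suc m) ps       (fsuc k) (ℕ.s≤s h) = suffix→ L m ps k h

  suffix← : ∀ L m → (∀ k → m ℕ.≤ toℕ k → P (F (List.lookup L k))) → All P (map F (drop m L))
  suffix← []      zero    h = []
  suffix← []      (suc m) h = []
  suffix← (x ∷ L) zero    h = h fzero ℕ.z≤n ∷ suffix← L zero (λ k _ → h (fsuc k) ℕ.z≤n)
  suffix← (x ∷ L) (suc m) h = suffix← L m (λ k m≤k → h (fsuc k) (ℕ.s≤s m≤k))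

indicator : Bool → ℕ
indicator β = if β then 1 else 0

tangent-indicator : ∀ {n} (a : Form n) h → dot a h ≡ 1ℚ → ∀ φ β → (T β → VanishesOn a φ) → Tangent a (indicator β) φ
tangent-indicator a h ah φ false van = applyDer φ a , λ x → trans (sym (eval-applyDer φ a x)) (sym (ℚP.*-identityˡ _))
tangent-indicator a h ah φ true  van = cofactor a h ah (applyDer φ a) , λ x → trans (sym (eval-applyDer φ a x))
  (trans (divide a h ah (applyDer φ a) (λ y ay → trans (eval-applyDer φ a y) (van tt y ay)) x)
    (cong (_* eval (cofactor a h ah (applyDer φ a)) x) (sym (ℚP.*-identityʳ _))))

indicator-tangent : ∀ {n} (a : Form n) φ β → Tangent a (indicator β) φ → T β → VanishesOn a φ
indicator-tangent a φ true t _ = tangent⇒vanishes a φ ℕP.≤-refl t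

sumℕ-cong : ∀ {m} {f g : Fin m → ℕ} → (∀ j → f j ≡ g j) → sumℕ f ≡ sumℕ g
sumℕ-cong {zero}  e = refl
sumℕ-cong {suc m} e = cong₂ ℕ._+_ (e fzero) (sumℕ-cong (λ j → e (fsuc j)))

count : ∀ N m → sumℕ {N} (λ k → indicator (m ≤ᵇ toℕ k)) ≡ N ℕ.∸ m
count zero    m       = sym (ℕP.0∸n≡0 m)
count (suc N) zero    = cong suc (count N zero)
count (suc N) (suc m) = trans (sumℕ-cong {N} (λ k → cong indicator (shift m (toℕ k)))) (count N m)
  where
  shift : ∀ m k → (suc m ≤ᵇ suc k) ≡ (m ≤ᵇ k)
  shift zero    k = refl
  shift (suc m) k = refl

module Chain (L : List Step) (ok : T (steps-ok L))
  (nz : T (allᶠ (λ k → nonZeroℤ (lookup (normal (List.lookup L k)) (pivot (List.lookup L k))))))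
  (dist : T (distinct-ok (λ k → normal (List.lookup L k)))) where

  arrangement : Arrangement 4
  arrangement = integral (λ k → normal (List.lookup L k)) (λ k → pivot (List.lookup L k)) nz dist

  private
    N = length L
    A = arrangement

  -- Steps are consed on, so the hyperplanes stand in reverse order of their addition and the
  -- partial arrangements are the suffixes of the list. A suffix is encoded by multiplicities 0 and
  -- 1 on the full arrangement, as `AdditivelyFree` requires.
  lastSteps : ℕ → Multiplicity A
  lastSteps i k = indicator ((N ℕ.∸ i) ≤ᵇ toℕ k)

  lastSteps-free : ∀ i → Free A (lastSteps i)
  lastSteps-free i = Free⇐ A (lastSteps i) (Basis-⇔ (λ {φ} → to {φ}) (λ {φ} → from {φ}) (proj₁ (steps-basis (drop m L) (steps-ok-drop m L ok))))
    where
    m = N ℕ.∸ i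
    to : ∀ {φ} → VanishesOnAll (normals (drop m L)) φ → TangentAll A (lastSteps i) φ
    to {φ} vs k = let i₀ , a≢0 = nonzero A k ; h , ah = unit-point (form A k) i₀ a≢0 in
      tangent-indicator (form A k) h ah φ (m ≤ᵇ toℕ k) (λ t → suffix→ (λ s → fm (normal s)) L m vs k (ℕP.≤ᵇ⇒≤ m (toℕ k) t))
    from : ∀ {φ} → TangentAll A (lastSteps i) φ → VanishesOnAll (normals (drop m L)) φ
    from {φ} ts = suffix← (λ s → fm (normal s)) L m
      (λ k m≤k → indicator-tangent (form A k) φ (m ≤ᵇ toℕ k) (ts k) (ℕP.≤⇒≤ᵇ m≤k))

  lastSteps-size : ∀ i → i ℕ.≤ N → ∣_∣ {A = A} (lastSteps i) ≡ i
  lastSteps-size i i≤N = trans (sum-allFin (lastSteps i)) (trans (count N (N ℕ.∸ i)) (ℕP.m∸[m∸n]≡n i≤N))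

  additivelyFree : AdditivelyFreeArr A
  additivelyFree = lastSteps
    , (λ i i≤ → let i≤N = ℕP.≤-trans i≤ (ℕP.≤-reflexive total) in lastSteps-size i i≤N , lastSteps-free i)
    , (λ i _ k → mono ((N ℕ.∸ i) ≤ᵇ toℕ k) ((N ℕ.∸ suc i) ≤ᵇ toℕ k)
        (λ t → ℕP.≤⇒≤ᵇ (ℕP.≤-trans (ℕP.∸-monoʳ-≤ N (ℕP.n≤1+n i)) (ℕP.≤ᵇ⇒≤ (N ℕ.∸ i) (toℕ k) t))))
    , (λ k → trans (cong (λ i → lastSteps i k) total) (cong (λ m → indicator (m ≤ᵇ toℕ k)) (ℕP.n∸n≡0 N)))
    where
    total : ∣_∣ {A = A} (λ _ → 1) ≡ N
    total = trans (sum-allFin {N} (λ _ → 1)) (count N 0)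
    mono : ∀ β γ → (T β → T γ) → indicator β ℕ.≤ indicator γ
    mono false γ     h = ℕ.z≤n
    mono true  true  h = ℕP.≤-refl
    mono true  false h = ⊥-elim (h tt)

-- The Ziegler restriction of an integral arrangement

module Restriction {M m : ℕ} (a : Fin (suc M) → Vec ℤ 4) (b : Fin m → Vec ℤ 3)
  (target : Fin (suc M) → Fin m) (factor : Fin (suc M) → ℤ) (section : Fin m → Fin (suc M)) where

  -- Literally the count in `κ-count`, so that this condition holds by `refl`.
  multiplicity : Fin m → ℕ
  multiplicity y = length (filter (λ k → ¬? (k FinP.≟ fzero) ×-dec (target k FinP.≟ y)) (allFin (suc M)))

  last : Fin 4
  last = Fin.fromℕ 3

  restrictℤ : Vec ℤ 4 → Vec ℤ 4 → Fin 3 → ℤ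
  restrictℤ a b i = lookup a last ℤ.* lookup b (Fin.punchIn last i) ℤ.- lookup b last ℤ.* lookup a (Fin.punchIn last i)

  restrict-ι : ∀ a b i → restrictForm (fm a) last (fm b) i ≡ ι (restrictℤ a b i)
  restrict-ι a b i = sym (trans (minus-ι (lookup a last) (lookup b j) (lookup b last) (lookup a j))
    (sym (trans (+-def (fm a last ℚ.* fm b j) (ℚ.- (fm b last ℚ.* fm a j)))
      (cong₂ _+_ (*-def (fm a last) (fm b j)) (trans (neg-def (fm b last ℚ.* fm a j)) (cong -_ (*-def (fm b last) (fm a j))))))))
    where j = Fin.punchIn last i

  proportional? : ∀ k i → Dec (restrictℤ (a fzero) (a k) i ≡ factor k ℤ.* lookup (b (target k)) i)
  proportional? k i = _ ℤ.≟ _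

  restriction-ok : Fin (suc M) → Bool
  restriction-ok k = isYes (k FinP.≟ fzero) ∨ (nonZeroℤ (factor k) ∧ allᶠ (λ i → isYes (proportional? k i)))

  section-ok : Fin m → Bool
  section-ok y = not (isYes (section y FinP.≟ fzero)) ∧ isYes (target (section y) FinP.≟ y)

  module _ (r-ok : T (allᶠ restriction-ok)) (s-ok : T (allᶠ section-ok)) where
    restricts : ∀ k → k ≢ fzero → Proportional (restrictForm (fm (a fzero)) last (fm (a k))) (fm (b (target k)))
    restricts k k≢0 with ∨-elim {isYes (k FinP.≟ fzero)} (allᶠ-elim restriction-ok r-ok k)
    ... | inj₁ e = ⊥-elim (k≢0 (isYes-sound (k FinP.≟ fzero) e))
    ... | inj₂ h = let c≢0 , es = ∧-elim {nonZeroℤ (factor k)} h in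
      ι (factor k) , nonZeroℤ-sound (factor k) c≢0 , λ i →
        trans (restrict-ι (a fzero) (a k) i)
          (trans (cong ι (isYes-sound (proportional? k i) (allᶠ-elim (λ i → isYes (proportional? k i)) es i)))
            (trans (ι-* (factor k) (lookup (b (target k)) i)) (sym (*-def _ _))))

    onto : ∀ y → ∃ λ k → (k ≢ fzero) × (target k ≡ y)
    onto y = let nz , e = ∧-elim {not (isYes (section y FinP.≟ fzero))} (allᶠ-elim section-ok s-ok y) in
      section y , ne (section y FinP.≟ fzero) nz , isYes-sound (target (section y) FinP.≟ y) e
      where
      ne : ∀ {k l : Fin (suc M)} (d : Dec (k ≡ l)) → T (not (isYes d)) → k ≢ l
      ne (no k≢l) _ = k≢l

module Literals where
  import Data.Nat.Literals as ℕL
  import Data.Integer.Literals as ℤL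
  open import Agda.Builtin.FromNat public
  open import Agda.Builtin.FromNeg public
  instance
    ℕ-number = ℕL.number
    ℤ-number = ℤL.number
    ℤ-negative = ℤL.negative

open Literals

-- The arrangement A in order of addition

0̂ x₀ x₁ x₂ x₃ : Ex 4
0̂  = K 0
x₀ = X (# 0)
x₁ = X (# 1)
x₂ = X (# 2)
x₃ = X (# 3)

-- To be read from the end: the head is the hyperplane added last, which is also the one restricted
-- to. The rows 0, 1, 2, 3 serve as pivot 1, 11, 11, 11 times, which gives the degrees of the final
-- basis. After seven additions row 0 is the Euler derivation; being tangent to every hyperplane, it
-- has coefficient 0 in all later steps.
steps : List Step
steps =
  step (0 ∷ 0 ∷ 1 ∷ 1 ∷ []) (# 3) (# 3) (1 ∷ 3 ∷ 3 ∷ 1 ∷ [])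
    (0̂ ∷ (K 11595 ⋆ x₀ ⊹ K 41990 ⋆ x₁ ⊹ K 21266 ⋆ x₂) ∷ (K -3 ⋆ x₀ ⊹ x₂) ∷ 0̂ ∷ []) ∷
  step (1 ∷ 0 ∷ 2 ∷ 1 ∷ []) (# 3) (# 2) (1 ∷ 204 ∷ 1 ∷ 68 ∷ [])
    (0̂ ∷ (K 2573 ⋆ x₀ ⊹ K 11186 ⋆ x₁ ⊹ K 3462 ⋆ x₂) ∷ 0̂ ∷ (K 1) ∷ []) ∷
  step (1 ∷ 1 ∷ -1 ∷ 0 ∷ []) (# 2) (# 3) (1 ∷ 372 ∷ 1116 ∷ 1 ∷ [])
    (0̂ ∷ (K -2108 ⋆ x₀ ⋆ x₀ ⊹ K -6052 ⋆ x₀ ⋆ x₁ ⊹ K -1054 ⋆ x₀ ⋆ x₃ ⊹ K -3026 ⋆ x₁ ⋆ x₁ ⊹ K -527 ⋆ x₁ ⋆ x₃) ∷ (K -68 ⋆ x₀ ⊹ K -34 ⋆ x₁ ⊹ K -31 ⋆ x₃) ∷ 0̂ ∷ []) ∷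
  step (0 ∷ 0 ∷ 0 ∷ 1 ∷ []) (# 3) (# 2) (1 ∷ 153 ∷ 1 ∷ 51 ∷ [])
    (0̂ ∷ (K -19 ⋆ x₀ ⋆ x₀ ⊹ K -19 ⋆ x₀ ⋆ x₁ ⊹ K 38 ⋆ x₀ ⋆ x₂ ⊹ K 19 ⋆ x₁ ⋆ x₂ ⊹ K -19 ⋆ x₂ ⋆ x₂) ∷ 0̂ ∷ (K 19) ∷ []) ∷
  step (1 ∷ 0 ∷ -1 ∷ 0 ∷ []) (# 2) (# 1) (1 ∷ 1 ∷ 1 ∷ 1 ∷ [])
    (0̂ ∷ 0̂ ∷ 0̂ ∷ 0̂ ∷ []) ∷
  step (1 ∷ 1 ∷ -1 ∷ 1 ∷ []) (# 3) (# 1) (1 ∷ 1 ∷ 124 ∷ 248 ∷ [])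
    (0̂ ∷ 0̂ ∷ (K -5) ∷ (K 3) ∷ []) ∷
  step (1 ∷ 1 ∷ 2 ∷ 1 ∷ []) (# 3) (# 3) (1 ∷ 1 ∷ 1 ∷ 1 ∷ [])
    (0̂ ∷ (K 30 ⋆ x₀ ⊹ K 24 ⋆ x₁ ⊹ K -260 ⋆ x₂) ∷ (K 4 ⋆ x₂) ∷ 0̂ ∷ []) ∷
  step (1 ∷ 0 ∷ 2 ∷ 0 ∷ []) (# 0) (# 3) (1 ∷ 3 ∷ 3 ∷ 1 ∷ [])
    (0̂ ∷ (K -78 ⋆ x₁ ⋆ x₁ ⊹ K -256 ⋆ x₁ ⋆ x₂ ⊹ K -17 ⋆ x₁ ⋆ x₃ ⊹ K 224 ⋆ x₂ ⋆ x₂ ⊹ K -94 ⋆ x₂ ⋆ x₃ ⊹ K 14 ⋆ x₃ ⋆ x₃) ∷ (K 2 ⋆ x₁ ⋆ x₂ ⊹ K -2 ⋆ x₁ ⋆ x₃ ⊹ K 2 ⋆ x₂ ⋆ x₂ ⊹ K 2 ⋆ x₂ ⋆ x₃ ⊹ K -1 ⋆ x₃ ⋆ x₃) ∷ 0̂ ∷ []) ∷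
  step (2 ∷ 0 ∷ 2 ∷ 1 ∷ []) (# 3) (# 2) (1 ∷ 2 ∷ 1 ∷ 1 ∷ [])
    (0̂ ∷ (K 34 ⋆ x₀ ⊹ K -37 ⋆ x₁ ⊹ K 44 ⋆ x₂) ∷ 0̂ ∷ 0̂ ∷ []) ∷
  step (2 ∷ 2 ∷ 2 ∷ 1 ∷ []) (# 3) (# 2) (1 ∷ 7 ∷ 1 ∷ 7 ∷ [])
    (0̂ ∷ (K -7 ⋆ x₀ ⋆ x₀ ⊹ K 21 ⋆ x₀ ⋆ x₁ ⊹ K -38 ⋆ x₀ ⋆ x₂ ⊹ K 2 ⋆ x₁ ⋆ x₁ ⊹ K -30 ⋆ x₁ ⋆ x₂ ⊹ K -5 ⋆ x₂ ⋆ x₂) ∷ 0̂ ∷ (K 2) ∷ []) ∷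
  step (2 ∷ 0 ∷ 0 ∷ 1 ∷ []) (# 3) (# 3) (1 ∷ 1 ∷ 1 ∷ 1 ∷ [])
    (0̂ ∷ (K -19 ⋆ x₀ ⋆ x₀ ⋆ x₁ ⊹ K 12 ⋆ x₀ ⋆ x₀ ⋆ x₂ ⊹ K -1 ⋆ x₀ ⋆ x₁ ⋆ x₁ ⊹ K 48 ⋆ x₀ ⋆ x₁ ⋆ x₂ ⊹ K -25 ⋆ x₀ ⋆ x₂ ⋆ x₂ ⊹ K 7 ⋆ x₁ ⋆ x₁ ⋆ x₁ ⊹ K -29 ⋆ x₁ ⋆ x₁ ⋆ x₂ ⊹ K -2 ⋆ x₁ ⋆ x₂ ⋆ x₂ ⊹ K 3 ⋆ x₂ ⋆ x₂ ⋆ x₂) ∷ (K -13 ⋆ x₀ ⊹ K 3 ⋆ x₂) ∷ 0̂ ∷ []) ∷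
  step (2 ∷ 2 ∷ 0 ∷ 1 ∷ []) (# 3) (# 3) (1 ∷ 5 ∷ 5 ∷ 1 ∷ [])
    (0̂ ∷ (K 20 ⋆ x₀ ⋆ x₀ ⋆ x₁ ⋆ x₁ ⊹ K -50 ⋆ x₀ ⋆ x₀ ⋆ x₁ ⋆ x₂ ⊹ K 20 ⋆ x₀ ⋆ x₀ ⋆ x₂ ⋆ x₂ ⊹ K 20 ⋆ x₀ ⋆ x₁ ⋆ x₁ ⋆ x₁ ⊹ K -60 ⋆ x₀ ⋆ x₁ ⋆ x₁ ⋆ x₂ ⊹ K 45 ⋆ x₀ ⋆ x₁ ⋆ x₂ ⋆ x₂ ⊹ K -10 ⋆ x₀ ⋆ x₂ ⋆ x₂ ⋆ x₂ ⊹ K -14 ⋆ x₁ ⋆ x₁ ⋆ x₁ ⋆ x₁ ⊹ K 39 ⋆ x₁ ⋆ x₁ ⋆ x₁ ⋆ x₂ ⊹ K -26 ⋆ x₁ ⋆ x₁ ⋆ x₂ ⋆ x₂ ⊹ K 9 ⋆ x₁ ⋆ x₂ ⋆ x₂ ⋆ x₂ ⊹ K -2 ⋆ x₂ ⋆ x₂ ⋆ x₂ ⋆ x₂) ∷ (K 8 ⋆ x₀ ⋆ x₀ ⊹ K 23 ⋆ x₀ ⋆ x₁ ⊹ K -10 ⋆ x₀ ⋆ x₂ ⊹ x₁ ⋆ x₁ ⊹ K 7 ⋆ x₁ ⋆ x₂ ⊹ K -2 ⋆ x₂ ⋆ x₂) ∷ 0̂ ∷ []) ∷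
  step (2 ∷ 1 ∷ 2 ∷ 1 ∷ []) (# 3) (# 1) (1 ∷ 1 ∷ 1 ∷ 1 ∷ [])
    (0̂ ∷ 0̂ ∷ 0̂ ∷ 0̂ ∷ []) ∷
  step (2 ∷ 0 ∷ 1 ∷ 1 ∷ []) (# 3) (# 1) (1 ∷ 1 ∷ 3 ∷ 1 ∷ [])
    (0̂ ∷ 0̂ ∷ (K 1) ∷ 0̂ ∷ []) ∷
  step (1 ∷ 0 ∷ 1 ∷ 1 ∷ []) (# 3) (# 2) (1 ∷ 1 ∷ 1 ∷ 1 ∷ [])
    (0̂ ∷ (x₀ ⊹ x₁ ⊹ K -1 ⋆ x₂) ∷ 0̂ ∷ 0̂ ∷ []) ∷
  step (0 ∷ 1 ∷ -1 ∷ 0 ∷ []) (# 2) (# 2) (1 ∷ 6 ∷ 1 ∷ 6 ∷ [])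
    (0̂ ∷ (K -4 ⋆ x₀ ⋆ x₀ ⊹ K -11 ⋆ x₀ ⋆ x₁ ⊹ K -5 ⋆ x₀ ⋆ x₃ ⊹ K -6 ⋆ x₁ ⋆ x₁ ⊹ K -5 ⋆ x₁ ⋆ x₃ ⊹ K -1 ⋆ x₃ ⋆ x₃) ∷ 0̂ ∷ (K 1) ∷ []) ∷
  step (1 ∷ -1 ∷ 1 ∷ 0 ∷ []) (# 2) (# 3) (1 ∷ 2 ∷ 1 ∷ 1 ∷ [])
    (0̂ ∷ (K -3 ⋆ x₀ ⋆ x₀ ⋆ x₁ ⊹ K -1 ⋆ x₀ ⋆ x₀ ⋆ x₃ ⊹ K -12 ⋆ x₀ ⋆ x₁ ⋆ x₁ ⊹ K -7 ⋆ x₀ ⋆ x₁ ⋆ x₃ ⊹ K -1 ⋆ x₀ ⋆ x₃ ⋆ x₃ ⊹ K -9 ⋆ x₁ ⋆ x₁ ⋆ x₁ ⊹ K -6 ⋆ x₁ ⋆ x₁ ⋆ x₃ ⊹ K -1 ⋆ x₁ ⋆ x₃ ⋆ x₃) ∷ (K -1 ⋆ x₀ ⊹ K 10 ⋆ x₁ ⊹ K 3 ⋆ x₃) ∷ 0̂ ∷ []) ∷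
  step (1 ∷ 1 ∷ 0 ∷ 0 ∷ []) (# 1) (# 1) (1 ∷ 1 ∷ 1 ∷ 1 ∷ [])
    (0̂ ∷ 0̂ ∷ 0̂ ∷ 0̂ ∷ []) ∷
  step (2 ∷ 2 ∷ 1 ∷ 1 ∷ []) (# 3) (# 1) (1 ∷ 1 ∷ 1 ∷ 1 ∷ [])
    (0̂ ∷ 0̂ ∷ (K 4) ∷ 0̂ ∷ []) ∷
  step (1 ∷ 2 ∷ 0 ∷ 1 ∷ []) (# 3) (# 1) (1 ∷ 1 ∷ 2 ∷ 2 ∷ [])
    (0̂ ∷ 0̂ ∷ (K 7 ⋆ x₀ ⊹ K 3 ⋆ x₁ ⊹ K 4 ⋆ x₂) ∷ (K 1) ∷ []) ∷
  step (2 ∷ 1 ∷ 0 ∷ 1 ∷ []) (# 3) (# 3) (1 ∷ 3 ∷ 3 ∷ 1 ∷ [])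
    (0̂ ∷ (K 2 ⋆ x₁ ⊹ x₂) ∷ (x₀ ⋆ x₀ ⊹ K 7 ⋆ x₀ ⋆ x₁ ⊹ K 2 ⋆ x₀ ⋆ x₂ ⊹ K 4 ⋆ x₁ ⋆ x₁ ⊹ K 4 ⋆ x₁ ⋆ x₂) ∷ 0̂ ∷ []) ∷
  step (0 ∷ 0 ∷ 1 ∷ 0 ∷ []) (# 2) (# 1) (1 ∷ 1 ∷ 2 ∷ 2 ∷ [])
    (0̂ ∷ 0̂ ∷ (K 3 ⋆ x₀ ⋆ x₀ ⊹ K 4 ⋆ x₀ ⋆ x₁ ⊹ x₀ ⋆ x₃ ⊹ x₁ ⋆ x₁ ⊹ x₁ ⋆ x₃) ∷ (K 3) ∷ []) ∷
  step (1 ∷ 1 ∷ 1 ∷ 0 ∷ []) (# 2) (# 2) (1 ∷ 1 ∷ 1 ∷ 1 ∷ [])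
    (0̂ ∷ 0̂ ∷ 0̂ ∷ 0̂ ∷ []) ∷
  step (1 ∷ 0 ∷ 0 ∷ 0 ∷ []) (# 0) (# 2) (1 ∷ 1 ∷ 1 ∷ 1 ∷ [])
    (0̂ ∷ 0̂ ∷ 0̂ ∷ (K -1) ∷ []) ∷
  step (0 ∷ 1 ∷ 0 ∷ 1 ∷ []) (# 3) (# 3) (1 ∷ 2 ∷ 2 ∷ 1 ∷ [])
    (0̂ ∷ (K 2 ⋆ x₁ ⊹ x₂) ∷ (K -1 ⋆ x₁ ⊹ x₂) ∷ 0̂ ∷ []) ∷
  step (1 ∷ -1 ∷ 0 ∷ 0 ∷ []) (# 1) (# 1) (1 ∷ 1 ∷ 1 ∷ 1 ∷ [])
    (0̂ ∷ 0̂ ∷ (K -1 ⋆ x₀) ∷ (K 1) ∷ []) ∷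
  step (2 ∷ 1 ∷ 1 ∷ 1 ∷ []) (# 3) (# 3) (1 ∷ 1 ∷ 1 ∷ 1 ∷ [])
    (0̂ ∷ (K -3 ⋆ x₁ ⊹ K -1 ⋆ x₂) ∷ (K 2 ⋆ x₀ ⋆ x₁ ⊹ K -1 ⋆ x₁ ⋆ x₁ ⊹ x₁ ⋆ x₂) ∷ 0̂ ∷ []) ∷
  step (1 ∷ 0 ∷ 1 ∷ 0 ∷ []) (# 2) (# 3) (1 ∷ 1 ∷ 1 ∷ 1 ∷ [])
    ((K -1 ⋆ x₃) ∷ (K -2 ⋆ x₁ ⋆ x₁ ⊹ K -1 ⋆ x₁ ⋆ x₃) ∷ (K -2 ⋆ x₀ ⋆ x₁ ⋆ x₁ ⊹ K -1 ⋆ x₀ ⋆ x₁ ⋆ x₃ ⊹ K -2 ⋆ x₁ ⋆ x₁ ⋆ x₁ ⊹ K -3 ⋆ x₁ ⋆ x₁ ⋆ x₃ ⊹ K -1 ⋆ x₁ ⋆ x₃ ⋆ x₃) ∷ 0̂ ∷ []) ∷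
  step (0 ∷ 1 ∷ 0 ∷ 0 ∷ []) (# 1) (# 2) (1 ∷ 1 ∷ 1 ∷ 1 ∷ [])
    (0̂ ∷ 0̂ ∷ 0̂ ∷ 0̂ ∷ []) ∷
  step (1 ∷ 2 ∷ 1 ∷ 1 ∷ []) (# 3) (# 2) (1 ∷ 1 ∷ 1 ∷ 1 ∷ [])
    (0̂ ∷ (K -2 ⋆ x₁ ⊹ K -1 ⋆ x₂) ∷ 0̂ ∷ 0̂ ∷ []) ∷
  step (1 ∷ 1 ∷ 0 ∷ 1 ∷ []) (# 3) (# 2) (1 ∷ 1 ∷ 1 ∷ 1 ∷ [])
    ((K -1 ⋆ x₂) ∷ 0̂ ∷ 0̂ ∷ 0̂ ∷ []) ∷
  step (0 ∷ 1 ∷ 1 ∷ 0 ∷ []) (# 2) (# 1) (1 ∷ 1 ∷ 1 ∷ 1 ∷ [])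
    (0̂ ∷ 0̂ ∷ 0̂ ∷ 0̂ ∷ []) ∷
  step (1 ∷ 0 ∷ 0 ∷ 1 ∷ []) (# 3) (# 1) (1 ∷ 1 ∷ 1 ∷ 1 ∷ [])
    ((K -1 ⋆ x₁ ⊹ K -1 ⋆ x₂) ∷ 0̂ ∷ (K 1) ∷ 0̂ ∷ []) ∷
  step (1 ∷ 1 ∷ 1 ∷ 1 ∷ []) (# 3) (# 0) (1 ∷ 1 ∷ 1 ∷ 1 ∷ [])
    (0̂ ∷ (K 1) ∷ (K 1) ∷ (K 1) ∷ []) ∷ []

steps-valid : T (steps-ok steps)
steps-valid = tt

-- The restriction B and the derivations θ₂, θ₃

power : ℕ → Ex 3
power zero          = K 1
power (suc zero)    = X (# 2)
power (suc (suc d)) = X (# 2) ⋆ power (suc d)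

-- An exhausted list stands for zero coefficients. The factor `power d` makes this zero formally of
-- degree `d`, so that the syntactic homogeneity test accepts the sum.
binary : ℕ → List ℤ → Ex 3
binary d       []       = K 0 ⋆ power d
binary zero    (c ∷ cs) = K c
binary (suc d) (c ∷ cs) = K c ⋆ power (suc d) ⊹ X (# 1) ⋆ binary d cs

-- Σ c_ij x^i y^j z^(d-i-j), from the rows c_i
ternary : ℕ → List (List ℤ) → Ex 3
ternary d       []       = K 0 ⋆ power d
ternary zero    (r ∷ rs) = binary zero r
ternary (suc d) (r ∷ rs) = binary (suc d) r ⊹ X (# 0) ⋆ ternary d rs

θ₂ᴱ θ₃ᴱ : Vec (Ex 3) 3
θ₂ᴱ =
  ternary 11
    ( []
    ∷ []
    ∷ []
    ∷ (0 ∷ 0 ∷ -211 ∷ 281 ∷ 351 ∷ -421 ∷ [])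
    ∷ (0 ∷ -632 ∷ 912 ∷ 1194 ∷ -984 ∷ -630 ∷ [])
    ∷ (-337 ∷ 491 ∷ 1995 ∷ -287 ∷ -2325 ∷ -335 ∷ [])
    ∷ (0 ∷ 1854 ∷ 344 ∷ -3168 ∷ -1620 ∷ 252 ∷ [])
    ∷ (650 ∷ 128 ∷ -2258 ∷ -2922 ∷ 924 ∷ [])
    ∷ (0 ∷ -1090 ∷ -2204 ∷ 1212 ∷ [])
    ∷ (-289 ∷ -583 ∷ 756 ∷ [])
    ∷ (0 ∷ 264 ∷ [])
    ∷ (48 ∷ []) ∷ []) ∷
  ternary 11
    ( (0 ∷ 0 ∷ 0 ∷ 0 ∷ 0 ∷ 84 ∷ -140 ∷ -52 ∷ 60 ∷ 16 ∷ -16 ∷ [])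
    ∷ (0 ∷ 0 ∷ 0 ∷ 0 ∷ 210 ∷ -350 ∷ -322 ∷ 70 ∷ 216 ∷ -24 ∷ -48 ∷ [])
    ∷ (0 ∷ 0 ∷ 0 ∷ -211 ∷ 281 ∷ -321 ∷ -701 ∷ 748 ∷ 312 ∷ -336 ∷ [])
    ∷ (0 ∷ 0 ∷ -842 ∷ 1262 ∷ 844 ∷ -1334 ∷ 364 ∷ 1232 ∷ -828 ∷ [])
    ∷ (0 ∷ -421 ∷ 631 ∷ 2527 ∷ -147 ∷ -1989 ∷ 1177 ∷ -624 ∷ [])
    ∷ (0 ∷ 0 ∷ 2526 ∷ 624 ∷ -3784 ∷ -1676 ∷ 924 ∷ [])
    ∷ (0 ∷ 842 ∷ 208 ∷ -3226 ∷ -4474 ∷ 2268 ∷ [])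
    ∷ (0 ∷ 0 ∷ -1684 ∷ -3356 ∷ 1680 ∷ [])
    ∷ (0 ∷ -421 ∷ -839 ∷ 420 ∷ []) ∷ []) ∷
  ternary 11
    ( (4 ∷ -10 ∷ -12 ∷ 40 ∷ 56 ∷ -126 ∷ [])
    ∷ (0 ∷ -57 ∷ 130 ∷ 176 ∷ -434 ∷ -63 ∷ [])
    ∷ (-57 ∷ 130 ∷ 97 ∷ -447 ∷ -160 ∷ 209 ∷ [])
    ∷ (0 ∷ -158 ∷ -26 ∷ 11 ∷ 1186 ∷ -315 ∷ [])
    ∷ (-79 ∷ -13 ∷ 518 ∷ 2513 ∷ -946 ∷ -839 ∷ [])
    ∷ (0 ∷ 615 ∷ 2304 ∷ -949 ∷ -3356 ∷ [])
    ∷ (205 ∷ 768 ∷ -321 ∷ -5034 ∷ [])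
    ∷ (0 ∷ -4 ∷ -3356 ∷ [])
    ∷ (-1 ∷ -839 ∷ []) ∷ []) ∷ []
θ₃ᴱ =
  ternary 11
    ( []
    ∷ []
    ∷ []
    ∷ (0 ∷ 0 ∷ -1104 ∷ 719 ∷ -1206 ∷ 1591 ∷ [])
    ∷ (0 ∷ -1053 ∷ -487 ∷ -204 ∷ 2514 ∷ 770 ∷ [])
    ∷ (-411 ∷ -436 ∷ 4263 ∷ -1183 ∷ 2130 ∷ -667 ∷ [])
    ∷ (0 ∷ 4083 ∷ -1619 ∷ 204 ∷ -1128 ∷ -308 ∷ [])
    ∷ (1152 ∷ -283 ∷ -2807 ∷ 266 ∷ -528 ∷ [])
    ∷ (0 ∷ -2172 ∷ 588 ∷ 396 ∷ [])
    ∷ (-477 ∷ 125 ∷ 968 ∷ [])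
    ∷ (0 ∷ 528 ∷ [])
    ∷ (96 ∷ []) ∷ []) ∷
  ternary 11
    ( (0 ∷ 0 ∷ 0 ∷ 0 ∷ 0 ∷ -462 ∷ 770 ∷ 330 ∷ -770 ∷ 44 ∷ 264 ∷ -80 ∷ [])
    ∷ (0 ∷ 0 ∷ 0 ∷ 0 ∷ -1155 ∷ 1925 ∷ 2079 ∷ -3465 ∷ -220 ∷ 1716 ∷ -528 ∷ [])
    ∷ (0 ∷ 0 ∷ 0 ∷ -1104 ∷ 719 ∷ 3183 ∷ -3799 ∷ -1683 ∷ 3872 ∷ -1188 ∷ [])
    ∷ (0 ∷ 0 ∷ 102 ∷ -2412 ∷ 2106 ∷ 589 ∷ -2541 ∷ 2772 ∷ -704 ∷ [])
    ∷ (0 ∷ 51 ∷ -1206 ∷ 798 ∷ 3437 ∷ -257 ∷ -2515 ∷ 1188 ∷ [])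
    ∷ (0 ∷ 0 ∷ -306 ∷ 3771 ∷ 1359 ∷ -4824 ∷ 1848 ∷ [])
    ∷ (0 ∷ -102 ∷ 1257 ∷ 691 ∷ -1846 ∷ 616 ∷ [])
    ∷ (0 ∷ 0 ∷ 204 ∷ -204 ∷ [])
    ∷ (0 ∷ 51 ∷ -51 ∷ []) ∷ []) ∷
  ternary 11
    ( (8 ∷ 0 ∷ -110 ∷ 110 ∷ -66 ∷ 154 ∷ [])
    ∷ (0 ∷ -66 ∷ -55 ∷ 165 ∷ 231 ∷ 77 ∷ [])
    ∷ (-66 ∷ -55 ∷ 18 ∷ 26 ∷ -744 ∷ 821 ∷ [])
    ∷ (0 ∷ -294 ∷ -410 ∷ -1128 ∷ 1359 ∷ 385 ∷ [])
    ∷ (-147 ∷ -205 ∷ 721 ∷ -28 ∷ 1206 ∷ -51 ∷ [])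
    ∷ (0 ∷ 1542 ∷ -849 ∷ 1359 ∷ -204 ∷ [])
    ∷ (514 ∷ -283 ∷ 691 ∷ -306 ∷ [])
    ∷ (0 ∷ 204 ∷ -204 ∷ [])
    ∷ (51 ∷ -51 ∷ []) ∷ []) ∷ []

lines : Vec (Vec ℤ 3 × Fin 3) 23
lines =
  ((0 ∷ 0 ∷ 1 ∷ []) , # 2) ∷
  ((0 ∷ 1 ∷ -1 ∷ []) , # 1) ∷
  ((0 ∷ 1 ∷ 0 ∷ []) , # 1) ∷
  ((0 ∷ 1 ∷ 1 ∷ []) , # 1) ∷
  ((1 ∷ -1 ∷ 0 ∷ []) , # 0) ∷
  ((1 ∷ -1 ∷ 1 ∷ []) , # 0) ∷
  ((1 ∷ 0 ∷ -1 ∷ []) , # 0) ∷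
  ((1 ∷ 0 ∷ 0 ∷ []) , # 0) ∷
  ((1 ∷ 0 ∷ 1 ∷ []) , # 0) ∷
  ((1 ∷ 0 ∷ 2 ∷ []) , # 0) ∷
  ((1 ∷ 1 ∷ -2 ∷ []) , # 0) ∷
  ((1 ∷ 1 ∷ -1 ∷ []) , # 0) ∷
  ((1 ∷ 1 ∷ 0 ∷ []) , # 0) ∷
  ((1 ∷ 1 ∷ 1 ∷ []) , # 0) ∷
  ((1 ∷ 2 ∷ -1 ∷ []) , # 0) ∷
  ((1 ∷ 2 ∷ 0 ∷ []) , # 0) ∷
  ((2 ∷ 0 ∷ -1 ∷ []) , # 2) ∷
  ((2 ∷ 0 ∷ 1 ∷ []) , # 2) ∷
  ((2 ∷ 1 ∷ -1 ∷ []) , # 1) ∷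
  ((2 ∷ 1 ∷ 0 ∷ []) , # 1) ∷
  ((2 ∷ 1 ∷ 1 ∷ []) , # 1) ∷
  ((2 ∷ 2 ∷ -1 ∷ []) , # 2) ∷
  ((2 ∷ 2 ∷ 1 ∷ []) , # 2) ∷ []

-- the line to which a hyperplane restricts, and the factor of proportionality;
-- the entry for the hyperplane restricted to is irrelevant
restriction : Vec (Fin 23 × ℤ) 34
restriction =
  (# 0 , 1) ∷ (# 8 , 1) ∷ (# 11 , 1) ∷ (# 0 , -1) ∷ (# 6 , 1) ∷ (# 10 , 1) ∷ (# 13 , 1) ∷ (# 9 , 1)
  ∷ (# 17 , 1) ∷ (# 22 , 1) ∷ (# 16 , 1) ∷ (# 21 , 1) ∷ (# 20 , 1) ∷ (# 7 , 2) ∷ (# 7 , 1) ∷ (# 1 , 1)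
  ∷ (# 5 , 1) ∷ (# 12 , 1) ∷ (# 12 , 2) ∷ (# 14 , 1) ∷ (# 18 , 1) ∷ (# 0 , 1) ∷ (# 13 , 1) ∷ (# 7 , 1)
  ∷ (# 1 , 1) ∷ (# 4 , 1) ∷ (# 19 , 1) ∷ (# 8 , 1) ∷ (# 2 , 1) ∷ (# 15 , 1) ∷ (# 11 , 1) ∷ (# 3 , 1)
  ∷ (# 6 , 1) ∷ (# 12 , 1) ∷ []

section : Vec (Fin 34) 23
section =
  # 3 ∷ # 15 ∷ # 28 ∷ # 31 ∷ # 25 ∷ # 16 ∷ # 4 ∷ # 13 ∷ # 1 ∷ # 7 ∷ # 5 ∷ # 2 ∷ # 17 ∷ # 6 ∷ # 19 ∷ # 29 ∷ # 10 ∷ # 8 ∷ # 20 ∷ # 26 ∷ # 12 ∷ # 11 ∷ # 9 ∷ []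

-- The counterexample

module 𝒜 = Chain steps steps-valid tt tt

A : Arrangement 4
A = 𝒜.arrangement

normalᴮ : Fin 23 → Vec ℤ 3
normalᴮ k = proj₁ (lookup lines k)

pivotᴮ : Fin 23 → Fin 3
pivotᴮ k = proj₂ (lookup lines k)

B : Arrangement 3
B = integral normalᴮ pivotᴮ tt tt

module ℛ = Restriction {33} (λ k → normal (List.lookup steps k)) normalᴮ
  (λ k → proj₁ (lookup restriction k)) (λ k → proj₂ (lookup restriction k)) (lookup section)

κ : Multiplicity B
κ = ℛ.multiplicity

isZieglerRestriction : IsZieglerRestriction A fzero B κ
isZieglerRestriction = record
  { pivot = ℛ.last
  ; pivot≢0 = λ ()
  ; f = λ k → proj₁ (lookup restriction k)
  ; f-restrict = ℛ.restricts tt tt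
  ; f-onto = ℛ.onto tt tt
  ; κ-count = λ y → refl }

certificate : Certificate 23
certificate = record
  { normalOf = normalᴮ
  ; pivotOf = pivotᴮ
  ; mult = κ
  ; deg = 11
  ; η₂ = θ₂ᴱ
  ; η₃ = θ₃ᴱ
  -- The point `p₀` and the parameters `t₁`, `t₂` are mere samples; that they are generic enough is
  -- verified by `det-ok` and `lines-ok`.
  ; p₀ = 3 ∷ 7 ∷ 19 ∷ []
  ; t₁ = 17
  ; t₂ = 41 }

-- Sealed, so that later uses of `valid` do not unfold the computation.
opaque
  valid : Check.Valid certificate
  valid = record { lines-ok = tt ; det-ok = tt ; hom₂-ok = tt ; hom₃-ok = tt ; mult-ok = tt ; size-ok = refl ; excess-ok = tt }

setting : Setting 23
setting = Certified.setting certificate valid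

B-not-additivelyFree : ¬ AdditivelyFree B κ
B-not-additivelyFree = not-additively-free B κ (Setting.1≤κ setting) fzero
  (λ μ μ′ k 1≤μ μ≤κ μk≡1 μ′k≡0 μ′≡μ free → let m , φ , basis = Free⇒ B μ′ free in
    Rank3.Between.Deleted.not-free setting μ 1≤μ μ≤κ k μk≡1 μ′ μ′k≡0 μ′≡μ φ basis)

theorem1p9 : Σ ℕ λ ℓ → Σ (Arrangement (suc ℓ)) λ A → AdditivelyFreeArr A × Σ (Fin (n A)) λ z → Σ (Arrangement ℓ) λ B → Σ (Multiplicity B) λ κ → IsZieglerRestriction A z B κ × ¬ AdditivelyFree B κ
theorem1p9 = 3 , A , 𝒜.additivelyFree , fzero , B , κ , isZieglerRestriction , B-not-additivelyFree
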